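{- Let $G$ be a finite simple graph, let $\theta$ be a real number, and let $X \subseteq V(G)$ with $|X|>1$. The following are equivalent: (a) $X$ is a maximal $\theta$-Tutte set in $G$ (i.e. a $\theta$-Tutte set not properly contained in another $\theta$-Tutte set); (b) $X$ is a maximal $\theta$-extreme set in $G$; (c) $X$ is a maximal $\theta$-nice set in $G$, i.e. $X$ induces a maximal complete subgraph of $D_{2,\theta}(G)$.
   Context: For a graph $G$ on $n$ vertices let $p(G,r)$ be the number of $r$-matchings of $G$ (sets of $r$ pairwise disjoint edges), $p(G,0)=1$, and let $\mu(G,x)=\sum_{r=0}^{\lfloor n/2\rfloor}(-1)^r p(G,r)x^{n-2r}$ be the matching polynomial (the graph with no vertices has $\mu=1$). For real $\theta$, $\textnormal{mult}(\theta,G)$ denotes the multiplicity of $\theta$ as a root of $\mu(G,x)$ (it is $0$ if $\theta$ is not a root). For $X\subseteq V(G)$ or vertices $u,v$, $G\setminus X$, $G\setminus uv$ denote the graphs obtained by deleting these vertices and all incident edges. A vertex $u$ is $\theta$-essential in $G$ if $\textnormal{mult}(\theta,G\setminus u)=\textnormal{mult}(\theta,G)-1$. A connected graph is $\theta$-critical if every vertex of it is $\theta$-essential in it; $c_\theta(G)$ is the number of connected components of $G$ that are $\theta$-critical. A set $X\subseteq V(G)$ is a $\theta$-Tutte set if $c_\theta(G\setminus X)=\textnormal{mult}(\theta,G)+|X|$, and a $\theta$-extreme set if $\textnormal{mult}(\theta,G\setminus X)=\textnormal{mult}(\theta,G)+|X|$. The graph $D_{2,\theta}(G)$ has vertex set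 $V(G)$, two distinct vertices $u,v$ being adjacent iff $\textnormal{mult}(\theta,G\setminus uv)=\textnormal{mult}(\theta,G)+2$. A set $X$ with $|X|>1$ is $\theta$-nice if $\textnormal{mult}(\theta,G\setminus uv)=\textnormal{mult}(\theta,G)+2$ for all distinct $u,v\in X$. -}

module Defs where

open import Level using (0ℓ)
open import Data.Bool using (Bool; true; false; _∧_; _∨_; not; if_then_else_)
open import Data.Nat as ℕ using (ℕ; zero; suc; _∸_)
open import Data.Nat.DivMod using (_/_; _%_)
open import Data.Fin as Fin using (Fin; toℕ)
open import Data.Fin.Subset using (Subset; ⁅_⁆; _∪_; _∩_; _⊂_; _∈_; ∁; ∣_∣; ⊤) renaming (_-_ to _⊝_)
open import Data.Integer as ℤ using (ℤ; +_; -[1+_])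
open import Data.List as List using (List; []; _∷_; length; filter; map; upTo; allFin; concatMap; reverse)
open import Data.Bool.ListAction using (any; all)
open import Data.Vec as Vec using (Vec; lookup; tabulate)
open import Data.Product using (_×_; _,_; ∃; Σ; proj₁; proj₂)
open import Relation.Nullary using (¬_; does)
open import Relation.Nullary.Decidable using (⌊_⌋)
open import Relation.Binary.PropositionalEquality using (_≡_)
open import Relation.Binary.Core using (Rel)
open import Relation.Binary.Structures using (IsStrictTotalOrder)
open import Algebra.Bundles using (CommutativeRing)
open import Function.Base using (_∘_)
open import Data.Sum using (_⊎_)

record RealField : Set₁ where
  field
    commRing : CommutativeRing 0ℓ 0ℓ
  open CommutativeRing commRing public
  field
    _<_ : Rel Carrier 0ℓ
    isStrictTotalOrder : IsStrictTotalOrder _≈_ _<_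
    1≉0 : ¬ (1# ≈ 0#)
    inverse : ∀ x → ¬ (x ≈ 0#) → ∃ λ y → (x * y) ≈ 1#
    +-mono-< : ∀ {x y} z → x < y → (x + z) < (y + z)
    *-pos : ∀ {x y} → 0# < x → 0# < y → 0# < (x * y)
    completeness : (P : Carrier → Set) → ∃ P →
                   (∃ λ b → ∀ x → P x → (x < b) ⊎ (x ≈ b)) →
                   ∃ λ s → (∀ x → P x → (x < s) ⊎ (x ≈ s)) ×
                           (∀ b → (∀ x → P x → (x < b) ⊎ (x ≈ b)) → (s < b) ⊎ (s ≈ b))
  open IsStrictTotalOrder isStrictTotalOrder public using (_≟_)

record Graph (n : ℕ) : Set where
  field
    adj    : Fin n → Fin n → Bool
    sym    : ∀ i j → adj i j ≡ adj j i
    irrefl : ∀ i → adj i i ≡ false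
open Graph public

sublists : {A : Set} → List A → List (List A)
sublists [] = [] ∷ []
sublists (x ∷ xs) = let r = sublists xs in r List.++ map (x ∷_) r

module _ {n : ℕ} (G : Graph n) where

  -- For S ⊆ V(G), G[S] is the induced subgraph; G \ X = G[∁ X].

  edges : Subset n → List (Fin n × Fin n)
  edges S = concatMap (λ i → map (i ,_)
              (filter (λ j → (toℕ i ℕ.<? toℕ j)) (allFin n)))
              (filter (λ i → Data.Bool._≟_ (lookup S i) true) (allFin n))
    where import Data.Bool
  edges' : Subset n → List (Fin n × Fin n)
  edges' S = filter (λ e → Data.Bool._≟_ (lookup S (proj₂ e) ∧ adj G (proj₁ e) (proj₂ e)) true) (edges S)
    where import Data.Bool

  disjointB : Fin n × Fin n → Fin n × Fin n → Bool
  disjointB (a , b) (c , d) =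
    not (⌊ a Fin.≟ c ⌋ ∨ ⌊ a Fin.≟ d ⌋ ∨ ⌊ b Fin.≟ c ⌋ ∨ ⌊ b Fin.≟ d ⌋)

  pairwiseDisjointB : List (Fin n × Fin n) → Bool
  pairwiseDisjointB [] = true
  pairwiseDisjointB (e ∷ es) = all (disjointB e) es ∧ pairwiseDisjointB es

  numMatchings : Subset n → ℕ → List.List (Fin n × Fin n) → ℕ
  numMatchings S r es = length (filter (λ M → Data.Bool._≟_ (⌊ length M ℕ.≟ r ⌋ ∧ pairwiseDisjointB M) true) (sublists es))
    where import Data.Bool

  p : Subset n → ℕ → ℕ
  p S r = numMatchings S r (edges' S)

  -- μ(G[S], x) = Σ_r (-1)^r p(G[S],r) x^{|S|-2r}, as an integer
  -- coefficient list, lowest degree first, of length |S|+1.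
  μ : Subset n → List ℤ
  μ S = map coeff (upTo (suc ∣ S ∣))
    where
    coeff : ℕ → ℤ
    coeff k with (∣ S ∣ ∸ k) % 2
    ... | zero  = let r = (∣ S ∣ ∸ k) / 2 in
                  if ⌊ r % 2 ℕ.≟ 0 ⌋ then + p S r else ℤ.- (+ p S r)
    ... | suc _ = + 0

  step : Subset n → Subset n → Subset n
  step S T = T ∪ (S ∩ tabulate (λ j → any (λ i → lookup T i ∧ adj G i j) (allFin n)))

  iter : ℕ → Subset n → Subset n → Subset n
  iter zero    S T = T
  iter (suc k) S T = iter k S (step S T)

  component : Subset n → Fin n → Subset n
  component S v = iter n S ⁅ v ⁆

module WithReals (R : RealField) where
  open RealField R

  fromℕ : ℕ → Carrier
  fromℕ zero    = 0#
  fromℕ (suc k) = 1# + fromℕ k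

  fromℤ : ℤ → Carrier
  fromℤ (+ k)     = fromℕ k
  fromℤ -[1+ k ]  = - fromℕ (suc k)

  -- synthetic division by (x - θ) of a coefficient list (lowest degree
  -- first): returns quotient and remainder, p = (x-θ) q + r.
  divLin : Carrier → List Carrier → List Carrier × Carrier
  divLin θ [] = [] , 0#
  divLin θ (a ∷ as) with divLin θ as
  ... | q , r = r ∷ q , a + θ * r

  -- multiplicity of θ as a root: the largest k such that (x-θ)^k divides
  -- the polynomial, computed by repeated division (fuel = #coefficients,
  -- which bounds the multiplicity for a nonzero polynomial).
  multFuel : ℕ → Carrier → List Carrier → ℕ
  multFuel zero    θ f = 0
  multFuel (suc k) θ f with divLin θ f
  ... | q , r = if ⌊ r ≟ 0# ⌋ then suc (multFuel k θ q) else 0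

  multPoly : Carrier → List Carrier → ℕ
  multPoly θ f = multFuel (length f) θ f

  module _ {n : ℕ} (G : Graph n) (θ : Carrier) where

    mult : Subset n → ℕ
    mult S = multPoly θ (map fromℤ (μ G S))

    -- G[T] (assumed connected) is θ-critical: every vertex is θ-essential,
    -- i.e. mult(θ, G[T] \ u) = mult(θ, G[T]) - 1 for all u ∈ T
    criticalB : Subset n → Bool
    criticalB T = all (λ u → if lookup T u then ⌊ suc (mult (T ⊝ u)) ℕ.≟ mult T ⌋ else true) (allFin n)

    leastInComp : Subset n → Fin n → Bool
    leastInComp S v = all (λ u → if ⌊ toℕ u ℕ.<? toℕ v ⌋ then not (lookup (component G S v) u) else true) (allFin n)

    cθ : Subset n → ℕ
    cθ S = length (filter (λ v → Data.Bool._≟_ (lookup S v ∧ leastInComp S v ∧ criticalB (component G S v)) true) (allFin n))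
      where import Data.Bool

    IsTutte : Subset n → Set
    IsTutte X = cθ (∁ X) ≡ mult ⊤ ℕ.+ ∣ X ∣

    IsExtreme : Subset n → Set
    IsExtreme X = mult (∁ X) ≡ mult ⊤ ℕ.+ ∣ X ∣

    IsNice : Subset n → Set
    IsNice X = (1 ℕ.< ∣ X ∣) ×
      (∀ u v → u ∈ X → v ∈ X → ¬ (u ≡ v) → mult ((⊤ ⊝ u) ⊝ v) ≡ mult ⊤ ℕ.+ 2)

    Maximal : (Subset n → Set) → Subset n → Set
    Maximal P X = P X × (∀ Y → X ⊂ Y → ¬ P Y)

{-# OPTIONS --safe #-}

-- Let F(S) be the Taylor expansion of μ(G[S], x) at x = θ, so that mult(θ, G[S]) is the order of F(S).
-- The Heilmann–Lieb identity exhibits F(S-u) F(S-w) - F(S) F(S-u-w) as a sum of squares; hence it has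
-- even order, and that order is at most twice the order of F(S-u-w) when u and w are adjacent.  The same
-- is true when the vertices carry different weights; raising the weight of a third vertex z by one
-- replaces F(S) by F(S) + F(S-z).  Comparing orders in these identities gives:
--
-- * interlacing, through the Wronskian Σ_v (F(S-v) F(S-u) - F(S) F(S-v-u)) + F(S-u)²;
-- * a neighbour of an essential vertex is essential or positive (its deletion raises the multiplicity);
-- * for essential u, v, the relation mult(G-u-v) ≥ mult(G) - 1 is transitive.  It holds for adjacent
--   vertices, so in a critical connected graph it holds for all pairs; then G-u has no essential
--   vertex, i.e. mult(G) = 1 (Gallai's lemma);
-- * three vertices that are pairwise extreme form an extreme set, so nice sets are extreme.
--
-- By Gallai's lemma c_θ ≤ mult, with equality if no vertex is positive.  Thus Tutte sets are extreme,
-- and adding positive vertices to an extreme set as long as possible produces a Tutte set.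
module Submission where

-- No root is ever located and no sign near θ is examined. A sum of squares of series has, at its
-- first nonzero coefficient, an even exponent and a positive value. So whenever the two products in
-- a Heilmann-Lieb identity have different orders, the smaller order is even, and most
-- configurations of multiplicities that must be excluded are excluded because it would be odd.
--
-- Parity says nothing when the two products have the same order. This is what the weights are for:
-- passing from F(S) to F(S) + F(S - z) lowers the order exactly where deleting z lowers the
-- multiplicity, and for a suitable z one product then acquires an odd order below that of the
-- other. To make the identity available for the changed family, it is proved for every family that
-- satisfies the vertex recurrence with weights depending on the vertex. Differences are written as
-- d + f = g throughout, which keeps the algebra within commutative semirings.

-- Finite vertex sets and the deletion of a vertex.

module Subsets where

  open import Data.Bool using (true; false; _∧_)
  open import Data.Nat using (ℕ; suc)
  open import Data.Fin as Fin using (Fin; zero; suc)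
  open import Data.Fin.Subset
  open import Data.Fin.Subset.Properties
  open import Data.Vec using (_∷_; lookup; here; there)
  open import Data.Vec.Properties using ([]=⇒lookup; lookup⇒[]=)
  open import Data.Product using (_×_; _,_; proj₁; proj₂)
  open import Data.Sum using (inj₁; inj₂)
  open import Data.Empty using (⊥-elim)
  open import Function.Base using (_∘_)
  open import Relation.Binary.PropositionalEquality

  private
    variable
      n : ℕ
      p q : Subset n
      x y : Fin n

  lookup-true : x ∈ p → lookup p x ≡ true
  lookup-true = []=⇒lookup

  lookup-true⁻ : lookup p x ≡ true → x ∈ p
  lookup-true⁻ {p = p} {x = x} = lookup⇒[]= x p

  lookup-false : x ∉ p → lookup p x ≡ false
  lookup-false {x = x} {p = p} x∉p with lookup p x in eq
  ... | false = refl
  ... | true  = ⊥-elim (x∉p (lookup-true⁻ eq))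

  lookup-false⁻ : lookup p x ≡ false → x ∉ p
  lookup-false⁻ eq x∈p with trans (sym eq) (lookup-true x∈p)
  ... | ()

  x∉p-x : ∀ (p : Subset n) x → x ∉ p - x
  x∉p-x (s ∷ p) zero    ()
  x∉p-x (s ∷ p) (suc x) (there x∈) = x∉p-x p x x∈

  ∈-⁻ : x ∈ p - y → x ∈ p × x ≢ y
  ∈-⁻ {p = p} {y = y} x∈ = p─q⊆p p ⁅ y ⁆ x∈ , λ { refl → x∉p-x p y x∈ }

  lookup-delete : ∀ (p : Subset n) {x y} → x ≢ y → lookup (p - y) x ≡ lookup p x
  lookup-delete p {x} {y} x≢y with lookup p x in eq
  ... | true  = lookup-true {p = p - y} (x∈p∧x≢y⇒x∈p-y (lookup-true⁻ {p = p} eq) x≢y)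
  ... | false = lookup-false {p = p - y} λ x∈ → lookup-false⁻ {p = p} eq (proj₁ (∈-⁻ {p = p} x∈))

  lookup-delete-same : ∀ (p : Subset n) x → lookup (p - x) x ≡ false
  lookup-delete-same p x = lookup-false (x∉p-x p x)

  ⊆-⁺ : p ⊆ q → x ∉ p → p ⊆ q - x
  ⊆-⁺ p⊆q x∉p y∈p = x∈p∧x≢y⇒x∈p-y (p⊆q y∈p) λ { refl → x∉p y∈p }

  ∣p∣≡1+∣p-x∣ : x ∈ p → ∣ p ∣ ≡ suc ∣ p - x ∣
  ∣p∣≡1+∣p-x∣ {p = inside ∷ p}  here       = cong (suc ∘ ∣_∣) (sym (p─⊥≡p p))
  ∣p∣≡1+∣p-x∣ {p = inside ∷ p}  (there x∈) = cong suc (∣p∣≡1+∣p-x∣ x∈)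
  ∣p∣≡1+∣p-x∣ {p = outside ∷ p} (there x∈) = ∣p∣≡1+∣p-x∣ x∈

  ∪-delete : ∀ (p q : Subset n) {x} → x ∉ q → (p ∪ q) - x ≡ (p - x) ∪ q
  ∪-delete p q {x} x∉q = ⊆-antisym to from
    where
    to : (p ∪ q) - x ⊆ (p - x) ∪ q
    to y∈ with ∈-⁻ y∈
    ... | y∈∪ , y≢x with x∈p∪q⁻ p q y∈∪
    ... | inj₁ y∈p = x∈p∪q⁺ (inj₁ (x∈p∧x≢y⇒x∈p-y y∈p y≢x))
    ... | inj₂ y∈q = x∈p∪q⁺ (inj₂ y∈q)
    from : (p - x) ∪ q ⊆ (p ∪ q) - x
    from y∈ with x∈p∪q⁻ (p - x) q y∈
    ... | inj₁ y∈p = x∈p∧x≢y⇒x∈p-y (x∈p∪q⁺ (inj₁ (proj₁ (∈-⁻ y∈p)))) (proj₂ (∈-⁻ y∈p))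
    ... | inj₂ y∈q = x∈p∧x≢y⇒x∈p-y (x∈p∪q⁺ (inj₂ y∈q)) λ { refl → x∉q y∈q }

  ∧-true : ∀ {b c} → b ∧ c ≡ true → b ≡ true × c ≡ true
  ∧-true {true} {true} _ = refl , refl

-- Formal power series over a commutative ring, and the Euler operator.

module Series where

  open import Level using (0ℓ)
  open import Algebra.Bundles using (CommutativeRing)
  open import Data.Nat as ℕ using (ℕ; zero; suc; z≤n; s≤s)
  open import Function.Base using (_∘_)
  open import Relation.Binary.PropositionalEquality as ≡ using (_≡_)
  open import Data.Product using (_,_)
  open import Data.Sum using (inj₁; inj₂)
  import Data.Nat.Properties as ℕ

  module PowerSeries (C : CommutativeRing 0ℓ 0ℓ) where
    open CommutativeRing C
    open import Relation.Binary.Reasoning.Setoid setoid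
    open import Algebra.Solver.Ring.NaturalCoefficients.Default commutativeSemiring
      using (solve; _:=_; _:+_; _:*_)
    open import Algebra.Properties.Semiring.Mult semiring using (_×_; ×-congʳ; ×-comm-*)
    open import Algebra.Properties.CommutativeMonoid.Mult +-commutativeMonoid using (×-distrib-+)

    -- The Cauchy product, by a recursion on the degree that shifts only the left factor. `conv-suc`
    -- is the mirror recursion, and commutativity results from playing one against the other.
    conv : (ℕ → Carrier) → (ℕ → Carrier) → ℕ → Carrier
    conv f g zero    = f 0 * g 0
    conv f g (suc n) = f 0 * g (suc n) + conv (f ∘ suc) g n

    conv-cong : ∀ {f f′ g g′} → (∀ i → f i ≈ f′ i) → (∀ i → g i ≈ g′ i) → ∀ n → conv f g n ≈ conv f′ g′ n
    conv-cong p q zero    = *-cong (p 0) (q 0)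
    conv-cong p q (suc n) = +-cong (*-cong (p 0) (q (suc n))) (conv-cong (p ∘ suc) q n)

    conv-distribʳ : ∀ f g h n → conv (λ i → f i + g i) h n ≈ conv f h n + conv g h n
    conv-distribʳ f g h zero    = distribʳ _ _ _
    conv-distribʳ f g h (suc n) = trans (+-congˡ (conv-distribʳ (f ∘ suc) (g ∘ suc) h n))
      (solve 5 (λ a b c u v → (a :+ b) :* c :+ (u :+ v) := (a :* c :+ u) :+ (b :* c :+ v)) refl _ _ _ _ _)

    conv-scale : ∀ c f g n → conv (λ i → c * f i) g n ≈ c * conv f g n
    conv-scale c f g zero    = *-assoc _ _ _
    conv-scale c f g (suc n) = trans (+-congˡ (conv-scale c (f ∘ suc) g n))
      (solve 4 (λ c a b u → c :* a :* b :+ c :* u := c :* (a :* b :+ u)) refl _ _ _ _)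

    conv-suc : ∀ f g n → conv f g (suc n) ≈ conv f (g ∘ suc) n + f (suc n) * g 0
    conv-suc f g zero    = refl
    conv-suc f g (suc n) = trans (+-congˡ (conv-suc (f ∘ suc) g n)) (sym (+-assoc _ _ _))

    conv-comm : ∀ f g n → conv f g n ≈ conv g f n
    conv-comm f g zero    = *-comm _ _
    conv-comm f g (suc n) = begin
      f 0 * g (suc n) + conv (f ∘ suc) g n  ≈⟨ +-comm _ _ ⟩
      conv (f ∘ suc) g n + f 0 * g (suc n)  ≈⟨ +-cong (conv-comm (f ∘ suc) g n) (*-comm _ _) ⟩
      conv g (f ∘ suc) n + g (suc n) * f 0  ≈⟨ conv-suc g f n ⟨
      conv g f (suc n)                      ∎

    conv-assoc : ∀ f g h n → conv (conv f g) h n ≈ conv f (conv g h) n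
    conv-assoc f g h zero    = *-assoc _ _ _
    conv-assoc f g h (suc n) = begin
      f 0 * g 0 * h (suc n) + conv (λ i → f 0 * g (suc i) + conv (f ∘ suc) g i) h n
        ≈⟨ +-congˡ (conv-distribʳ (λ i → f 0 * g (suc i)) (conv (f ∘ suc) g) h n) ⟩
      f 0 * g 0 * h (suc n) + (conv (λ i → f 0 * g (suc i)) h n + conv (conv (f ∘ suc) g) h n)
        ≈⟨ +-congˡ (+-cong (conv-scale (f 0) (g ∘ suc) h n) (conv-assoc (f ∘ suc) g h n)) ⟩
      f 0 * g 0 * h (suc n) + (f 0 * conv (g ∘ suc) h n + conv (f ∘ suc) (conv g h) n)
        ≈⟨ solve 5 (λ a b c u v → a :* b :* c :+ (a :* u :+ v) := a :* (b :* c :+ u) :+ v) refl _ _ _ _ _ ⟩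
      f 0 * (g 0 * h (suc n) + conv (g ∘ suc) h n) + conv (f ∘ suc) (conv g h) n ∎

    -- Records rather than bare functions, so that Agda can infer series from equations between them.
    record Series : Set where
      constructor series
      field coeff : ℕ → Carrier
    open Series public

    infix 4 _≋_
    record _≋_ (f g : Series) : Set where
      constructor pointwise
      field at : ∀ i → coeff f i ≈ coeff g i
    open _≋_ public

    constant : Carrier → ℕ → Carrier
    constant c zero    = c
    constant c (suc _) = 0#

    conv-zeroˡ : ∀ g n → conv (λ _ → 0#) g n ≈ 0#
    conv-zeroˡ g zero    = zeroˡ _
    conv-zeroˡ g (suc n) = trans (+-cong (zeroˡ _) (conv-zeroˡ g n)) (+-identityˡ _)

    conv-constant : ∀ c g n → conv (constant c) g n ≈ c * g n
    conv-constant c g zero    = refl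
    conv-constant c g (suc n) = trans (+-congˡ (conv-zeroˡ g n)) (+-identityʳ _)

    conv-identityˡ : ∀ g n → conv (constant 1#) g n ≈ g n
    conv-identityˡ g n = trans (conv-constant 1# g n) (*-identityˡ _)

    seriesRing : CommutativeRing 0ℓ 0ℓ
    seriesRing = record
      { Carrier = Series
      ; _≈_ = _≋_
      ; _+_ = λ f g → series (λ i → coeff f i + coeff g i)
      ; _*_ = λ f g → series (conv (coeff f) (coeff g))
      ; -_  = λ f → series (λ i → - coeff f i)
      ; 0#  = series (λ _ → 0#)
      ; 1#  = series (constant 1#)
      ; isCommutativeRing = record
        { isRing = record
          { +-isAbelianGroup = record
            { isGroup = record
              { isMonoid = record
                { isSemigroup = record
                  { isMagma = record
                    { isEquivalence = record
                      { refl  = pointwise λ _ → refl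
                      ; sym   = λ p → pointwise λ i → sym (at p i)
                      ; trans = λ p q → pointwise λ i → trans (at p i) (at q i)
                      }
                    ; ∙-cong = λ p q → pointwise λ i → +-cong (at p i) (at q i)
                    }
                  ; assoc = λ _ _ _ → pointwise λ _ → +-assoc _ _ _
                  }
                ; identity = (λ _ → pointwise λ _ → +-identityˡ _) , (λ _ → pointwise λ _ → +-identityʳ _)
                }
              ; inverse = (λ _ → pointwise λ _ → -‿inverseˡ _) , (λ _ → pointwise λ _ → -‿inverseʳ _)
              ; ⁻¹-cong = λ p → pointwise λ i → -‿cong (at p i)
              }
            ; comm = λ _ _ → pointwise λ _ → +-comm _ _
            }
          ; *-cong = λ p q → pointwise (conv-cong (at p) (at q))
          ; *-assoc = λ f g h → pointwise (conv-assoc (coeff f) (coeff g) (coeff h))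
          ; *-identity = (λ f → pointwise (conv-identityˡ (coeff f)))
                       , (λ f → pointwise λ i → trans (conv-comm (coeff f) _ i) (conv-identityˡ (coeff f) i))
          ; distrib = (λ f g h → pointwise λ i → trans (conv-comm (coeff f) _ i)
                        (trans (conv-distribʳ (coeff g) (coeff h) (coeff f) i)
                          (+-cong (conv-comm (coeff g) _ i) (conv-comm (coeff h) _ i))))
                    , (λ f g h → pointwise (conv-distribʳ (coeff g) (coeff h) (coeff f)))
          }
        ; *-comm = λ f g → pointwise (conv-comm (coeff f) (coeff g))
        }
      }

    module 𝕊 = CommutativeRing seriesRing

    shift : (ℕ → Carrier) → ℕ → Carrier
    shift f zero    = 0#
    shift f (suc n) = f n

    t : Series
    t = series (shift (constant 1#))

    coeff-t* : ∀ f n → coeff (t 𝕊.* f) n ≈ shift (coeff f) n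
    coeff-t* f zero    = zeroˡ _
    coeff-t* f (suc n) = trans (+-cong (zeroˡ _) (conv-identityˡ (coeff f) n)) (+-identityˡ _)

    C⟨_⟩ : Carrier → Series
    C⟨ c ⟩ = series (constant c)

    coeff-C* : ∀ c f n → coeff (C⟨ c ⟩ 𝕊.* f) n ≈ c * coeff f n
    coeff-C* c f n = conv-constant c (coeff f) n

    -- The operator t d/dt in place of d/dt: it preserves degrees, so it acts on each coefficient
    -- separately and never lowers the order of a series.
    euler : Series → Series
    euler f = series (λ i → i × coeff f i)

    euler-cong : ∀ {f g} → f ≋ g → euler f ≋ euler g
    euler-cong p = pointwise λ i → ×-congʳ i (at p i)

    euler-+ : ∀ f g → euler (f 𝕊.+ g) ≋ euler f 𝕊.+ euler g
    euler-+ f g = pointwise λ i → ×-distrib-+ _ _ i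

    euler-0 : euler 𝕊.0# ≋ 𝕊.0#
    euler-0 = pointwise λ i → ×0 i
      where
      ×0 : ∀ i → i × 0# ≈ 0#
      ×0 zero    = refl
      ×0 (suc i) = trans (+-identityˡ _) (×0 i)

    euler-C : ∀ c → euler C⟨ c ⟩ ≋ 𝕊.0#
    euler-C c = pointwise λ { zero → refl ; (suc i) → at euler-0 (suc i) }

    euler-C* : ∀ c f → euler (C⟨ c ⟩ 𝕊.* f) ≋ C⟨ c ⟩ 𝕊.* euler f
    euler-C* c f = pointwise λ i → begin
      i × coeff (C⟨ c ⟩ 𝕊.* f) i ≈⟨ ×-congʳ i (coeff-C* c f i) ⟩
      i × (c * coeff f i)        ≈⟨ ×-comm-* i c (coeff f i) ⟨
      c * (i × coeff f i)        ≈⟨ coeff-C* c (euler f) i ⟨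
      coeff (C⟨ c ⟩ 𝕊.* euler f) i ∎

    euler-t* : ∀ f → euler (t 𝕊.* f) ≋ t 𝕊.* f 𝕊.+ t 𝕊.* euler f
    euler-t* f = pointwise λ i → trans (×-congʳ i (coeff-t* f i))
      (trans (go i) (sym (+-cong (coeff-t* f i) (coeff-t* (euler f) i))))
      where
      go : ∀ i → i × shift (coeff f) i ≈ shift (coeff f) i + shift (coeff (euler f)) i
      go zero    = sym (+-identityˡ _)
      go (suc i) = refl

    infixl 6 _+t
    _+t : Carrier → Series
    c +t = C⟨ c ⟩ 𝕊.+ t

    -- The Leibniz rule for a linear factor, whose own Euler derivative is t. This is the product on
    -- the right of the vertex recurrence.
    euler-+t* : ∀ c f → euler ((c +t) 𝕊.* f) ≋ t 𝕊.* f 𝕊.+ (c +t) 𝕊.* euler f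
    euler-+t* c f = 𝕊.trans (euler-cong (𝕊.distribʳ f C⟨ c ⟩ t))
      (𝕊.trans (euler-+ (C⟨ c ⟩ 𝕊.* f) (t 𝕊.* f))
      (𝕊.trans (𝕊.+-cong (euler-C* c f) (euler-t* f))
        (solve𝕊 4 (λ a b x y → a :⊛ y :⊕ (b :⊛ x :⊕ b :⊛ y) :≃ b :⊛ x :⊕ (a :⊕ b) :⊛ y) 𝕊.refl C⟨ c ⟩ t f (euler f))))
      where
      open import Algebra.Solver.Ring.NaturalCoefficients.Default 𝕊.commutativeSemiring
        using () renaming (solve to solve𝕊; _:=_ to _:≃_; _:+_ to _:⊕_; _:*_ to _:⊛_)

    Vanishes : ℕ → Series → Set
    Vanishes k f = ∀ i → i ℕ.< k → coeff f i ≈ 0#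

    conv-vanishesʳ : ∀ l f g → (∀ i → i ℕ.< l → g i ≈ 0#) → ∀ i → i ℕ.< l → conv f g i ≈ 0#
    conv-vanishesʳ l f g v zero    i<l = trans (*-congˡ (v 0 i<l)) (zeroʳ _)
    conv-vanishesʳ l f g v (suc i) i<l = trans (+-cong (trans (*-congˡ (v (suc i) i<l)) (zeroʳ _))
      (conv-vanishesʳ l (f ∘ suc) g v i (ℕ.≤-trans (ℕ.n≤1+n _) i<l))) (+-identityˡ _)

    conv-vanishes : ∀ k l f g → (∀ i → i ℕ.< k → f i ≈ 0#) → (∀ i → i ℕ.< l → g i ≈ 0#) →
                    ∀ i → i ℕ.< k ℕ.+ l → conv f g i ≈ 0#
    conv-vanishes zero    l f g u v i i<l = conv-vanishesʳ l f g v i i<l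
    conv-vanishes (suc k) l f g u v zero i< = trans (*-congʳ (u 0 (s≤s z≤n))) (zeroˡ _)
    conv-vanishes (suc k) l f g u v (suc i) (s≤s i<) = trans (+-cong (trans (*-congʳ (u 0 (s≤s z≤n))) (zeroˡ _))
      (conv-vanishes k l (f ∘ suc) g (λ j j<k → u (suc j) (s≤s j<k)) v i i<)) (+-identityˡ _)

    -- Every other product in the convolution has a factor of index below k or below l.
    conv-lead : ∀ k l f g → (∀ i → i ℕ.< k → f i ≈ 0#) → (∀ i → i ℕ.< l → g i ≈ 0#) →
                conv f g (k ℕ.+ l) ≈ f k * g l
    conv-lead zero    zero    f g u v = refl
    conv-lead zero    (suc l) f g u v = trans (+-congˡ (conv-vanishesʳ (suc l) (f ∘ suc) g v l ℕ.≤-refl))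
        (+-identityʳ _)
    conv-lead (suc k) l       f g u v = trans (+-cong (trans (*-congʳ (u 0 (s≤s z≤n))) (zeroˡ _))
      (conv-lead k l (f ∘ suc) g (λ j j<k → u (suc j) (s≤s j<k)) v)) (+-identityˡ _)

    vanishes-cong : ∀ {k f g} → f ≋ g → Vanishes k f → Vanishes k g
    vanishes-cong p v i i<k = trans (sym (at p i)) (v i i<k)

    vanishes-≤ : ∀ {k l f} → k ℕ.≤ l → Vanishes l f → Vanishes k f
    vanishes-≤ k≤l v i i<k = v i (ℕ.≤-trans i<k k≤l)

    vanishes-+ : ∀ {k f g} → Vanishes k f → Vanishes k g → Vanishes k (f 𝕊.+ g)
    vanishes-+ u v i i<k = trans (+-cong (u i i<k) (v i i<k)) (+-identityˡ _)

    vanishes-* : ∀ {k l} f g → Vanishes k f → Vanishes l g → Vanishes (k ℕ.+ l) (f 𝕊.* g)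
    vanishes-* f g = conv-vanishes _ _ (coeff f) (coeff g)

    vanishes-suc : ∀ {k f} → Vanishes k f → coeff f k ≈ 0# → Vanishes (suc k) f
    vanishes-suc {k} u z i i<1+k with ℕ.m≤n⇒m<n∨m≡n (ℕ.≤-pred i<1+k)
    ... | inj₁ i<k    = u i i<k
    ... | inj₂ ≡.refl = z

-- Orders of series over an ordered field; sums of squares have even order.

module Orders where

  open import Defs using (RealField)
  open Series
  open import Data.Nat as ℕ using (ℕ; zero; suc; s≤s)
  import Data.Nat.Properties as ℕ
  open import Data.Product using (_×_; _,_; ∃)
  open import Data.Sum using (_⊎_; inj₁; inj₂)
  open import Data.Empty using (⊥-elim)
  open import Relation.Nullary using (¬_; yes; no)
  open import Relation.Binary.PropositionalEquality as ≡ using (_≡_)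
  open import Relation.Binary.Structures using (IsStrictTotalOrder)
  open import Relation.Binary.Definitions using (tri<; tri≈; tri>)

  module Ordered (R : RealField) where
    open RealField R renaming (_<_ to infix 4 _<ᴿ_)
    private module O = IsStrictTotalOrder isStrictTotalOrder
    open PowerSeries commRing
    open import Relation.Binary.Reasoning.Setoid setoid
    open import Algebra.Properties.Ring ring using (-‿distribˡ-*; -‿distribʳ-*; -‿involutive)
    open import Algebra.Properties.Semiring.Mult semiring using (×-congʳ; ×-assoc-*; ×-comm-*) renaming (_×_ to _⊠_)

    0<⇒≉0 : ∀ {x} → 0# <ᴿ x → ¬ x ≈ 0#
    0<⇒≉0 0<x x≈0 = O.irrefl (sym x≈0) 0<x

    <0⇒0<- : ∀ {x} → x <ᴿ 0# → 0# <ᴿ - x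
    <0⇒0<- {x} x<0 = O.<-respʳ-≈ (+-identityˡ _) (O.<-respˡ-≈ (-‿inverseʳ x) (+-mono-< (- x) x<0))

    +-pos : ∀ {x y} → 0# <ᴿ x → 0# <ᴿ y → 0# <ᴿ x + y
    +-pos {x} {y} 0<x 0<y = O.trans 0<y (O.<-respˡ-≈ (+-identityˡ y) (+-mono-< y 0<x))

    square-pos : ∀ {x} → ¬ x ≈ 0# → 0# <ᴿ x * x
    square-pos {x} x≉0 with O.compare 0# x
    ... | tri< 0<x _ _ = *-pos 0<x 0<x
    ... | tri≈ _ 0≈x _ = ⊥-elim (x≉0 (sym 0≈x))
    ... | tri> _ _ x<0 = O.<-respʳ-≈ (begin
        (- x) * (- x)     ≈⟨ -‿distribˡ-* x (- x) ⟨
        - (x * (- x))   ≈⟨ -‿cong (sym (-‿distribʳ-* x x)) ⟩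
        - (- (x * x)) ≈⟨ -‿involutive (x * x) ⟩
        x * x         ∎) (*-pos (<0⇒0<- x<0) (<0⇒0<- x<0))

    *-≉0 : ∀ {x y} → ¬ x ≈ 0# → ¬ y ≈ 0# → ¬ x * y ≈ 0#
    *-≉0 {x} {y} x≉0 y≉0 xy≈0 with inverse x x≉0
    ... | z , xz≈1 = y≉0 (begin
      y            ≈⟨ *-identityˡ y ⟨
      1# * y       ≈⟨ *-congʳ xz≈1 ⟨
      x * z * y    ≈⟨ *-congʳ (*-comm x z) ⟩
      z * x * y    ≈⟨ *-assoc z x y ⟩
      z * (x * y)  ≈⟨ *-congˡ xy≈0 ⟩
      z * 0#       ≈⟨ zeroʳ z ⟩
      0#           ∎)

    ⊠-pos : ∀ n {x} → 0# <ᴿ x → 0# <ᴿ suc n ⊠ x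
    ⊠-pos zero    0<x = O.<-respʳ-≈ (sym (+-identityʳ _)) 0<x
    ⊠-pos (suc n) 0<x = +-pos 0<x (⊠-pos n 0<x)

    ⊠-neg : ∀ n x → n ⊠ (- x) + n ⊠ x ≈ 0#
    ⊠-neg n x = trans (sym (×-distrib-+ (- x) x n)) (trans (×-congʳ n (-‿inverseˡ x)) (at euler-0 n))
      where open import Algebra.Properties.CommutativeMonoid.Mult +-commutativeMonoid using (×-distrib-+)

    ⊠-≉0 : ∀ n {x} → ¬ x ≈ 0# → ¬ suc n ⊠ x ≈ 0#
    ⊠-≉0 n {x} x≉0 nx≈0 with O.compare 0# x
    ... | tri< 0<x _ _ = 0<⇒≉0 (⊠-pos n 0<x) nx≈0
    ... | tri≈ _ 0≈x _ = x≉0 (sym 0≈x)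
    ... | tri> _ _ x<0 = 0<⇒≉0 (⊠-pos n (<0⇒0<- x<0))
                           (trans (sym (+-identityʳ _)) (trans (+-congˡ (sym nx≈0)) (⊠-neg (suc n) x)))

    +-cancelˡ : ∀ x {y z} → x + y ≈ x + z → y ≈ z
    +-cancelˡ x {y} {z} = ∙-cancelˡ x y z
      where open import Algebra.Properties.Group +-group using (∙-cancelˡ)

    -- Characteristic zero in a subtraction-free form: `ord-wronskian` needs that the factor k - l
    -- does not kill its leading coefficient.
    ⊠-injective : ∀ m n {x} → ¬ x ≈ 0# → m ⊠ x ≈ n ⊠ x → m ≡ n
    ⊠-injective zero    zero    x≉0 e = ≡.refl
    ⊠-injective zero    (suc n) x≉0 e = ⊥-elim (⊠-≉0 n x≉0 (sym e))
    ⊠-injective (suc m) zero    x≉0 e = ⊥-elim (⊠-≉0 m x≉0 e)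
    ⊠-injective (suc m) (suc n) x≉0 e = ≡.cong suc (⊠-injective m n x≉0 (+-cancelˡ _ e))

    -- A relation and not a function, because it is not decidable whether a series is zero.
    record Ord (k : ℕ) (f : Series) : Set where
      constructor ord
      field
        vanishes : Vanishes k f
        leading  : ¬ coeff f k ≈ 0#
    open Ord public

    vanishes⇒≤ord : ∀ {k l f} → Vanishes k f → Ord l f → k ℕ.≤ l
    vanishes⇒≤ord v o = ℕ.≮⇒≥ λ l<k → leading o (v _ l<k)

    ord-cong : ∀ {k f g} → f ≋ g → Ord k f → Ord k g
    ord-cong p (ord v l) = ord (vanishes-cong p v) λ z → l (trans (at p _) z)

    ord-* : ∀ {k l f g} → Ord k f → Ord l g → Ord (k ℕ.+ l) (f 𝕊.* g)
    ord-* {k} {l} {f} {g} (ord u a) (ord v b) =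
      ord (vanishes-* f g u v) λ z → *-≉0 a b (trans (sym (conv-lead k l (coeff f) (coeff g) u v)) z)

    ord-unique : ∀ {k l f} → Ord k f → Ord l f → k ≡ l
    ord-unique o o′ = ℕ.≤-antisym (vanishes⇒≤ord (vanishes o) o′) (vanishes⇒≤ord (vanishes o′) o)

    private
      x+y≈z⇒y≈0⇒x≈z : ∀ {x y z} → x + y ≈ z → y ≈ 0# → x ≈ z
      x+y≈z⇒y≈0⇒x≈z e y≈0 = trans (trans (sym (+-identityʳ _)) (+-congˡ (sym y≈0))) e

    vanishes-diff : ∀ {k d f g} → d 𝕊.+ f 𝕊.≈ g → Vanishes k f → Vanishes k g → Vanishes k d
    vanishes-diff e u v i i<k = trans (x+y≈z⇒y≈0⇒x≈z (at e i) (u i i<k)) (v i i<k)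

    ord-diffʳ : ∀ {k d f g} → d 𝕊.+ f 𝕊.≈ g → Vanishes (suc k) f → Ord k g → Ord k d
    ord-diffʳ e u (ord v l) = ord (vanishes-diff e (vanishes-≤ (ℕ.n≤1+n _) u) v)
      λ z → l (trans (sym (x+y≈z⇒y≈0⇒x≈z (at e _) (u _ ℕ.≤-refl))) z)

    ord-diffˡ : ∀ {k d f g} → d 𝕊.+ f 𝕊.≈ g → Ord k f → Vanishes (suc k) g → Ord k d
    ord-diffˡ e (ord u l) v = ord (vanishes-diff e u (vanishes-≤ (ℕ.n≤1+n _) v))
      λ z → l (trans (x+y≈z⇒y≈0⇒x≈z (trans (+-comm _ _) (at e _)) z) (v _ ℕ.≤-refl))

    -- The trace that being a sum of squares leaves on the leading term: even exponent and positive
    -- coefficient. Quantifying over every k below which d vanishes covers the zero series without a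
    -- case distinction between zero and nonzero.
    EvenPositive : Series → Set
    EvenPositive d = ∀ k → Vanishes k d → (coeff d k ≈ 0#) ⊎ ((0# <ᴿ coeff d k) × ∃ λ j → k ≡ j ℕ.+ j)

    evenPositive-0 : EvenPositive 𝕊.0#
    evenPositive-0 k v = inj₁ refl

    even-order : ∀ {k d} → EvenPositive d → Ord k d → ∃ λ j → k ≡ j ℕ.+ j
    even-order P (ord v l) with P _ v
    ... | inj₁ z       = ⊥-elim (l z)
    ... | inj₂ (_ , j) = j

    private
      no-cancellation : ∀ {k d e} → EvenPositive d → EvenPositive e → Vanishes k d → Vanishes k e →
                        coeff (d 𝕊.+ e) k ≈ 0# → (coeff d k ≈ 0#) × (coeff e k ≈ 0#)
      no-cancellation {k} P Q u v z with P k u | Q k v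
      ... | inj₁ a       | inj₁ b       = a , b
      ... | inj₁ a       | inj₂ (b , _) = ⊥-elim (0<⇒≉0 b (trans (sym (trans (+-congʳ a) (+-identityˡ _))) z))
      ... | inj₂ (a , _) | inj₁ b       = ⊥-elim (0<⇒≉0 a (trans (sym (trans (+-congˡ b) (+-identityʳ _))) z))
      ... | inj₂ (a , _) | inj₂ (b , _) = ⊥-elim (0<⇒≉0 (+-pos a b) z)

    -- Positive leading coefficients at the same exponent cannot cancel. This turns an identity for
    -- a sum of squares into a bound on the order of each single square in it.
    vanishes-summands : ∀ {d e} → EvenPositive d → EvenPositive e → ∀ k →
                        Vanishes k (d 𝕊.+ e) → Vanishes k d × Vanishes k e
    vanishes-summands P Q zero    v = (λ _ ()) , (λ _ ())
    vanishes-summands {d} {e} P Q (suc k) v with vanishes-summands P Q k (vanishes-≤ {f = d 𝕊.+ e} (ℕ.n≤1+n k) v)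
    ... | a , b with no-cancellation P Q a b (v k ℕ.≤-refl)
    ... | x , y = vanishes-suc {f = d} a x , vanishes-suc {f = e} b y

    evenPositive-+ : ∀ {d e} → EvenPositive d → EvenPositive e → EvenPositive (d 𝕊.+ e)
    evenPositive-+ {d} {e} P Q k v with vanishes-summands P Q k v
    ... | a , b with P k a | Q k b
    ... | inj₁ x       | inj₁ y       = inj₁ (trans (+-cong x y) (+-identityˡ _))
    ... | inj₁ x       | inj₂ (y , j) = inj₂ (O.<-respʳ-≈ (trans (sym (+-identityˡ _)) (+-congʳ (sym x))) y , j)
    ... | inj₂ (x , j) | inj₁ y       = inj₂ (O.<-respʳ-≈ (trans (sym (+-identityʳ _)) (+-congˡ (sym y))) x , j)
    ... | inj₂ (x , j) | inj₂ (y , _) = inj₂ (+-pos x y , j)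

    private
      square-root-zero : ∀ {x} → x * x ≈ 0# → x ≈ 0#
      square-root-zero {x} xx≈0 with x ≟ 0#
      ... | yes x≈0 = x≈0
      ... | no  x≉0 = ⊥-elim (*-≉0 x≉0 x≉0 xx≈0)

    -- If f vanishes below j, the coefficient of f² at 2j is the square of the coefficient of f at
    -- j, so the vanishing of f² passes to f one exponent at a time.
    vanishes-root : ∀ {f} j → Vanishes (j ℕ.+ j) (f 𝕊.* f) → Vanishes j f
    vanishes-root zero    v i ()
    vanishes-root {f} (suc j) v = vanishes-suc {f = f} u
        (square-root-zero (trans (sym (conv-lead j j (coeff f) (coeff f) u u))
          (v (j ℕ.+ j) (s≤s (ℕ.+-monoʳ-≤ j (ℕ.n≤1+n j))))))
      where u = vanishes-root {f} j (vanishes-≤ {f = f 𝕊.* f} (ℕ.+-mono-≤ (ℕ.n≤1+n j) (ℕ.n≤1+n j)) v)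

    parity : ∀ n → (∃ λ j → n ≡ j ℕ.+ j) ⊎ (∃ λ j → n ≡ suc (j ℕ.+ j))
    parity zero = inj₁ (0 , ≡.refl)
    parity (suc n) with parity n
    ... | inj₁ (j , ≡.refl) = inj₂ (j , ≡.refl)
    ... | inj₂ (j , ≡.refl) = inj₁ (suc j , ≡.cong suc (≡.sym (ℕ.+-suc j j)))

    evenPositive-square : ∀ f → EvenPositive (f 𝕊.* f)
    evenPositive-square f k v with parity k
    ... | inj₁ (j , ≡.refl) with vanishes-root {f} j v
    ...   | u with coeff f j ≟ 0#
    ...     | yes z = inj₁ (trans (conv-lead j j (coeff f) (coeff f) u u) (trans (*-congʳ z) (zeroˡ _)))
    ...     | no ¬z = inj₂ (O.<-respʳ-≈ (sym (conv-lead j j (coeff f) (coeff f) u u)) (square-pos ¬z) , j , ≡.refl)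
    -- At k = 2j + 1 the coefficient of f² at 2j already vanishes, hence f vanishes up to and
    -- including j and f² beyond 2j + 1.
    evenPositive-square f k v | inj₂ (j , ≡.refl) = inj₁
        (vanishes-* f f u u (suc (j ℕ.+ j)) (s≤s (ℕ.≤-reflexive (≡.sym (ℕ.+-suc j j)))))
      where
      w = vanishes-root {f} j (vanishes-≤ {f = f 𝕊.* f} (ℕ.n≤1+n _) v)
      u = vanishes-suc {f = f} w (square-root-zero
          (trans (sym (conv-lead j j (coeff f) (coeff f) w w)) (v (j ℕ.+ j) ℕ.≤-refl)))

    odd≢even : ∀ {k} j → k ≡ suc (j ℕ.+ j) → ¬ (∃ λ i → k ≡ i ℕ.+ i)
    odd≢even zero    ≡.refl (suc i , e) with ≡.trans e (≡.cong suc (ℕ.+-suc i i))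
    ... | ()
    odd≢even (suc j) ≡.refl (suc i , e) = odd≢even j ≡.refl
      (i , ℕ.suc-injective (ℕ.suc-injective
          (≡.trans (≡.cong suc (≡.cong suc (≡.sym (ℕ.+-suc j j)))) (≡.trans e (≡.cong suc (ℕ.+-suc i i))))))

    -- The coefficient of t^(k+l) in E(f) g − f E(g) is (k − l) times the product of the leading coefficients.
    ord-wronskian : ∀ {k l f g} f₁ g₁ w → Ord k f → Ord l g → ¬ k ≡ l →
                    euler f ≋ t 𝕊.* f₁ → euler g ≋ t 𝕊.* g₁ → w 𝕊.+ f 𝕊.* g₁ ≋ f₁ 𝕊.* g →
                    ∀ c → suc c ≡ k ℕ.+ l → Ord c w
    ord-wronskian {k} {l} {f} {g} f₁ g₁ w of og k≢l ef eg e c c≡ =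
        ord (λ i i<c → trans (sym (coeff-t* w (suc i))) (vanishes-diff tw tfg tf₁g (suc i)
                (ℕ.≤-trans (s≤s i<c) (ℕ.≤-reflexive c≡))))
            λ z → k≢l (⊠-injective k l (*-≉0 (leading of) (leading og)) (begin
              k ⊠ (coeff f k * coeff g l)   ≈⟨ ×-assoc-* k _ _ ⟨
              k ⊠ coeff f k * coeff g l     ≈⟨ conv-lead k l _ _ (euler-vanishes of) (vanishes og) ⟨
              coeff (euler f 𝕊.* g) (k ℕ.+ l) ≈⟨ at f′g (k ℕ.+ l) ⟩
              coeff (t 𝕊.* (f₁ 𝕊.* g)) (k ℕ.+ l) ≈⟨ at tw (k ℕ.+ l) ⟨
              coeff (t 𝕊.* w) (k ℕ.+ l) + coeff (t 𝕊.* (f 𝕊.* g₁)) (k ℕ.+ l)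
                 ≈⟨ +-congʳ (trans (reflexive (≡.cong (coeff (t 𝕊.* w)) (≡.sym c≡))) (trans (coeff-t* w (suc c)) z)) ⟩
              0# + coeff (t 𝕊.* (f 𝕊.* g₁)) (k ℕ.+ l) ≈⟨ +-identityˡ _ ⟩
              coeff (t 𝕊.* (f 𝕊.* g₁)) (k ℕ.+ l) ≈⟨ at fg′ (k ℕ.+ l) ⟨
              coeff (f 𝕊.* euler g) (k ℕ.+ l) ≈⟨ conv-lead k l _ _ (vanishes of) (euler-vanishes og) ⟩
              coeff f k * l ⊠ coeff g l  ≈⟨ ×-comm-* l _ _ ⟩
              l ⊠ (coeff f k * coeff g l) ∎))
      where
      euler-vanishes : ∀ {k f} → Ord k f → Vanishes k (euler f)
      euler-vanishes o i i<k = trans (×-congʳ i (vanishes o i i<k)) (at euler-0 i)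

      f′g : euler f 𝕊.* g ≋ t 𝕊.* (f₁ 𝕊.* g)
      f′g = 𝕊.trans (𝕊.*-congʳ ef) (𝕊.*-assoc t f₁ g)

      fg′ : f 𝕊.* euler g ≋ t 𝕊.* (f 𝕊.* g₁)
      fg′ = 𝕊.trans (𝕊.*-congˡ eg) (𝕊.trans (𝕊.sym (𝕊.*-assoc f t g₁))
              (𝕊.trans (𝕊.*-congʳ (𝕊.*-comm f t)) (𝕊.*-assoc t f g₁)))

      -- E(f) and E(g) share the factor t. Splitting it off is what makes the order of w equal to k
      -- + l - 1.
      tw : t 𝕊.* w 𝕊.+ t 𝕊.* (f 𝕊.* g₁) ≋ t 𝕊.* (f₁ 𝕊.* g)
      tw = 𝕊.trans (𝕊.sym (𝕊.distribˡ t w (f 𝕊.* g₁))) (𝕊.*-congˡ e)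

      tfg : Vanishes (k ℕ.+ l) (t 𝕊.* (f 𝕊.* g₁))
      tfg = vanishes-cong fg′ (vanishes-* f (euler g) (vanishes of) (euler-vanishes og))

      tf₁g : Vanishes (k ℕ.+ l) (t 𝕊.* (f₁ 𝕊.* g))
      tf₁g = vanishes-cong f′g (vanishes-* (euler f) g (euler-vanishes of) (vanishes og))

-- The vertex recurrence, disjoint unions, and the Heilmann-Lieb identity.

module Recurrences where

  open import Level using (0ℓ)
  open import Defs using (Graph; adj)
  open Subsets
  open import Algebra.Bundles using (CommutativeRing)
  open import Data.Bool using (Bool; true; false; _∧_; if_then_else_)
  open import Data.Bool.Properties using (∧-zeroʳ)
  open import Data.Nat as ℕ using (ℕ; zero; suc)
  import Data.Nat.Properties as ℕ
  open import Data.Fin as Fin using (Fin; zero; suc)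
  open import Data.Fin.Subset using (Subset; _∈_; _∉_; _∪_; _-_; ∣_∣; ⊥)
  open import Data.Fin.Subset.Properties using (p─x─y≡p─y─x; x∈p∧x≢y⇒x∈p-y; nonempty?; Empty-unique; ∪-identityˡ; x∈p∪q⁺; x∈p∪q⁻; _∈?_)
  open import Data.Vec using (lookup)
  open import Data.Product using (_×_; _,_; ∃; proj₁)
  open import Data.Sum using (inj₁; inj₂)
  open import Data.Empty using (⊥-elim)
  open import Function.Base using (_∘_)
  open import Relation.Nullary using (yes; no)
  open import Relation.Binary.PropositionalEquality as ≡ using (_≡_; _≢_)

  module Recurrence (A : CommutativeRing 0ℓ 0ℓ) {n : ℕ} (G : Graph n) where
    open CommutativeRing A hiding (_-_; zero)
    open import Relation.Binary.Reasoning.Setoid setoid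
    open import Algebra.Properties.Semiring.Sum semiring public
    open import Algebra.Solver.Ring.NaturalCoefficients.Default commutativeSemiring
      using (solve; _:=_; _:+_; _:*_; con)

    +-cancelʳ : ∀ x {y z} → y + x ≈ z + x → y ≈ z
    +-cancelʳ x {y} {z} = ∙-cancelʳ x y z
      where open import Algebra.Properties.Group +-group using (∙-cancelʳ)

    neighbourTerm : (Subset n → Carrier) → Subset n → Fin n → Fin n → Carrier
    neighbourTerm F T u v = if lookup T v ∧ adj G u v then F (T - v) else 0#

    neighbourSum : (Subset n → Carrier) → Subset n → Fin n → Carrier
    neighbourSum F T u = sum (neighbourTerm F T u)

    -- The recurrence μ(S) = x μ(S - u) - Σ μ(S - u - v) over the neighbours v of u, with the
    -- negative terms moved to the left. The weight `y u` stands for x and may differ from vertex to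
    -- vertex.
    Recursive : (Fin n → Carrier) → (Subset n → Carrier) → Set
    Recursive y F = ∀ S u → u ∈ S → F S + neighbourSum F (S - u) u ≈ y u * F (S - u)

    if-cong : ∀ b {x y z : Carrier} → (b ≡ true → x ≈ y) → (if b then x else z) ≈ (if b then y else z)
    if-cong true  e = e ≡.refl
    if-cong false e = refl

    if-+ : ∀ b {x y : Carrier} → (if b then x + y else 0#) ≈ (if b then x else 0#) + (if b then y else 0#)
    if-+ true  = refl
    if-+ false = sym (+-identityˡ 0#)

    if-0 : ∀ b → (if b then 0# else 0#) ≈ 0#
    if-0 true  = refl
    if-0 false = refl

    module _ {y : Fin n → Carrier} {F : Subset n → Carrier} (rec : Recursive y F) (F⊥ : F ⊥ ≈ 1#) where

      private
        -- Expand both sides at a vertex u of C. Its neighbours in the union all lie in C, so every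
        -- term of the expansion keeps the factor `F D`. The bound k is there because the recursion
        -- deletes one or two vertices.
        multiplicative′ : ∀ k C D → ∣ C ∣ ℕ.≤ k → (∀ {x} → x ∈ C → x ∉ D) →
                          (∀ {i j} → i ∈ C → j ∈ D → adj G i j ≡ false) → F (C ∪ D) ≈ F C * F D
        multiplicative′ k C D ∣C∣≤k disjoint noEdge with nonempty? C
        ... | no empty with ≡.refl ← Empty-unique empty =
                trans (reflexive (≡.cong F (∪-identityˡ D))) (sym (trans (*-congʳ F⊥) (*-identityˡ _)))
        multiplicative′ zero C D ∣C∣≤0 disjoint noEdge | yes (u , u∈C)
          with () ← ≡.trans (≡.sym (ℕ.n≤0⇒n≡0 ∣C∣≤0)) (∣p∣≡1+∣p-x∣ u∈C)
        multiplicative′ (suc k) C D ∣C∣≤k disjoint noEdge | yes (u , u∈C) = +-cancelʳ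
            (neighbourSum F (C - u) u * F D) (begin
            F (C ∪ D) + neighbourSum F (C - u) u * F D             ≈⟨ +-congˡ nbs ⟨
            F (C ∪ D) + neighbourSum F ((C ∪ D) - u) u             ≈⟨ rec (C ∪ D) u (x∈p∪q⁺ (inj₁ u∈C)) ⟩
            y u * F ((C ∪ D) - u)                          ≈⟨ *-congˡ (reflexive (≡.cong F eq)) ⟩
            y u * F ((C - u) ∪ D)                          ≈⟨ *-congˡ
                (multiplicative′ k (C - u) D small (disjoint ∘ proj₁ ∘ ∈-⁻) (noEdge ∘ proj₁ ∘ ∈-⁻)) ⟩
            y u * (F (C - u) * F D)                        ≈⟨ *-assoc _ _ _ ⟨
            y u * F (C - u) * F D                          ≈⟨ *-congʳ (rec C u u∈C) ⟨
            (F C + neighbourSum F (C - u) u) * F D         ≈⟨ distribʳ _ _ _ ⟩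
            F C * F D + neighbourSum F (C - u) u * F D     ∎)
          where
          eq : (C ∪ D) - u ≡ (C - u) ∪ D
          eq = ∪-delete C D (disjoint u∈C)
          small : ∣ C - u ∣ ℕ.≤ k
          small = ℕ.≤-pred (ℕ.≤-trans (ℕ.≤-reflexive (≡.sym (∣p∣≡1+∣p-x∣ u∈C))) ∣C∣≤k)
          ∉∪ : ∀ {v} → v ∉ C - u → adj G u v ≡ true → v ∉ (C - u) ∪ D
          ∉∪ v∉ uv v∈∪ with x∈p∪q⁻ (C - u) D v∈∪
          ... | inj₁ v∈ = v∉ v∈
          ... | inj₂ v∈D with () ← ≡.trans (≡.sym uv) (noEdge u∈C v∈D)
          term : ∀ v → (if lookup ((C - u) ∪ D) v ∧ adj G u v then F (((C - u) ∪ D) - v) else 0#)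
                     ≈ (if lookup (C - u) v ∧ adj G u v then F ((C - u) - v) else 0#) * F D
          term v with adj G u v in uv
          ... | false rewrite ∧-zeroʳ (lookup ((C - u) ∪ D) v) | ∧-zeroʳ (lookup (C - u) v) = sym (zeroˡ _)
          ... | true with v ∈? (C - u)
          ...   | yes v∈ rewrite lookup-true v∈ | lookup-true (x∈p∪q⁺ {p = C - u} {q = D} (inj₁ v∈)) =
                    trans (reflexive (≡.cong F (∪-delete (C - u) D (disjoint (proj₁ (∈-⁻ v∈))))))
                          (multiplicative′ k ((C - u) - v) D
                            (ℕ.≤-trans (ℕ.n≤1+n _) (ℕ.≤-trans (ℕ.≤-reflexive (≡.sym (∣p∣≡1+∣p-x∣ v∈))) small))
                            (disjoint ∘ proj₁ ∘ ∈-⁻ ∘ proj₁ ∘ ∈-⁻) (noEdge ∘ proj₁ ∘ ∈-⁻ ∘ proj₁ ∘ ∈-⁻))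
          ...   | no v∉ rewrite lookup-false v∉ | lookup-false {x = v} {p = (C - u) ∪ D} (∉∪ v∉ uv) = sym (zeroˡ _)
          nbs : neighbourSum F ((C ∪ D) - u) u ≈ neighbourSum F (C - u) u * F D
          nbs = trans (reflexive (≡.cong (λ T → neighbourSum F T u) eq))
                  (trans (sum-cong-≋ term) (sym (*-distribʳ-sum (F D) (neighbourTerm F (C - u) u))))

      multiplicative : ∀ C D → (∀ {x} → x ∈ C → x ∉ D) → (∀ {i j} → i ∈ C → j ∈ D → adj G i j ≡ false) →
          F (C ∪ D) ≈ F C * F D
      multiplicative C D = multiplicative′ ∣ C ∣ C D ℕ.≤-refl

    -- `Pos` abstracts from being a sum of squares; it is instantiated later with `EvenPositive`, so
    -- the identity itself is proved without any mention of orders.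
    module HeilmannLieb
      (Pos : Carrier → Set)
      (pos-0 : Pos 0#)
      (pos-+ : ∀ {x y} → Pos x → Pos y → Pos (x + y))
      (pos-square : ∀ x → Pos (x * x))
      where

      pos-sum : ∀ {m} (f : Fin m → Carrier) → (∀ i → Pos (f i)) → Pos (sum f)
      pos-sum {zero}  f p = pos-0
      pos-sum {suc m} f p = pos-+ (p zero) (pos-sum (f ∘ suc) (p ∘ suc))

      pos-sum-split : ∀ {m} (f : Fin m → Carrier) → (∀ i → Pos (f i)) → ∀ i → ∃ λ r → Pos r × sum f ≈ f i + r
      pos-sum-split {suc m} f p zero = sum (f ∘ suc) , pos-sum (f ∘ suc) (p ∘ suc) , refl
      pos-sum-split {suc m} f p (suc i) with pos-sum-split (f ∘ suc) (p ∘ suc) i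
      ... | r , pr , e = f zero + r , pos-+ (p zero) pr ,
            trans (+-congˡ e) (solve 3 (λ a b c → a :+ (b :+ c) := b :+ (a :+ c)) refl _ _ _)

      module _ {y : Fin n → Carrier} {F : Subset n → Carrier} (rec : Recursive y F) where

        -- In the classical identity d is the sum of F(S - P)² over all paths P from u to w. Here
        -- only its positivity is recorded, and, in `edge`, the square that belongs to the path
        -- consisting of a single edge.
        record Identity (S : Subset n) (u w : Fin n) : Set where
          field
            d        : Carrier
            positive : Pos d
            identity : d + F S * F (S - u - w) ≈ F (S - u) * F (S - w)
            edge     : adj G u w ≡ true → ∃ λ r → Pos r × d ≈ F (S - u - w) * F (S - u - w) + r
        open Identity public

        private
          -- The contribution of the vertex v after the first step of a path. `b` and `b′` tell
          -- whether v occurs in the expansion of F(S) and of F(S - w) at u; they can differ only at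
          -- v = w, where the path ends and a square is left over.
          record Term (T : Subset n) (w v : Fin n) (b b′ : Bool) : Set where
            field
              d        : Carrier
              positive : Pos d
              identity : d + F T * (if b′ then F (T - w - v) else 0#) ≈ (if b then F (T - v) else 0#) * F (T - w)
              edge     : v ≡ w → b ≡ true → d ≈ F (T - w) * F (T - w)

          -- Expand F(S) and F(S - w) at u, with T = S - u. The weight of u drops out, and the
          -- difference becomes the sum, over the neighbours v of u, of F(T - v) F(T - w) - F(T) F(T
          -- - w - v). This is a square for v = w and an instance of the same identity in the
          -- smaller set T otherwise.
          heilmannLieb′ : ∀ k S u w → ∣ S ∣ ℕ.≤ k → u ∈ S → w ∈ S → u ≢ w → Identity S u w
          heilmannLieb′ zero S u w ∣S∣≤0 u∈S w∈S u≢w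
            with () ← ≡.trans (≡.sym (ℕ.n≤0⇒n≡0 ∣S∣≤0)) (∣p∣≡1+∣p-x∣ u∈S)
          heilmannLieb′ (suc k) S u w ∣S∣≤k u∈S w∈S u≢w = record
            { d        = sum D
            ; positive = pos-sum D (λ v → Term.positive (term v))
            -- Adding the neighbour terms of F(S - w) to both sides replaces the subtraction of the
            -- two expansions.
            ; identity = +-cancelʳ (F T * Σ′) (begin
                sum D + F S * F (T - w) + F T * Σ′
                  ≈⟨ solve 3 (λ a b c → a :+ b :+ c := b :+ (a :+ c)) refl _ _ _ ⟩
                F S * F (T - w) + (sum D + F T * Σ′)  ≈⟨ +-congˡ summed ⟩
                F S * F (T - w) + Σ₀ * F (T - w)      ≈⟨ distribʳ _ _ _ ⟨
                (F S + Σ₀) * F (T - w)                ≈⟨ *-congʳ (rec S u u∈S) ⟩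
                y u * F T * F (T - w)                 ≈⟨ solve 3 (λ a b c → a :* b :* c := b :* (a :* c)) refl _ _ _ ⟩
                F T * (y u * F (T - w))               ≈⟨ *-congˡ rec-w ⟨
                F T * (F (S - w) + Σ′)                ≈⟨ distribˡ _ _ _ ⟩
                F T * F (S - w) + F T * Σ′            ∎)
            ; edge     = λ uw → let r , pr , e = pos-sum-split D (λ v → Term.positive (term v)) w
                                in r , pr , trans e (+-congʳ (Term.edge (term w) ≡.refl
                                    (≡.cong₂ _∧_ (lookup-true w∈T) uw)))
            }
            where
            T = S - u
            Σ₀ = neighbourSum F T u
            Σ′ = neighbourSum F (T - w) u
            w∈T : w ∈ T
            w∈T = x∈p∧x≢y⇒x∈p-y w∈S (u≢w ∘ ≡.sym)
            small : ∣ T ∣ ℕ.≤ k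
            small = ℕ.≤-pred (ℕ.≤-trans (ℕ.≤-reflexive (≡.sym (∣p∣≡1+∣p-x∣ u∈S))) ∣S∣≤k)
            rec-w : F (S - w) + Σ′ ≈ y u * F (T - w)
            rec-w = ≡.subst (λ Z → F (S - w) + neighbourSum F Z u ≈ y u * F Z) (p─x─y≡p─y─x S w u)
                      (rec (S - w) u (x∈p∧x≢y⇒x∈p-y u∈S u≢w))
            term : ∀ v → Term T w v (lookup T v ∧ adj G u v) (lookup (T - w) v ∧ adj G u v)
            term v with v Fin.≟ w
            ... | yes ≡.refl with adj G u v
            ...   | true  rewrite lookup-delete-same T v | lookup-true w∈T = record
                      { d = F (T - v) * F (T - v) ; positive = pos-square _
                      ; identity = trans (+-congˡ (zeroʳ _)) (+-identityʳ _) ; edge = λ _ _ → refl }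
            ...   | false rewrite lookup-delete-same T v | lookup-true w∈T = record
                      { d = 0# ; positive = pos-0
                      ; identity = trans (+-identityˡ _) (trans (zeroʳ _) (sym (zeroˡ _))) ; edge = λ _ () }
            term v | no v≢w with lookup T v in lv | adj G u v
            ...   | true  | true  rewrite lookup-delete T v≢w | lv =
                      let h = heilmannLieb′ k T v w small (lookup-true⁻ lv) w∈T v≢w in record
                      { d = d h ; positive = positive h
                      ; identity = trans (+-congˡ (*-congˡ (reflexive (≡.cong F (p─x─y≡p─y─x T w v))))) (identity h)
                      ; edge = λ v≡w → ⊥-elim (v≢w v≡w) }
            ...   | true  | false rewrite lookup-delete T v≢w | lv = record
                      { d = 0# ; positive = pos-0
                      ; identity = trans (+-identityˡ _) (trans (zeroʳ _) (sym (zeroˡ _))) ; edge =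
                          λ v≡w → ⊥-elim (v≢w v≡w) }
            ...   | false | _     rewrite lookup-delete T v≢w | lv = record
                      { d = 0# ; positive = pos-0
                      ; identity = trans (+-identityˡ _) (trans (zeroʳ _) (sym (zeroˡ _))) ; edge =
                          λ v≡w → ⊥-elim (v≢w v≡w) }
            D : Fin n → Carrier
            D v = Term.d (term v)
            summed : sum D + F T * Σ′ ≈ Σ₀ * F (T - w)
            summed = trans (+-congˡ (*-distribˡ-sum (F T) (neighbourTerm F (T - w) u))) (trans (sym (∑-distrib-+ D _))
                       (trans (sum-cong-≋ (λ v → Term.identity (term v)))
                           (sym (*-distribʳ-sum (F (T - w)) (neighbourTerm F T u)))))

        heilmannLieb : ∀ S u w → u ∈ S → w ∈ S → u ≢ w → Identity S u w
        heilmannLieb S u w = heilmannLieb′ ∣ S ∣ S u w ℕ.≤-refl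

-- Raising the weight of one vertex.

module Perturbations where

  open import Level using (0ℓ)
  open import Defs using (Graph; adj)
  open Subsets
  open Recurrences
  open import Algebra.Bundles using (CommutativeRing)
  open import Data.Bool using (_∧_; if_then_else_)
  open import Data.Nat using (ℕ)
  open import Data.Fin as Fin using (Fin)
  open import Data.Fin.Subset using (Subset; _∈_; _∉_; _-_)
  open import Data.Fin.Subset.Properties using (p─x─y≡p─y─x; x∈p∧x≢y⇒x∈p-y; _∈?_)
  open import Data.Vec using (lookup)
  open import Data.Product using (proj₁)
  open import Function.Base using (_∘_)
  open import Relation.Nullary using (yes; no; does)
  open import Relation.Binary.PropositionalEquality as ≡ using (_≡_; _≢_)

  module Perturbation (A : CommutativeRing 0ℓ 0ℓ) {n : ℕ} (G : Graph n) where
    open CommutativeRing A hiding (_-_; zero)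
    open import Relation.Binary.Reasoning.Setoid setoid
    open import Algebra.Solver.Ring.NaturalCoefficients.Default commutativeSemiring
      using (solve; _:=_; _:+_; _:*_; con)
    open Recurrence A G

    module _ {y : Fin n → Carrier} {F : Subset n → Carrier} (rec : Recursive y F) (z : Fin n) where

      -- The partial derivative of F with respect to the weight of z. Each weight enters at most
      -- linearly, so a unit increase adds exactly this term.
      partialAt : Subset n → Carrier
      partialAt S = if lookup S z then F (S - z) else 0#

      partialAt-∈ : ∀ {S} → z ∈ S → partialAt S ≈ F (S - z)
      partialAt-∈ z∈S rewrite lookup-true z∈S = refl

      partialAt-∉ : ∀ {S} → z ∉ S → partialAt S ≈ 0#
      partialAt-∉ z∉S rewrite lookup-false z∉S = refl

      private
        neighbourTerm-0 : ∀ T u v → z ∉ T → neighbourTerm partialAt T u v ≈ 0#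
        neighbourTerm-0 T u v z∉T = trans
            (if-cong (lookup T v ∧ adj G u v) λ _ → partialAt-∉ {T - v} (z∉T ∘ proj₁ ∘ ∈-⁻))
                                          (if-0 (lookup T v ∧ adj G u v))

        neighbourSum-0 : ∀ T u → z ∉ T → neighbourSum partialAt T u ≈ 0#
        neighbourSum-0 T u z∉T = trans (sum-cong-≋ λ v → neighbourTerm-0 T u v z∉T) (sum-replicate-zero n)

        neighbourTerm-∈ : ∀ T u v → z ∈ T → neighbourTerm partialAt T u v ≈ neighbourTerm F (T - z) u v
        neighbourTerm-∈ T u v z∈T with v Fin.≟ z
        ... | yes ≡.refl rewrite lookup-delete-same T v = if-0 (lookup T v ∧ adj G u v)
        ... | no v≢z rewrite lookup-delete T v≢z = if-cong (lookup T v ∧ adj G u v) λ _ →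
                trans (partialAt-∈ (x∈p∧x≢y⇒x∈p-y z∈T (v≢z ∘ ≡.sym))) (reflexive (≡.cong F (p─x─y≡p─y─x T v z)))

        -- The weight of z does not occur as a coefficient in the recurrence at another vertex u, so
        -- differentiating with respect to it preserves that recurrence. In terms of sets, this is
        -- the recurrence for S - z.
        partialAt-recursive : ∀ S u → u ∈ S → u ≢ z →
            partialAt S + neighbourSum partialAt (S - u) u ≈ y u * partialAt (S - u)
        partialAt-recursive S u u∈S u≢z with z ∈? S
        ... | no z∉S = begin
          partialAt S + neighbourSum partialAt (S - u) u ≈⟨ +-cong (partialAt-∉ z∉S)
              (neighbourSum-0 (S - u) u (z∉S ∘ proj₁ ∘ ∈-⁻)) ⟩
          0# + 0#                ≈⟨ +-identityˡ 0# ⟩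
          0#                     ≈⟨ zeroʳ (y u) ⟨
          y u * 0#               ≈⟨ *-congˡ (partialAt-∉ (z∉S ∘ proj₁ ∘ ∈-⁻)) ⟨
          y u * partialAt (S - u) ∎
        ... | yes z∈S = begin
          partialAt S + neighbourSum partialAt (S - u) u ≈⟨ +-cong (partialAt-∈ z∈S)
              (sum-cong-≋ λ v → neighbourTerm-∈ (S - u) u v z∈S-u) ⟩
          F (S - z) + neighbourSum F (S - u - z) u       ≈⟨ +-congˡ
              (reflexive (≡.cong (λ T → neighbourSum F T u) (p─x─y≡p─y─x S u z))) ⟩
          F (S - z) + neighbourSum F (S - z - u) u       ≈⟨ rec (S - z) u (x∈p∧x≢y⇒x∈p-y u∈S u≢z) ⟩
          y u * F (S - z - u)                            ≈⟨ *-congˡ (reflexive (≡.cong F (p─x─y≡p─y─x S z u))) ⟩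
          y u * F (S - u - z)                            ≈⟨ *-congˡ (partialAt-∈ z∈S-u) ⟨
          y u * partialAt (S - u) ∎
          where
          z∈S-u : z ∈ S - u
          z∈S-u = x∈p∧x≢y⇒x∈p-y z∈S (u≢z ∘ ≡.sym)

        neighbourSum-+ : ∀ (H K : Subset n → Carrier) T u →
            neighbourSum (λ S → H S + K S) T u ≈ neighbourSum H T u + neighbourSum K T u
        neighbourSum-+ H K T u = trans (sum-cong-≋ λ v → if-+ (lookup T v ∧ adj G u v))
            (∑-distrib-+ (neighbourTerm H T u) (neighbourTerm K T u))

      perturbed : Subset n → Carrier
      perturbed S = F S + partialAt S

      perturbedWeight : Fin n → Carrier
      perturbedWeight v = if does (v Fin.≟ z) then y v + 1# else y v

      -- Raising the weight of z by 1 turns F(S) into F(S) + F(S - z).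
      perturbed-recursive : Recursive perturbedWeight perturbed
      perturbed-recursive S u u∈S with u Fin.≟ z
      ... | yes ≡.refl = begin
          F S + partialAt S + neighbourSum perturbed (S - u) u
            ≈⟨ +-cong (+-congˡ (partialAt-∈ u∈S))
                (trans (neighbourSum-+ F partialAt (S - u) u) (+-congˡ (neighbourSum-0 (S - u) u (x∉p-x S u)))) ⟩
          F S + F (S - u) + (neighbourSum F (S - u) u + 0#)
            ≈⟨ solve 3 (λ a b c → a :+ b :+ (c :+ con 0) := a :+ c :+ b) refl _ _ _ ⟩
          F S + neighbourSum F (S - u) u + F (S - u)          ≈⟨ +-congʳ (rec S u u∈S) ⟩
          y u * F (S - u) + F (S - u)                         ≈⟨ solve 2
              (λ a b → a :* b :+ b := (a :+ con 1) :* (b :+ con 0)) refl _ _ ⟩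
          (y u + 1#) * (F (S - u) + 0#)                       ≈⟨ *-congˡ (+-congˡ (partialAt-∉ (x∉p-x S u))) ⟨
          (y u + 1#) * perturbed (S - u) ∎
      ... | no u≢z = begin
          F S + partialAt S + neighbourSum perturbed (S - u) u
            ≈⟨ +-congˡ (neighbourSum-+ F partialAt (S - u) u) ⟩
          F S + partialAt S + (neighbourSum F (S - u) u + neighbourSum partialAt (S - u) u)
            ≈⟨ solve 4 (λ a b c d → a :+ b :+ (c :+ d) := (a :+ c) :+ (b :+ d)) refl _ _ _ _ ⟩
          (F S + neighbourSum F (S - u) u) + (partialAt S + neighbourSum partialAt (S - u) u)
            ≈⟨ +-cong (rec S u u∈S) (partialAt-recursive S u u∈S u≢z) ⟩
          y u * F (S - u) + y u * partialAt (S - u)  ≈⟨ distribˡ _ _ _ ⟨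
          y u * perturbed (S - u) ∎

-- Sums over vertex deletions and the Wronskian.

module VertexDeletions where

  open import Level using (0ℓ)
  open import Defs using (Graph; adj)
  open Subsets
  open Recurrences
  open import Algebra.Bundles using (CommutativeRing)
  open import Data.Bool using (Bool; true; false; _∧_; if_then_else_)
  open import Data.Nat using (ℕ; suc; zero)
  open import Data.Fin as Fin using (Fin; suc; zero)
  open import Data.Fin.Subset using (Subset; _∈_; _-_)
  open import Data.Fin.Subset.Properties using (p─x─y≡p─y─x; x∈p∧x≢y⇒x∈p-y)
  open import Data.Vec using (lookup)
  open import Data.Product using (_×_; _,_; ∃; proj₂)
  open import Data.Empty using (⊥-elim)
  open import Function.Base using (_∘_)
  open import Relation.Nullary using (yes; no; does)
  open import Relation.Binary.PropositionalEquality as ≡ using (_≡_)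

  module VertexSums (A : CommutativeRing 0ℓ 0ℓ) {n : ℕ} (G : Graph n) where
    open CommutativeRing A hiding (_-_; zero)
    open import Relation.Binary.Reasoning.Setoid setoid
    open import Algebra.Solver.Ring.NaturalCoefficients.Default commutativeSemiring
      using (solve; _:=_; _:+_; _:*_; con)
    open Recurrence A G

    sum-single : ∀ {m} (u : Fin m) c → sum (λ x → if does (x Fin.≟ u) then c else 0#) ≈ c
    sum-single {suc m} zero    c = trans (+-congˡ (sum-replicate-zero m)) (+-identityʳ c)
    sum-single {suc m} (suc u) c = trans (+-identityˡ _)
        (trans (sum-cong-≋ λ x → reflexive (same x)) (sum-single u c))
      where
      same : ∀ x → (if does (suc x Fin.≟ suc u) then c else 0#) ≡ (if does (x Fin.≟ u) then c else 0#)
      same x with x Fin.≟ u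
      ... | yes _ = ≡.refl
      ... | no _  = ≡.refl

    sum-if : ∀ {m} b (f : Fin m → Carrier) → (if b then sum f else 0#) ≈ sum (λ i → if b then f i else 0#)
    sum-if true  f = refl
    sum-if {m} false f = sym (sum-replicate-zero m)

    vertexTerm : (Subset n → Carrier) → Subset n → Fin n → Carrier
    vertexTerm F S v = if lookup S v then F (S - v) else 0#

    -- When all weights equal x, this is the derivative in x by the chain rule: each weight
    -- contributes the deletion of its own vertex.
    vertexSum : (Subset n → Carrier) → Subset n → Carrier
    vertexSum F S = sum (vertexTerm F S)

    module _ {y : Fin n → Carrier} {F : Subset n → Carrier} (rec : Recursive y F) where

      private
        swap : ∀ T u v x → (if lookup T v ∧ adj G u v then vertexTerm F (T - v) x else 0#)
                         ≈ (if lookup T x then neighbourTerm F (T - x) u v else 0#)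
        swap T u v x with v Fin.≟ x
        ... | yes ≡.refl rewrite lookup-delete-same T v = trans (if-0 (lookup T v ∧ adj G u v))
            (sym (if-0 (lookup T v)))
        ... | no v≢x rewrite lookup-delete T v≢x | lookup-delete T
            (v≢x ∘ ≡.sym) with lookup T v | lookup T x | adj G u v
        ...   | true  | true  | true  = reflexive (≡.cong F (p─x─y≡p─y─x T v x))
        ...   | true  | true  | false = refl
        ...   | true  | false | true  = refl
        ...   | true  | false | false = refl
        ...   | false | true  | true  = refl
        ...   | false | true  | false = refl
        ...   | false | false | true  = refl
        ...   | false | false | false = refl

        neighbour-vertex-swap : ∀ T u →
            neighbourSum (vertexSum F) T u ≈ sum (λ x → if lookup T x then neighbourSum F (T - x) u else 0#)
        neighbour-vertex-swap T u = begin
          sum (λ v → if lookup T v ∧ adj G u v then vertexSum F (T - v) else 0#)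
            ≈⟨ sum-cong-≋ (λ v → sum-if (lookup T v ∧ adj G u v) (vertexTerm F (T - v))) ⟩
          sum (λ v → sum λ x → if lookup T v ∧ adj G u v then vertexTerm F (T - v) x else 0#)
            ≈⟨ ∑-comm (λ v x → if lookup T v ∧ adj G u v then vertexTerm F (T - v) x else 0#) ⟩
          sum (λ x → sum λ v → if lookup T v ∧ adj G u v then vertexTerm F (T - v) x else 0#)
            ≈⟨ sum-cong-≋ (λ x → sum-cong-≋ λ v → swap T u v x) ⟩
          sum (λ x → sum λ v → if lookup T x then neighbourTerm F (T - x) u v else 0#)
            ≈⟨ sum-cong-≋ (λ x → sum-if (lookup T x) (neighbourTerm F (T - x) u)) ⟨
          sum (λ x → if lookup T x then neighbourSum F (T - x) u else 0#) ∎

        split : ∀ S u → u ∈ S → vertexSum F S ≈ F (S - u) + sum (λ x → if lookup (S - u) x then F (S - x) else 0#)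
        split S u u∈S = trans (sum-cong-≋ term) (trans
            (∑-distrib-+ (λ x → if does (x Fin.≟ u) then F (S - u) else 0#)
                (λ x → if lookup (S - u) x then F (S - x) else 0#))
            (+-congʳ (sum-single u (F (S - u)))))
          where
          term : ∀ x → vertexTerm F S x ≈ (if does (x Fin.≟ u) then F (S - u) else 0#) + (if lookup (S - u) x then F (S - x) else 0#)
          term x with x Fin.≟ u
          ... | yes ≡.refl rewrite lookup-delete-same S x | lookup-true u∈S = sym (+-identityʳ _)
          ... | no x≢u rewrite lookup-delete S x≢u = sym (+-identityˡ _)

      -- What the recurrence becomes after differentiation.
      vertexSum-recursive : ∀ S u → u ∈ S →
        vertexSum F S + neighbourSum (vertexSum F) (S - u) u ≈ F (S - u) + y u * vertexSum F (S - u)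
      vertexSum-recursive S u u∈S = begin
        vertexSum F S + neighbourSum (vertexSum F) T u ≈⟨ +-cong (split S u u∈S) (neighbour-vertex-swap T u) ⟩
        F T + sum f + sum g                            ≈⟨ +-assoc _ _ _ ⟩
        F T + (sum f + sum g)                          ≈⟨ +-congˡ (∑-distrib-+ f g) ⟨
        F T + sum (λ x → f x + g x)                    ≈⟨ +-congˡ (sum-cong-≋ term) ⟩
        F T + sum (λ x → y u * vertexTerm F T x)       ≈⟨ +-congˡ (*-distribˡ-sum (y u) (vertexTerm F T)) ⟨
        F T + y u * vertexSum F T ∎
        where
        T = S - u
        f g : Fin n → Carrier
        f x = if lookup T x then F (S - x) else 0#
        g x = if lookup T x then neighbourSum F (T - x) u else 0#
        term : ∀ x → f x + g x ≈ y u * vertexTerm F T x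
        term x with lookup T x in eq
        ... | false = trans (+-identityˡ _) (sym (zeroʳ _))
        ... | true = ≡.subst (λ Z → F (S - x) + neighbourSum F Z u ≈ y u * F Z) (p─x─y≡p─y─x S x u)
                       (rec (S - x) u (x∈p∧x≢y⇒x∈p-y u∈S (proj₂ (∈-⁻ {p = S} (lookup-true⁻ {p = T} eq)) ∘ ≡.sym)))

      module _
        (Pos : Carrier → Set)
          (pos-0 : Pos 0#)
        (pos-+ : ∀ {x y} → Pos x → Pos y → Pos (x + y))
        (pos-square : ∀ x → Pos (x * x))
        where
        open HeilmannLieb Pos pos-0 pos-+ pos-square

        -- w stands for F′(S) F(S - u) - F(S) F′(S - u). Its summand for v = u is F(S - u)², which
        -- `square` isolates for the lower interlacing bound. The summand of a neighbour v of u
        -- contains F(S - u - v)², which `neighbour` isolates for the upper one.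
        record Wronskian (S : Subset n) (u : Fin n) : Set where
          field
            w         : Carrier
            positive  : Pos w
            identity  : w + F S * vertexSum F (S - u) ≈ vertexSum F S * F (S - u)
            square    : ∃ λ r → Pos r × w ≈ F (S - u) * F (S - u) + r
            neighbour : ∀ v → v ∈ S - u → adj G u v ≡ true → ∃ λ r → Pos r × w ≈ F (S - u - v) * F (S - u - v) + r

        private
          record Term (S : Subset n) (u v : Fin n) (b b′ : Bool) : Set where
            field
              d         : Carrier
              positive  : Pos d
              identity  : d + F S * (if b′ then F (S - u - v) else 0#) ≈ (if b then F (S - v) else 0#) * F (S - u)
              square    : v ≡ u → d ≈ F (S - u) * F (S - u)
              neighbour : b′ ≡ true → adj G u v ≡ true → ∃ λ r → Pos r × d ≈ F (S - u - v) * F (S - u - v) + r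

        wronskian : ∀ S u → u ∈ S → Wronskian S u
        wronskian S u u∈S = record
          { w = sum D
          ; positive = pos-sum D P
          ; identity = trans (+-congˡ (*-distribˡ-sum (F S) (vertexTerm F (S - u)))) (trans (sym (∑-distrib-+ D _))
               (trans (sum-cong-≋ (λ v → Term.identity (term v)))
                   (sym (*-distribʳ-sum (F (S - u)) (vertexTerm F S)))))
          ; square = let r , pr , e = pos-sum-split D P u in r , pr , trans e (+-congʳ (Term.square (term u) ≡.refl))
          ; neighbour = λ v v∈ uv → let r , pr , e = pos-sum-split D P v
                                        s , ps , e′ = Term.neighbour (term v) (lookup-true v∈) uv
                                    in s + r , pos-+ ps pr , trans e (trans (+-congʳ e′) (+-assoc _ _ _))
          }
          where
          term : ∀ v → Term S u v (lookup S v) (lookup (S - u) v)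
          term v with v Fin.≟ u
          ... | yes ≡.refl rewrite lookup-delete-same S v | lookup-true u∈S = record
                { d = F (S - v) * F (S - v) ; positive = pos-square _
                ; identity = trans (+-congˡ (zeroʳ _)) (+-identityʳ _) ; square = λ _ → refl ; neighbour = λ () }
          ... | no v≢u rewrite lookup-delete S v≢u with lookup S v in eq
          ...   | false = record
                { d = 0# ; positive = pos-0
                ; identity = trans (+-identityˡ _) (trans (zeroʳ _) (sym (zeroˡ _)))
                ; square = λ v≡u → ⊥-elim (v≢u v≡u) ; neighbour = λ () }
          ...   | true = let h = heilmannLieb rec S u v u∈S (lookup-true⁻ eq) (v≢u ∘ ≡.sym) in record
                { d = d h ; positive = positive h
                ; identity = trans (identity h) (*-comm _ _)
                ; square = λ v≡u → ⊥-elim (v≢u v≡u) ; neighbour = λ _ → edge h }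
          D : Fin n → Carrier
          D v = Term.d (term v)
          P : ∀ v → Pos (D v)
          P v = Term.positive (term v)

-- Interlacing, essential vertices, Gallai's lemma, and triples of extreme vertices.

module Multiplicities where

  open import Defs using (Graph; adj; RealField)
  open Subsets
  open Series
  open Orders
  open Recurrences
  open Perturbations
  open VertexDeletions
  open import Data.Bool using (true; false; if_then_else_)
  open import Data.Nat as ℕ using (ℕ; suc; zero; _+_; _≤_; _<_; s≤s)
  import Data.Nat.Properties as ℕ
  open import Data.Fin as Fin using (Fin; suc; zero)
  open import Data.Fin.Properties using (any?)
  open import Data.Fin.Subset using (Subset; _∈_; _∉_; _-_; ⊥; _∪_; ∣_∣; Nonempty)
  open import Data.Fin.Subset.Properties using (p─x─y≡p─y─x; x∈p∧x≢y⇒x∈p-y; _∈?_; nonempty?; Empty-unique; ∉⊥)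
  open import Data.Vec using (lookup)
  open import Data.Product using (_×_; _,_; ∃; Σ; proj₁; proj₂)
  open import Data.Sum using (_⊎_; inj₁; inj₂)
  open import Data.Empty using (⊥-elim) renaming (⊥ to Absurd)
  open import Function.Base using (_∘_)
  open import Relation.Nullary using (¬_; yes; no)
  open import Relation.Nullary.Decidable using (_×-dec_)
  open import Relation.Binary.PropositionalEquality as ≡ using (_≡_; _≢_)

  module Multiplicity (R : RealField) {n : ℕ} (G : Graph n) where
    open RealField R using (Carrier)
    open PowerSeries (RealField.commRing R)
    open Ordered R
    open Recurrence seriesRing G
    open VertexSums seriesRing G
    open Perturbation seriesRing G
    open HeilmannLieb EvenPositive evenPositive-0 evenPositive-+ evenPositive-square

    -- Only the recurrence and the orders of F enter here. That F comes from matching polynomials is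
    -- established separately.
    module Roots (θ : Carrier) (F : Subset n → Series) (rec : Recursive (λ _ → θ +t) F) (F⊥ : F ⊥ ≋ 𝕊.1#)
                 (m : Subset n → ℕ) (ordF : ∀ S → Ord (m S) (F S)) where

      private
        module 𝔽 = RealField R

        euler-sum : ∀ {k} (f : Fin k → Series) → euler (sum f) ≋ sum (euler ∘ f)
        euler-sum {zero}  f = euler-0
        euler-sum {suc k} f = 𝕊.trans (euler-+ (f zero) (sum (f ∘ suc))) (𝕊.+-congˡ (euler-sum (f ∘ suc)))

        euler-neighbourSum : ∀ T u → (∀ v → v ∈ T → euler (F (T - v)) ≋ t 𝕊.* vertexSum F (T - v)) →
                             euler (neighbourSum F T u) ≋ t 𝕊.* neighbourSum (vertexSum F) T u
        euler-neighbourSum T u e = 𝕊.trans (euler-sum (neighbourTerm F T u)) (𝕊.trans (sum-cong-≋ term)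
            (𝕊.sym (*-distribˡ-sum t (neighbourTerm (vertexSum F) T u))))
          where
          term : ∀ v → euler (neighbourTerm F T u v) ≋ t 𝕊.* neighbourTerm (vertexSum F) T u v
          term v with lookup T v in eq | adj G u v
          ... | true  | true  = e v (lookup-true⁻ eq)
          ... | true  | false = 𝕊.trans euler-0 (𝕊.sym (𝕊.zeroʳ t))
          ... | false | _     = 𝕊.trans euler-0 (𝕊.sym (𝕊.zeroʳ t))

        -- Apply the Euler operator to the recurrence at u. By induction the terms of the smaller
        -- sets become t times their vertex sums, and comparison with t times `vertexSum-recursive`
        -- leaves the claim once the neighbour sums are cancelled.
        derivative′ : ∀ k S → ∣ S ∣ ≤ k → euler (F S) ≋ t 𝕊.* vertexSum F S
        derivative′ k S ∣S∣≤k with nonempty? S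
        ... | no empty with ≡.refl ← Empty-unique empty =
                𝕊.trans (euler-cong F⊥) (𝕊.trans (euler-C 𝔽.1#) (𝕊.sym (𝕊.trans (𝕊.*-congˡ vs⊥) (𝕊.zeroʳ t))))
          where
          vs⊥ : vertexSum F ⊥ ≋ 𝕊.0#
          vs⊥ = 𝕊.trans (sum-cong-≋ λ v → 𝕊.reflexive
              (≡.cong (λ b → if b then F (⊥ - v) else 𝕊.0#) (lookup-false (∉⊥ {x = v})))) (sum-replicate-zero n)
        derivative′ zero    S ∣S∣≤0 | yes (u , u∈S)
          with () ← ≡.trans (≡.sym (ℕ.n≤0⇒n≡0 ∣S∣≤0)) (∣p∣≡1+∣p-x∣ u∈S)
        derivative′ (suc k) S ∣S∣≤k | yes (u , u∈S) = +-cancelʳ (euler (neighbourSum F T u)) (begin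
            euler (F S) 𝕊.+ euler (neighbourSum F T u)   ≈⟨ euler-+ (F S) (neighbourSum F T u) ⟨
            euler (F S 𝕊.+ neighbourSum F T u)           ≈⟨ euler-cong (rec S u u∈S) ⟩
            euler ((θ +t) 𝕊.* F T)                       ≈⟨ euler-+t* θ (F T) ⟩
            t 𝕊.* F T 𝕊.+ (θ +t) 𝕊.* euler (F T)         ≈⟨ 𝕊.+-congˡ (𝕊.*-congˡ (derivative′ k T small)) ⟩
            t 𝕊.* F T 𝕊.+ (θ +t) 𝕊.* (t 𝕊.* vertexSum F T)
              ≈⟨ solve 4 (λ a b c d → a :* b :+ c :* (a :* d) := a :* (b :+ c :* d)) 𝕊.refl t (F T) (θ +t)
                  (vertexSum F T) ⟩
            t 𝕊.* (F T 𝕊.+ (θ +t) 𝕊.* vertexSum F T)     ≈⟨ 𝕊.*-congˡ (vertexSum-recursive rec S u u∈S) ⟨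
            t 𝕊.* (vertexSum F S 𝕊.+ neighbourSum (vertexSum F) T u) ≈⟨ 𝕊.distribˡ t _ _ ⟩
            t 𝕊.* vertexSum F S 𝕊.+ t 𝕊.* neighbourSum (vertexSum F) T u
              ≈⟨ 𝕊.+-congˡ (euler-neighbourSum T u λ v v∈T → derivative′ k (T - v)
                  (ℕ.≤-trans (ℕ.n≤1+n _) (ℕ.≤-trans (ℕ.≤-reflexive (≡.sym (∣p∣≡1+∣p-x∣ v∈T))) small))) ⟨
            t 𝕊.* vertexSum F S 𝕊.+ euler (neighbourSum F T u) ∎)
          where
          open import Relation.Binary.Reasoning.Setoid 𝕊.setoid
          open import Algebra.Solver.Ring.NaturalCoefficients.Default 𝕊.commutativeSemiring using (solve; _:=_; _:+_; _:*_)
          T = S - u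
          small : ∣ T ∣ ≤ k
          small = ℕ.≤-pred (ℕ.≤-trans (ℕ.≤-reflexive (≡.sym (∣p∣≡1+∣p-x∣ u∈S))) ∣S∣≤k)

      -- μ′(G) = Σ μ(G \ v), in terms of the Taylor expansion at θ.
      derivative : ∀ S → euler (F S) ≋ t 𝕊.* vertexSum F S
      derivative S = derivative′ ∣ S ∣ S ℕ.≤-refl

      private
        vanishes-sum : ∀ {l} k (f : Fin l → Series) → (∀ i → Vanishes k (f i)) → Vanishes k (sum f)
        vanishes-sum {zero}  k f v i _ = 𝔽.refl
        vanishes-sum {suc l} k f v = vanishes-+ {f = f zero} {g = sum (f ∘ suc)} (v zero)
            (vanishes-sum k (f ∘ suc) (v ∘ suc))

        -- Nothing cancels between f² and r, so the order of w cannot exceed the order 2b of f².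
        dominates : ∀ {w r k b f} → w ≋ f 𝕊.* f 𝕊.+ r → EvenPositive r → Vanishes k w → Ord b f → k ≤ b + b
        dominates {f = f} e r v o = vanishes⇒≤ord
            (proj₁ (vanishes-summands (evenPositive-square f) r _ (vanishes-cong e v))) (ord-* o o)

        1+c≡a+b⇒ : ∀ {a b c} → suc c ≡ a + b → c ≤ b + b → a ≤ suc b
        1+c≡a+b⇒ {a} {b} {c} e le = ℕ.+-cancelʳ-≤ b a (suc b) (ℕ.≤-trans (ℕ.≤-reflexive (≡.sym e)) (s≤s le))

        -- The order of the Wronskian is one less than the sum of two distinct orders; being
        -- distinct, they are not both zero.
        pred : ∀ {a b} → a ≢ b → ∃ λ c → suc c ≡ a + b
        pred {zero}  {zero}  a≢b = ⊥-elim (a≢b ≡.refl)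
        pred {zero}  {suc b} a≢b = b , ≡.refl
        pred {suc a} {b}     a≢b = a + b , ≡.refl

        W : ∀ S u → u ∈ S → _
        W = wronskian rec EvenPositive evenPositive-0 evenPositive-+ evenPositive-square

        ordW : ∀ S u (u∈S : u ∈ S) → m S ≢ m (S - u) → ∀ c → suc c ≡ m S + m (S - u) → Ord c (Wronskian.w (W S u u∈S))
        ordW S u u∈S ne = ord-wronskian (vertexSum F S) (vertexSum F (S - u)) _ (ordF S) (ordF (S - u)) ne
                            (derivative S) (derivative (S - u)) (Wronskian.identity (W S u u∈S))

      -- If the two orders differ, the Wronskian has order m(S) + m(S - u) - 1. It contains the
      -- square F(S - u)², so this is at most 2 m(S - u).
      mult-lower : ∀ S u → u ∈ S → m S ≤ suc (m (S - u))
      mult-lower S u u∈S with m S ℕ.≟ m (S - u)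
      ... | yes e = ℕ.≤-trans (ℕ.≤-reflexive e) (ℕ.n≤1+n _)
      ... | no ne with pred ne | Wronskian.square (W S u u∈S)
      ... | c , e | r , pr , eq = 1+c≡a+b⇒ e (dominates eq pr (vanishes (ordW S u u∈S ne c e)) (ordF (S - u)))

      -- Suppose m(S - u) > m(S) + 1. For each neighbour v of u the Wronskian contains F(S - u -
      -- v)², which forces m(S - u - v) > m(S). Then every term of the recurrence at u other than
      -- F(S) vanishes beyond order m(S), and so would F(S).
      mult-upper : ∀ S u → u ∈ S → m (S - u) ≤ suc (m S)
      mult-upper S u u∈S = ℕ.≮⇒≥ λ big → leading (ordF S)
          (vanishes-diff (rec S u u∈S)
            (vanishes-sum (suc (m S)) (neighbourTerm F (S - u) u) (term big))
            (vanishes-* {0} (θ +t) (F (S - u)) (λ _ ())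
                (vanishes-≤ {f = F (S - u)} (ℕ.≤-trans (ℕ.n≤1+n _) big) (vanishes (ordF (S - u)))))
            (m S) ℕ.≤-refl)
        where
        term : suc (m S) < m (S - u) → ∀ v → Vanishes (suc (m S)) (neighbourTerm F (S - u) u v)
        term big v with lookup (S - u) v in eq | adj G u v in uv
        ... | true  | false = λ _ _ → 𝔽.refl
        ... | false | _     = λ _ _ → 𝔽.refl
        ... | true  | true  = vanishes-≤ {f = F (S - u - v)} (ℕ.≰⇒> low) (vanishes (ordF (S - u - v)))
          where
          ne : m S ≢ m (S - u)
          ne e = ℕ.<-irrefl e (ℕ.≤-trans (ℕ.n≤1+n _) big)
          low : ¬ m (S - u - v) ≤ m S
          low le with pred ne | Wronskian.neighbour (W S u u∈S) v (lookup-true⁻ eq) uv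
          ... | c , e | r , pr , e′ = ℕ.<⇒≱ big (1+c≡a+b⇒ (≡.trans e (ℕ.+-comm (m S) _))
                  (ℕ.≤-trans (dominates e′ pr (vanishes (ordW S u u∈S ne c e)) (ordF (S - u - v)))
                      (ℕ.+-mono-≤ le le)))

      -- Otherwise `mult-lower` makes every F(S - v) vanish up to order k + 1, and with them the
      -- derivative of F(S). In characteristic zero that derivative has order exactly k.
      exists-essential : ∀ S k → m S ≡ suc k → ∃ λ u → u ∈ S × m (S - u) ≡ k
      exists-essential S k mS with any? (λ u → (u ∈? S) ×-dec (m (S - u) ℕ.≟ k))
      ... | yes r = r
      ... | no none = ⊥-elim (⊠-≉0 k (λ z → leading (ordF S) (𝔽.trans (𝔽.reflexive (≡.cong (coeff (F S)) mS)) z))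
              (𝔽.trans (at (derivative S) (suc k)) (𝔽.trans (coeff-t* (vertexSum F S) (suc k))
                (vanishes-sum (suc k) (vertexTerm F S) term k ℕ.≤-refl))))
        where
        term : ∀ v → Vanishes (suc k) (vertexTerm F S v)
        term v with lookup S v in eq
        ... | false = λ _ _ → 𝔽.refl
        ... | true  = vanishes-≤ {f = F (S - v)}
            (ℕ.≤∧≢⇒< (ℕ.≤-pred (ℕ.≤-trans (ℕ.≤-reflexive (≡.sym mS)) (mult-lower S v (lookup-true⁻ eq))))
                          (λ e → none (v , lookup-true⁻ eq , ≡.sym e))) (vanishes (ordF (S - v)))

      mult-∪ : ∀ C D → (∀ {x} → x ∈ C → x ∉ D) → (∀ {i j} → i ∈ C → j ∈ D → adj G i j ≡ false) → m (C ∪ D) ≡ m C + m D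
      mult-∪ C D disjoint noEdge = ord-unique (ordF (C ∪ D))
          (ord-cong (𝕊.sym (multiplicative rec F⊥ C D disjoint noEdge)) (ord-* (ordF C) (ordF D)))

      private
        HLᵢ : ∀ S u w → u ∈ S → w ∈ S → u ≢ w → Identity rec S u w
        HLᵢ = heilmannLieb rec

        odd-absurd : ∀ {k j d} → EvenPositive d → Ord k d → k ≡ suc (j + j) → Absurd
        odd-absurd {j = j} P o e = odd≢even j e (even-order P o)

        ordF′ : ∀ {k} S → m S ≡ k → Ord k (F S)
        ordF′ S ≡.refl = ordF S

        vanF : ∀ {k} S → k ≤ m S → Vanishes k (F S)
        vanF S k≤ = vanishes-≤ {f = F S} k≤ (vanishes (ordF S))

        -- The product F(S - u) F(S - w) would have strictly the smaller order and hence alone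
        -- determine the order of the sum of squares, which is even. `odd-left` is the same with the
        -- two products exchanged.
        odd-right : ∀ {j S u w} → u ∈ S → w ∈ S → u ≢ w → suc (suc (j + j)) ≤ m S + m (S - u - w) →
            ¬ m (S - u) + m (S - w) ≡ suc (j + j)
        odd-right {j} {S} {u} {w} u∈S w∈S u≢w big e =
          odd-absurd {j = j} (positive h) (ord-diffʳ (identity h)
            (vanishes-≤ {f = F S 𝕊.* F (S - u - w)} (ℕ.≤-trans (ℕ.≤-reflexive (≡.cong suc e)) big)
                (vanishes (ord-* (ordF S) (ordF (S - u - w)))))
            (ord-* (ordF (S - u)) (ordF (S - w)))) e
          where h = HLᵢ S u w u∈S w∈S u≢w

        odd-left : ∀ {j S u w} → u ∈ S → w ∈ S → u ≢ w → suc (suc (j + j)) ≤ m (S - u) + m (S - w) →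
            ¬ m S + m (S - u - w) ≡ suc (j + j)
        odd-left {j} {S} {u} {w} u∈S w∈S u≢w big e =
          odd-absurd {j = j} (positive h) (ord-diffˡ (identity h) (ord-* (ordF S) (ordF (S - u - w)))
            (vanishes-≤ {f = F (S - u) 𝕊.* F (S - w)} (ℕ.≤-trans (ℕ.≤-reflexive (≡.cong suc e)) big)
                (vanishes (ord-* (ordF (S - u)) (ordF (S - w)))))) e
          where h = HLᵢ S u w u∈S w∈S u≢w

        -- Along an edge the sum of squares contains F(S - u - w)². Unlike the parity arguments,
        -- this also applies when the two products have equal order.
        edge-bound : ∀ {k S u w} → u ∈ S → w ∈ S → u ≢ w → adj G u w ≡ true → k ≤ m S + m (S - u - w) →
            k ≤ m (S - u) + m (S - w) →
                     k ≤ m (S - u - w) + m (S - u - w)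
        edge-bound {k} {S} {u} {w} u∈S w∈S u≢w uw ≤₁ ≤₂ with edge (HLᵢ S u w u∈S w∈S u≢w) uw
        ... | r , pr , e = dominates e pr (vanishes-diff (identity (HLᵢ S u w u∈S w∈S u≢w))
                (vanishes-≤ {f = F S 𝕊.* F (S - u - w)} ≤₁ (vanishes (ord-* (ordF S) (ordF (S - u - w)))))
                (vanishes-≤ {f = F (S - u) 𝕊.* F (S - w)} ≤₂ (vanishes (ord-* (ordF (S - u)) (ordF (S - w))))))
                    (ordF (S - u - w))

        ord-+ : ∀ {k f g} → Ord k f → Vanishes (suc k) g → Ord k (f 𝕊.+ g)
        ord-+ {f = f} {g} (ord v l) u = ord (vanishes-+ {f = f} {g = g} v (vanishes-≤ {f = g} (ℕ.n≤1+n _) u))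
          λ z → l (𝔽.trans (𝔽.sym (𝔽.trans (𝔽.+-congˡ (u _ ℕ.≤-refl)) (𝔽.+-identityʳ _))) z)

        ord-sumˡ : ∀ {k} A B → m A ≡ k → suc k ≤ m B → Ord k (F A 𝕊.+ F B)
        ord-sumˡ A B e le = ord-+ {g = F B} (ordF′ A e) (vanF B le)

        ord-sumʳ : ∀ {k} A B → suc k ≤ m A → m B ≡ k → Ord k (F A 𝕊.+ F B)
        ord-sumʳ A B le e = ord-cong (𝕊.+-comm (F B) (F A)) (ord-sumˡ B A e le)

        van-sum : ∀ {k} A B → k ≤ m A → k ≤ m B → Vanishes k (F A 𝕊.+ F B)
        van-sum A B a b = vanishes-+ {f = F A} {g = F B} (vanF A a) (vanF B b)

        perturbed-∈ : ∀ {z S} → z ∈ S → perturbed rec z S ≋ F S 𝕊.+ F (S - z)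
        perturbed-∈ z∈S = 𝕊.+-congˡ (partialAt-∈ rec _ z∈S)

        -- Heilmann–Lieb after raising the weight of z by one.
        perturbed-odd : ∀ {j k l a b S u w z} → u ∈ S → w ∈ S → z ∈ S → u ≢ w → u ≢ z → w ≢ z →
          Ord k (F S 𝕊.+ F (S - z)) → Ord l (F (S - u - w) 𝕊.+ F (S - u - w - z)) → k + l ≡ suc (j + j) →
          Vanishes a (F (S - u) 𝕊.+ F (S - u - z)) → Vanishes b (F (S - w) 𝕊.+ F (S - w - z)) → suc
              (k + l) ≤ a + b → Absurd
        perturbed-odd {j} {k} {l} {a} {b} {S} {u} {w} {z} u∈S w∈S z∈S u≢w u≢z w≢z o₁ o₂ odd v₁ v₂ le =
          odd-absurd {j = j} (positive h) (ord-diffˡ (identity h)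
            (ord-* (ord-cong (𝕊.sym (perturbed-∈ z∈S)) o₁) (ord-cong (𝕊.sym (perturbed-∈ z∈uw)) o₂))
            (vanishes-≤ {f = H (S - u) 𝕊.* H (S - w)} le (vanishes-* (H (S - u)) (H (S - w))
              (vanishes-cong (𝕊.sym (perturbed-∈ z∈u)) v₁) (vanishes-cong (𝕊.sym (perturbed-∈ z∈w)) v₂)))) odd
          where
          H = perturbed rec z
          h = heilmannLieb (perturbed-recursive rec z) S u w u∈S w∈S u≢w
          z∈u : z ∈ S - u
          z∈u = x∈p∧x≢y⇒x∈p-y z∈S (u≢z ∘ ≡.sym)
          z∈w : z ∈ S - w
          z∈w = x∈p∧x≢y⇒x∈p-y z∈S (w≢z ∘ ≡.sym)
          z∈uw : z ∈ S - u - w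
          z∈uw = x∈p∧x≢y⇒x∈p-y z∈u (w≢z ∘ ≡.sym)

        adjacent⇒≢ : ∀ {u v} → adj G u v ≡ true → u ≢ v
        adjacent⇒≢ {u} uv ≡.refl with () ← ≡.trans (≡.sym uv) (Graph.irrefl G u)

      -- Suppose m(S - u) = b + 1. Then F(S - u) F(S - v) has the odd order 2b + 1. By interlacing
      -- m(S - u - v) ≥ b. Equality makes both products have order 2b + 1, against the bound 2b from
      -- the edge; a larger value contradicts parity.
      essential-neighbour-not-neutral : ∀ {S u v b} → u ∈ S → v ∈ S → adj G u v ≡ true →
        m S ≡ suc b → m (S - v) ≡ b → m (S - u) ≢ suc b
      essential-neighbour-not-neutral {S} {u} {v} {b} u∈S v∈S uv mS mv mu with m (S - u - v) ℕ.≟ b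
      ... | yes muv = ℕ.<-irrefl ≡.refl (ℕ.≤-trans
              (edge-bound {suc (b + b)} u∈S v∈S u≢v uv (ℕ.≤-reflexive (≡.sym (≡.cong₂ _+_ mS muv)))
                  (ℕ.≤-reflexive (≡.sym (≡.cong₂ _+_ mu mv))))
              (ℕ.≤-reflexive (≡.cong₂ _+_ muv muv)))
        where u≢v = adjacent⇒≢ uv
      ... | no muv≢b = odd-right {b} u∈S v∈S u≢v
              (ℕ.≤-trans (s≤s (ℕ.≤-trans (ℕ.≤-reflexive (≡.sym (ℕ.+-suc b b))) (ℕ.+-monoʳ-≤ b b<)))
                         (ℕ.≤-reflexive (≡.sym (≡.cong (_+ m (S - u - v)) mS)))) (≡.cong₂ _+_ mu mv)
        where
        u≢v = adjacent⇒≢ uv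
        b< : b < m (S - u - v)
        b< = ℕ.≤∧≢⇒< (ℕ.≤-pred (ℕ.≤-trans (ℕ.≤-reflexive (≡.sym mu))
            (mult-lower (S - u) v (x∈p∧x≢y⇒x∈p-y v∈S (u≢v ∘ ≡.sym))))) (muv≢b ∘ ≡.sym)

      -- If m(S - u - v) were b - 1, both products would have order 2b, exceeding the bound 2b - 2
      -- given by the edge.
      adjacent⇒parallel : ∀ {S u v b} → u ∈ S → v ∈ S → adj G u v ≡ true →
        m S ≡ suc b → m (S - u) ≡ b → m (S - v) ≡ b → b ≤ m (S - u - v)
      adjacent⇒parallel {S} {u} {v} {b} u∈S v∈S uv mS mu mv = ℕ.≮⇒≥ λ k<b →
          ℕ.<⇒≱ (ℕ.+-mono-< k<b k<b) (edge-bound {b + b} u∈S v∈S u≢v uv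
            (ℕ.≤-trans (ℕ.+-monoʳ-≤ b b≤) (ℕ.≤-reflexive
                (≡.trans (ℕ.+-suc b _) (≡.cong (_+ m (S - u - v)) (≡.sym mS)))))
            (ℕ.≤-reflexive (≡.sym (≡.cong₂ _+_ mu mv))))
        where
        u≢v = adjacent⇒≢ uv
        b≤ : b ≤ suc (m (S - u - v))
        b≤ = ℕ.≤-trans (ℕ.≤-reflexive (≡.sym mu)) (mult-lower (S - u) v (x∈p∧x≢y⇒x∈p-y v∈S (u≢v ∘ ≡.sym)))

      private
        pair-case : ∀ {a k} → a ≤ k → k ≤ suc a → k ≡ a ⊎ k ≡ suc a
        pair-case {a} {k} a≤k k≤1+a with k ℕ.≟ a
        ... | yes e = inj₁ e
        ... | no ne = inj₂ (ℕ.≤-antisym k≤1+a (ℕ.≤∧≢⇒< a≤k (ne ∘ ≡.sym)))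

        -- Deleting an inessential v keeps an essential w essential.
        essential-persists : ∀ {T v w c} → v ∈ T → w ∈ T → v ≢ w → m T ≡ suc c → m (T - w) ≡ c → suc c ≤ m (T - v) →
          (m (T - v) ≡ suc c × m (T - v - w) ≡ c) ⊎ (m (T - v) ≡ suc (suc c) × m (T - v - w) ≡ suc c)
        essential-persists {T} {v} {w} {c} v∈ w∈ v≢w mT mw mv≥ with pair-case mv≥
            (ℕ.≤-trans (mult-upper T v v∈) (ℕ.≤-reflexive (≡.cong suc mT)))
        ... | inj₂ mv = inj₂ (mv , ℕ.≤-antisym upper
            (ℕ.≤-pred (ℕ.≤-trans (ℕ.≤-reflexive (≡.sym mv)) (mult-lower (T - v) w w∈v))))
          where
          w∈v = x∈p∧x≢y⇒x∈p-y w∈ (v≢w ∘ ≡.sym)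
          upper : m (T - v - w) ≤ suc c
          upper = ℕ.≤-trans (ℕ.≤-reflexive (≡.cong m (p─x─y≡p─y─x T v w)))
                    (ℕ.≤-trans (mult-upper (T - w) v (x∈p∧x≢y⇒x∈p-y v∈ v≢w)) (ℕ.≤-reflexive (≡.cong suc mw)))
        ... | inj₁ mv with m (T - v - w) ℕ.≟ c
        ...   | yes e = inj₁ (mv , e)
        -- A larger value would push F(T) F(T - v - w) beyond the odd order 2c + 1 of F(T - v) F(T -
        -- w).
        ...   | no ne = ⊥-elim (odd-right {c} v∈ w∈ v≢w
                  (ℕ.≤-trans (s≤s (ℕ.≤-trans (ℕ.≤-reflexive (≡.sym (ℕ.+-suc c c))) (ℕ.+-monoʳ-≤ c c<)))
                      (ℕ.≤-reflexive (≡.cong (_+ m (T - v - w)) (≡.sym mT))))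
                  (≡.cong₂ _+_ mv mw))
          where
          c< : c < m (T - v - w)
          c< = ℕ.≤∧≢⇒< (ℕ.≤-pred (ℕ.≤-trans (ℕ.≤-reflexive (≡.sym mv))
              (mult-lower (T - v) w (x∈p∧x≢y⇒x∈p-y w∈ (v≢w ∘ ≡.sym))))) (ne ∘ ≡.sym)

        delete-reverse : ∀ (S : Subset n) u v w → S - w - v - u ≡ S - u - v - w
        delete-reverse S u v w = ≡.trans (p─x─y≡p─y─x (S - w) v u)
            (≡.trans (≡.cong (_- v) (p─x─y≡p─y─x S w u)) (p─x─y≡p─y─x (S - u) w v))

        -- In S - u the vertex v is inessential and w essential; in S - w the same holds with u in
        -- place of w. `essential-persists` leaves two possibilities on each side, and the common
        -- value m(S - u - v - w) links them.
        parallel-absurd : ∀ {S u v w c} → u ∈ S → v ∈ S → w ∈ S → u ≢ v → v ≢ w → u ≢ w →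
          m S ≡ suc (suc c) → m (S - u) ≡ suc c → m (S - v) ≡ suc c → m (S - w) ≡ suc c → m (S - u - w) ≡ c →
          suc c ≤ m (S - u - v) → suc c ≤ m (S - w - v) → Absurd
        parallel-absurd {S} {u} {v} {w} {c} u∈ v∈ w∈ u≢v v≢w u≢w mS mu mv mw muw uv≥ wv≥
          with essential-persists {S - u} {v} {w} (x∈p∧x≢y⇒x∈p-y v∈ (u≢v ∘ ≡.sym))
              (x∈p∧x≢y⇒x∈p-y w∈ (u≢w ∘ ≡.sym)) v≢w mu muw uv≥
             | essential-persists {S - w} {v} {u} (x∈p∧x≢y⇒x∈p-y v∈ v≢w) (x∈p∧x≢y⇒x∈p-y u∈ u≢w) (u≢v ∘ ≡.sym) mw
                 (≡.trans (≡.cong m (p─x─y≡p─y─x S w u)) muw) wv≥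
        -- v is neutral on both sides. In S - v the products have orders 2c + 1 and 2c + 2.
        ... | inj₁ (muv , muvw) | inj₁ (mwv , _) = odd-left {c} {S - v} {u} {w} (x∈p∧x≢y⇒x∈p-y u∈ u≢v)
            (x∈p∧x≢y⇒x∈p-y w∈ (v≢w ∘ ≡.sym)) u≢w
                (ℕ.≤-reflexive (≡.trans (≡.cong suc (≡.sym (ℕ.+-suc c c)))
                  (≡.sym (≡.cong₂ _+_ (≡.trans (≡.cong m (p─x─y≡p─y─x S v u)) muv)
                      (≡.trans (≡.cong m (p─x─y≡p─y─x S v w)) mwv)))))
                (≡.cong₂ _+_ mv (≡.trans (≡.cong (λ T → m (T - w)) (p─x─y≡p─y─x S v u)) muvw))
        -- v is positive on both sides. Both products in S have order 2c + 2, so parity is silent.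
        -- Raising the weight of v lowers the order at S to c + 1 and leaves c at S - u - w, while
        -- both factors on the other side still vanish to order c + 1.
        ... | inj₂ (muv , muvw) | inj₂ (mwv , _) =
            perturbed-odd {c} {suc c} {c} {suc c} {suc c} u∈ w∈ v∈ u≢w u≢v (v≢w ∘ ≡.sym)
                (ord-sumʳ S (S - v) (ℕ.≤-reflexive (≡.sym mS)) mv)
                (ord-sumˡ (S - u - w) (S - u - w - v) muw
                    (ℕ.≤-reflexive (≡.sym (≡.trans (≡.cong m (p─x─y≡p─y─x (S - u) w v)) muvw))))
                ≡.refl
                (van-sum (S - u) (S - u - v) (ℕ.≤-reflexive (≡.sym mu)) uv≥)
                (van-sum (S - w) (S - w - v) (ℕ.≤-reflexive (≡.sym mw)) wv≥)
                (ℕ.≤-reflexive (≡.cong suc (≡.sym (ℕ.+-suc c c))))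
        -- In the mixed cases the two sides give different values for m(S - u - v - w).
        ... | inj₁ (_ , muvw) | inj₂ (_ , mwvu) = ℕ.1+n≢n
            (≡.trans (≡.sym mwvu) (≡.trans (≡.cong m (delete-reverse S u v w)) muvw))
        ... | inj₂ (_ , muvw) | inj₁ (_ , mwvu) = ℕ.1+n≢n
            (≡.trans (≡.sym muvw) (≡.trans (≡.sym (≡.cong m (delete-reverse S u v w))) mwvu))

      -- If it failed for u and w, interlacing would leave only m(S - u - w) = b - 1, which is
      -- `parallel-absurd` with c = b - 1.
      parallel-trans : ∀ {S u v w b} → u ∈ S → v ∈ S → w ∈ S → u ≢ v → v ≢ w → u ≢ w →
        m S ≡ suc b → m (S - u) ≡ b → m (S - v) ≡ b → m (S - w) ≡ b →
        b ≤ m (S - u - v) → b ≤ m (S - v - w) → b ≤ m (S - u - w)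
      parallel-trans {S} {u} {v} {w} {b} u∈ v∈ w∈ u≢v v≢w u≢w mS mu mv mw uv≥ vw≥ = ℕ.≮⇒≥ λ k<b →
        let b≡ = ℕ.≤-antisym (ℕ.≤-trans (ℕ.≤-reflexive (≡.sym mu)) (mult-lower (S - u) w (x∈p∧x≢y⇒x∈p-y w∈ (u≢w ∘ ≡.sym)))) k<b in
        parallel-absurd {c = m (S - u - w)} u∈ v∈ w∈ u≢v v≢w u≢w (≡.trans mS (≡.cong suc b≡)) (≡.trans mu b≡)
            (≡.trans mv b≡) (≡.trans mw b≡) ≡.refl
          (ℕ.≤-trans (ℕ.≤-reflexive (≡.sym b≡)) uv≥)
          (ℕ.≤-trans (ℕ.≤-reflexive (≡.sym b≡)) (ℕ.≤-trans vw≥ (ℕ.≤-reflexive (≡.cong m (p─x─y≡p─y─x S v w)))))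

      -- By interlacing the last multiplicity is h + 1, h + 2 or h + 3. The middle value falls to
      -- plain parity in S - c, the smallest only to a perturbation at c.
      three-extreme : ∀ {S a b c h} → a ∈ S → b ∈ S → c ∈ S → a ≢ b → a ≢ c → b ≢ c →
        m S ≡ h → m (S - a) ≡ suc h → m (S - b) ≡ suc h → m (S - c) ≡ suc h →
        m (S - a - b) ≡ suc (suc h) → m (S - a - c) ≡ suc (suc h) → m (S - b - c) ≡ suc (suc h) →
        m (S - a - b - c) ≡ suc (suc (suc h))
      three-extreme {S} {a} {b} {c} {h} a∈ b∈ c∈ a≢b a≢c b≢c mS ma mb mc mab mac mbc
        with m (S - a - b - c) ℕ.≟ suc h | m (S - a - b - c) ℕ.≟ suc (suc h)
      -- Both products in S have order 2h + 2. Raising the weight of c keeps order h at S and lowers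
      -- S - a - b from h + 2 to h + 1, a total of 2h + 1, while each factor on the other side
      -- vanishes to order h + 1.
      ... | yes mabc | _ = ⊥-elim (perturbed-odd {h} {h} {suc h} {suc h} {suc h} a∈ b∈ c∈ a≢b a≢c b≢c
              (ord-sumˡ S (S - c) mS (ℕ.≤-reflexive (≡.sym mc)))
              (ord-sumʳ (S - a - b) (S - a - b - c) (ℕ.≤-reflexive (≡.sym mab)) mabc)
              (ℕ.+-suc h h)
              (van-sum (S - a) (S - a - c) (ℕ.≤-reflexive (≡.sym ma))
                  (ℕ.≤-trans (ℕ.n≤1+n _) (ℕ.≤-reflexive (≡.sym mac))))
              (van-sum (S - b) (S - b - c) (ℕ.≤-reflexive (≡.sym mb))
                  (ℕ.≤-trans (ℕ.n≤1+n _) (ℕ.≤-reflexive (≡.sym mbc))))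
              ℕ.≤-refl)
      -- In S - c the products have orders 2h + 3 and 2h + 4.
      ... | no _ | yes mabc = ⊥-elim (odd-left {suc h} {S - c} {a} {b} (x∈p∧x≢y⇒x∈p-y a∈ a≢c)
          (x∈p∧x≢y⇒x∈p-y b∈ b≢c) a≢b
              (ℕ.≤-reflexive (≡.trans (≡.cong suc (≡.sym (ℕ.+-suc (suc h) (suc h))))
                (≡.sym (≡.cong₂ _+_ (≡.trans (≡.cong m (p─x─y≡p─y─x S c a)) mac)
                    (≡.trans (≡.cong m (p─x─y≡p─y─x S c b)) mbc)))))
              (≡.trans (≡.cong₂ _+_ mc (≡.trans (≡.cong m cab) mabc)) (ℕ.+-suc (suc h) (suc h))))
        where
        cab : S - c - a - b ≡ S - a - b - c
        cab = ≡.trans (≡.cong (_- b) (p─x─y≡p─y─x S c a)) (p─x─y≡p─y─x (S - a) c b)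
      ... | no ≢1 | no ≢2 = ℕ.≤-antisym
              (ℕ.≤-trans (mult-upper (S - a - b) c c∈ab) (ℕ.≤-reflexive (≡.cong suc mab)))
              (ℕ.≤∧≢⇒< (ℕ.≤∧≢⇒< (ℕ.≤-pred (ℕ.≤-trans (ℕ.≤-reflexive (≡.sym mab))
                  (mult-lower (S - a - b) c c∈ab))) (≢1 ∘ ≡.sym)) (≢2 ∘ ≡.sym))
        where
        c∈ab : c ∈ S - a - b
        c∈ab = x∈p∧x≢y⇒x∈p-y (x∈p∧x≢y⇒x∈p-y c∈ (a≢c ∘ ≡.sym)) (b≢c ∘ ≡.sym)

      -- Connectedness as an induction principle: a property that holds at one vertex and passes
      -- along edges holds everywhere. Both uses below are of this kind, and no paths have to be
      -- handled.
      Connected : Subset n → Set₁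
      Connected C = ∀ (P : Fin n → Set) u → u ∈ C → P u →
          (∀ i j → i ∈ C → j ∈ C → adj G i j ≡ true → P i → P j) → ∀ j → j ∈ C → P j

      -- If the multiplicity were k + 2, then C - u would have multiplicity k + 1 and hence an
      -- essential vertex x, with m(C - u - x) = k. But x is parallel to u, because the relation
      -- holds along edges, is transitive, and C is connected; so m(C - u - x) ≥ k + 1.
      gallai : ∀ C → Connected C → Nonempty C → (∀ u → u ∈ C → suc (m (C - u)) ≡ m C) → m C ≡ 1
      gallai C connected (u , u∈C) essential = go (m (C - u)) ≡.refl
        where
        go : ∀ b → m (C - u) ≡ b → m C ≡ 1
        go zero mu = ≡.trans (≡.sym (essential u u∈C)) (≡.cong suc mu)
        go (suc k) mu with exists-essential (C - u) k mu
        ... | x , x∈ , mx with parallel x (proj₁ (∈-⁻ x∈))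
          where
          mC : m C ≡ suc (suc k)
          mC = ≡.trans (≡.sym (essential u u∈C)) (≡.cong suc mu)
          m- : ∀ {v} → v ∈ C → m (C - v) ≡ suc k
          m- v∈ = ℕ.suc-injective (≡.trans (essential _ v∈) mC)
          -- The case j = u is set apart because the relation concerns two distinct vertices. The
          -- first edge out of u is handled by adjacency alone, the later ones by transitivity.
          step : ∀ i j → i ∈ C → j ∈ C → adj G i j ≡ true → i ≡ u ⊎ suc k ≤ m (C - u - i) →
              j ≡ u ⊎ suc k ≤ m (C - u - j)
          step i j i∈ j∈ ij p with j Fin.≟ u | i Fin.≟ u
          ... | yes e | _ = inj₁ e
          ... | no _ | yes ≡.refl = inj₂ (adjacent⇒parallel i∈ j∈ ij mC (m- i∈) (m- j∈))
          ... | no j≢u | no i≢u with p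
          ... | inj₁ i≡u = ⊥-elim (i≢u i≡u)
          ... | inj₂ ui = inj₂ (parallel-trans u∈C i∈ j∈ (i≢u ∘ ≡.sym) (adjacent⇒≢ ij) (j≢u ∘ ≡.sym) mC mu
              (m- i∈) (m- j∈) ui
                                  (adjacent⇒parallel i∈ j∈ ij mC (m- i∈) (m- j∈)))
          parallel : ∀ j → j ∈ C → j ≡ u ⊎ suc k ≤ m (C - u - j)
          parallel = connected (λ j → j ≡ u ⊎ suc k ≤ m (C - u - j)) u u∈C (inj₁ ≡.refl) step
        ... | inj₁ x≡u = ⊥-elim (proj₂ (∈-⁻ x∈) x≡u)
        ... | inj₂ big = ⊥-elim (ℕ.<-irrefl ≡.refl (ℕ.≤-trans big (ℕ.≤-reflexive mx)))

-- The vertex recurrence for the numbers of r-matchings.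

module MatchingNumbers where

  open import Defs renaming (sym to adj-sym)
  open Subsets
  open import Data.Bool as Bool using (Bool; true; false; _∧_; if_then_else_)
  open import Data.Bool.Properties using (T?; T-≡)
  open import Data.Bool.ListAction using (all)
  open import Data.Nat as ℕ using (ℕ; suc; zero; _+_)
  import Data.Nat.Properties as ℕ
  open import Data.Fin as Fin using (Fin; toℕ)
  import Data.Fin.Properties as Fin
  open import Data.Fin.Subset as Subset using (Subset; _-_)
  open import Data.Fin.Subset.Properties using (x∈p∧x≢y⇒x∈p-y)
  open import Data.List using (List; []; _∷_; _++_; length; filter; filterᵇ; map; allFin)
  open import Data.Nat.ListAction using (sum)
  open import Data.List.Properties using (map-cong)
  open import Data.List.Membership.Propositional using (_∈_; find; lose)
  open import Data.List.Membership.Propositional.Properties using (∈-filter⁺; ∈-filter⁻; ∈-map⁺; ∈-map⁻; ∈-concatMap⁺; ∈-concatMap⁻; ∈-allFin; ∈-++⁺ˡ; ∈-++⁺ʳ; ∈-++⁻)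
  open import Data.List.Membership.Propositional.Properties.WithK using (unique∧set⇒bag)
  open import Data.List.Relation.Binary.BagAndSetEquality using (∼bag⇒↭)
  open import Data.List.Relation.Binary.Permutation.Propositional using (_↭_; refl; prep; swap; trans)
  open import Data.List.Relation.Binary.Permutation.Propositional.Properties using (filter-↭)
  open import Data.List.Relation.Unary.Unique.Propositional using (Unique)
  import Data.List.Relation.Unary.Unique.Propositional.Properties as Unique
  import Data.List.Relation.Unary.AllPairs as AllPairs
  import Data.List.Relation.Unary.AllPairs.Properties as AllPairs
  import Data.List.Relation.Unary.All.Properties as All
  import Data.List.Relation.Unary.All as All
  open import Data.Vec using (lookup)
  open import Data.Product using (_×_; _,_; proj₁; proj₂)
  open import Data.Sum using (_⊎_; inj₁; inj₂; [_,_]′)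
  open import Data.Empty using (⊥-elim)
  open import Function.Base using (_∘_)
  open import Function.Bundles using (mk⇔; Equivalence)
  open import Relation.Nullary using (¬_; Dec; yes; no; does)
  open import Relation.Binary.Definitions using (tri<; tri≈; tri>)
  open import Relation.Nullary.Decidable using (⌊_⌋; isYes≗does; dec-true; dec-false)
  open import Relation.Binary.PropositionalEquality as ≡ using (_≡_; _≢_; cong; cong₂; sym)
  open ≡.≡-Reasoning

  module _ {A : Set} where

    count : (A → Bool) → List A → ℕ
    count b []       = 0
    count b (x ∷ xs) = (if b x then 1 else 0) + count b xs

    length-filter : ∀ (b : A → Bool) xs → length (filter (λ x → b x Bool.≟ true) xs) ≡ count b xs
    length-filter b [] = ≡.refl
    length-filter b (x ∷ xs) with b x
    ... | true  = cong suc (length-filter b xs)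
    ... | false = length-filter b xs

    count-++ : ∀ (b : A → Bool) xs ys → count b (xs ++ ys) ≡ count b xs + count b ys
    count-++ b []       ys = ≡.refl
    count-++ b (x ∷ xs) ys = ≡.trans (cong (_ +_) (count-++ b xs ys)) (sym (ℕ.+-assoc (if b x then 1 else 0) _ _))

    count-cong : ∀ {b c : A → Bool} → (∀ x → b x ≡ c x) → ∀ xs → count b xs ≡ count c xs
    count-cong e []       = ≡.refl
    count-cong e (x ∷ xs) = cong₂ _+_ (cong (if_then 1 else 0) (e x)) (count-cong e xs)

    count-false : ∀ xs → count (λ (_ : A) → false) xs ≡ 0
    count-false []       = ≡.refl
    count-false (x ∷ xs) = count-false xs

  count-map : ∀ {A B : Set} (b : B → Bool) (f : A → B) xs → count b (map f xs) ≡ count (b ∘ f) xs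
  count-map b f []       = ≡.refl
  count-map b f (x ∷ xs) = cong (_ +_) (count-map b f xs)

  count-sublists : ∀ {A : Set} (b : List A → Bool) x xs →
    count b (sublists (x ∷ xs)) ≡ count b (sublists xs) + count (b ∘ (x ∷_)) (sublists xs)
  count-sublists b x xs = ≡.trans (count-++ b (sublists xs) _) (cong (_ +_) (count-map b (x ∷_) (sublists xs)))

  -- Used with d the disjointness from an edge e: matchings through e are counted as matchings in
  -- the list of the edges that avoid e.
  count-sublists-filter : ∀ {A : Set} (d : A → Bool) (q : List A → Bool) xs →
    count (λ L → all d L ∧ q L) (sublists xs) ≡ count q (sublists (filterᵇ d xs))
  count-sublists-filter d q [] = ≡.refl
  count-sublists-filter d q (x ∷ xs) with d x in eq
  ... | true  = begin
    count (λ L → all d L ∧ q L) (sublists (x ∷ xs)) ≡⟨ count-sublists _ x xs ⟩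
    count (λ L → all d L ∧ q L) (sublists xs) + count (λ L → all d (x ∷ L) ∧ q (x ∷ L)) (sublists xs)
      ≡⟨ cong₂ _+_ (count-sublists-filter d q xs)
                   (≡.trans (count-cong (λ L → cong (λ b → (b ∧ all d L) ∧ q (x ∷ L)) eq) (sublists xs))
                       (count-sublists-filter d (q ∘ (x ∷_)) xs)) ⟩
    count q (sublists (filterᵇ d xs)) + count (q ∘ (x ∷_)) (sublists (filterᵇ d xs)) ≡⟨ count-sublists q x
        (filterᵇ d xs) ⟨
    count q (sublists (x ∷ filterᵇ d xs)) ∎
  ... | false = begin
    count (λ L → all d L ∧ q L) (sublists (x ∷ xs)) ≡⟨ count-sublists _ x xs ⟩
    count (λ L → all d L ∧ q L) (sublists xs) + count (λ L → all d (x ∷ L) ∧ q (x ∷ L)) (sublists xs)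
      ≡⟨ cong₂ _+_ (count-sublists-filter d q xs)
                   (≡.trans (count-cong (λ L → cong (λ b → (b ∧ all d L) ∧ q (x ∷ L)) eq) (sublists xs))
                       (count-false (sublists xs))) ⟩
    count q (sublists (filterᵇ d xs)) + 0 ≡⟨ ℕ.+-identityʳ _ ⟩
    count q (sublists (filterᵇ d xs)) ∎

  filterᵇ-comm : ∀ {A : Set} (b c : A → Bool) xs → filterᵇ b (filterᵇ c xs) ≡ filterᵇ c (filterᵇ b xs)
  filterᵇ-comm b c [] = ≡.refl
  filterᵇ-comm b c (x ∷ xs) with b x in bx | c x in cx
  ... | true  | true  rewrite bx | cx = cong (x ∷_) (filterᵇ-comm b c xs)
  ... | true  | false rewrite cx = filterᵇ-comm b c xs
  ... | false | true  rewrite bx = filterᵇ-comm b c xs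
  ... | false | false = filterᵇ-comm b c xs

  ⌊⌋-true : ∀ {P : Set} (d : Dec P) → P → ⌊ d ⌋ ≡ true
  ⌊⌋-true d p = ≡.trans (isYes≗does d) (dec-true d p)

  ⌊⌋-false : ∀ {P : Set} (d : Dec P) → ¬ P → ⌊ d ⌋ ≡ false
  ⌊⌋-false d p = ≡.trans (isYes≗does d) (dec-false d p)

  ∈-filterᵇ⁺ : ∀ {A : Set} (b : A → Bool) {x xs} → x ∈ xs → b x ≡ true → x ∈ filterᵇ b xs
  ∈-filterᵇ⁺ b x∈ bx = ∈-filter⁺ (T? ∘ b) x∈ (Equivalence.from T-≡ bx)

  ∈-filterᵇ⁻ : ∀ {A : Set} (b : A → Bool) {x xs} → x ∈ filterᵇ b xs → x ∈ xs × b x ≡ true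
  ∈-filterᵇ⁻ b {xs = xs} x∈ with ∈-filter⁻ (T? ∘ b) {xs = xs} x∈
  ... | y , bx = y , Equivalence.to T-≡ bx

  module MatchingCount {n : ℕ} (G : Graph n) where

    Edge : Set
    Edge = Fin n × Fin n

    isMatching : ℕ → List Edge → Bool
    isMatching r L = ⌊ length L ℕ.≟ r ⌋ ∧ pairwiseDisjointB G L

    matchings : ℕ → List Edge → ℕ
    matchings r es = count (isMatching r) (sublists es)

    matchings-zero : ∀ es → matchings 0 es ≡ 1
    matchings-zero []       = ≡.refl
    matchings-zero (e ∷ es) = ≡.trans (count-sublists (isMatching 0) e es)
      (≡.trans (cong₂ _+_ (matchings-zero es) (count-false (sublists es))) ≡.refl)

    remaining : Edge → List Edge → List Edge
    remaining e = filterᵇ (disjointB G e)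

    -- A matching either omits e, or consists of e and a matching of edges disjoint from e.
    matchings-suc : ∀ r e es → matchings (suc r) (e ∷ es) ≡ matchings (suc r) es + matchings r (remaining e es)
    matchings-suc r e es = ≡.trans (count-sublists (isMatching (suc r)) e es) (cong (_ +_)
        (≡.trans (count-cong shuffle (sublists es)) (count-sublists-filter (disjointB G e) (isMatching r) es)))
      where
      shuffle : ∀ L → isMatching (suc r) (e ∷ L) ≡ all (disjointB G e) L ∧ isMatching r L
      shuffle L rewrite isYes≗does (suc (length L) ℕ.≟ suc r) | isYes≗does (length L ℕ.≟ r)
        with does (length L ℕ.≟ r) | all (disjointB G e) L
      ... | true  | true  = ≡.refl
      ... | true  | false = ≡.refl
      ... | false | true  = ≡.refl
      ... | false | false = ≡.refl

    private
      ≟-sym : ∀ (a b : Fin n) → ⌊ a Fin.≟ b ⌋ ≡ ⌊ b Fin.≟ a ⌋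
      ≟-sym a b with a Fin.≟ b
      ... | yes e = sym (⌊⌋-true (b Fin.≟ a) (sym e))
      ... | no ne = sym (⌊⌋-false (b Fin.≟ a) (ne ∘ sym))

      disjoint-sym : ∀ e f → disjointB G e f ≡ disjointB G f e
      disjoint-sym (a , b) (c , d) rewrite ≟-sym a c | ≟-sym a d | ≟-sym b c | ≟-sym b d
        with ⌊ c Fin.≟ a ⌋ | ⌊ d Fin.≟ a ⌋ | ⌊ c Fin.≟ b ⌋
      ... | true  | _     | _     = ≡.refl
      ... | false | true  | true  = ≡.refl
      ... | false | true  | false = ≡.refl
      ... | false | false | true  = ≡.refl
      ... | false | false | false = ≡.refl

      -- Splitting off both edges, in either order, sorts the matchings by which of e and f they
      -- contain.
      matchings-swap : ∀ r e f es → matchings r (e ∷ f ∷ es) ≡ matchings r (f ∷ e ∷ es)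
      matchings-swap zero e f es = ≡.trans (matchings-zero (e ∷ f ∷ es)) (sym (matchings-zero (f ∷ e ∷ es)))
      matchings-swap (suc r) e f es = begin
          matchings (suc r) (e ∷ f ∷ es)  ≡⟨ matchings-suc r e (f ∷ es) ⟩
          matchings (suc r) (f ∷ es) + matchings r (remaining e (f ∷ es))  ≡⟨ cong
              (_+ matchings r (remaining e (f ∷ es))) (matchings-suc r f es) ⟩
          matchings (suc r) es + matchings r (remaining f es) + matchings r (remaining e (f ∷ es))  ≡⟨ core r ⟩
          matchings (suc r) es + matchings r (remaining e es) + matchings r (remaining f (e ∷ es))  ≡⟨ cong
              (_+ matchings r (remaining f (e ∷ es))) (matchings-suc r e es) ⟨
          matchings (suc r) (e ∷ es) + matchings r (remaining f (e ∷ es))  ≡⟨ matchings-suc r f (e ∷ es) ⟨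
          matchings (suc r) (f ∷ e ∷ es) ∎
        where
        swap-last : ∀ a b c → a + b + c ≡ a + c + b
        swap-last a b c = ≡.trans (ℕ.+-assoc a b c) (≡.trans (cong (a +_) (ℕ.+-comm b c)) (sym (ℕ.+-assoc a c b)))
        core : ∀ r → matchings (suc r) es + matchings r (remaining f es) + matchings r (remaining e (f ∷ es))
                   ≡ matchings (suc r) es + matchings r (remaining e es) + matchings r (remaining f (e ∷ es))
        core r rewrite disjoint-sym f e with disjointB G e f
        ... | false = swap-last (matchings (suc r) es) _ _
        core zero    | true = begin
          matchings 1 es + matchings 0 (remaining f es) + matchings 0 (f ∷ remaining e es)
            ≡⟨ cong₂ (λ a b → matchings 1 es + a + b) (matchings-zero (remaining f es))
                (matchings-zero (f ∷ remaining e es)) ⟩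
          matchings 1 es + 1 + 1
            ≡⟨ cong₂ (λ a b → matchings 1 es + a + b) (matchings-zero (remaining e es))
                (matchings-zero (e ∷ remaining f es)) ⟨
          matchings 1 es + matchings 0 (remaining e es) + matchings 0 (e ∷ remaining f es) ∎
        -- e and f are disjoint and can occur together. Splitting off the second edge as well leaves
        -- the same four counts on both sides, since the two filters commute.
        core (suc r) | true = begin
          M + a + matchings (suc r) (f ∷ remaining e es)  ≡⟨ cong (M + a +_) (matchings-suc r f (remaining e es)) ⟩
          M + a + (b + matchings r (remaining f (remaining e es)))  ≡⟨ cong (λ L → M + a + (b + matchings r L))
              (filterᵇ-comm (disjointB G f) (disjointB G e) es) ⟩
          M + a + (b + c)  ≡⟨ ℕ.+-assoc (M + a) b c ⟨
          M + a + b + c    ≡⟨ cong (_+ c) (swap-last M a b) ⟩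
          M + b + a + c    ≡⟨ ℕ.+-assoc (M + b) a c ⟩
          M + b + (a + c)  ≡⟨ cong (M + b +_) (matchings-suc r e (remaining f es)) ⟨
          M + b + matchings (suc r) (e ∷ remaining f es) ∎
          where
          M = matchings (suc (suc r)) es
          a = matchings (suc r) (remaining f es)
          b = matchings (suc r) (remaining e es)
          c = matchings r (remaining e (remaining f es))

      matchings-prep : ∀ r e es fs → matchings (suc r) es ≡ matchings (suc r) fs →
        matchings r (remaining e es) ≡ matchings r (remaining e fs) → matchings (suc r) (e ∷ es) ≡ matchings
            (suc r) (e ∷ fs)
      matchings-prep r e es fs p q = ≡.trans (matchings-suc r e es)
          (≡.trans (cong₂ _+_ p q) (sym (matchings-suc r e fs)))

    -- The counts are defined from one particular list of edges; this permits moving the edges at a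
    -- chosen vertex to its front.
    matchings-↭ : ∀ r {es fs} → es ↭ fs → matchings r es ≡ matchings r fs
    matchings-↭ zero {es} {fs} _ = ≡.trans (matchings-zero es) (sym (matchings-zero fs))
    matchings-↭ (suc r) refl = ≡.refl
    matchings-↭ (suc r) (prep {xs = es} {ys = fs} e p) = matchings-prep r e es fs (matchings-↭ (suc r) p)
        (matchings-↭ r (filter-↭ (T? ∘ disjointB G e) p))
    matchings-↭ (suc r) (swap {xs = es} {ys = fs} e f p) = ≡.trans (matchings-swap (suc r) e f es)
      (matchings-prep r f (e ∷ es) (e ∷ fs)
          (matchings-prep r e es fs (matchings-↭ (suc r) p) (matchings-↭ r (filter-↭ (T? ∘ disjointB G e) p)))
        (matchings-↭ r (filter-↭ (T? ∘ disjointB G f) (prep e p))))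
    matchings-↭ (suc r) (trans p q) = ≡.trans (matchings-↭ (suc r) p) (matchings-↭ (suc r) q)

    p≡matchings : ∀ S r → p G S r ≡ matchings r (edges' G S)
    p≡matchings S r = length-filter (isMatching r) (sublists (edges' G S))

    IsEdge : Subset n → Edge → Set
    IsEdge S (i , j) = i Subset.∈ S × j Subset.∈ S × adj G i j ≡ true × toℕ i ℕ.< toℕ j

    private
      inB? : ∀ (S : Subset n) i → Dec (lookup S i ≡ true)
      inB? S i = lookup S i Bool.≟ true

      up : Fin n → List Edge
      up i = map (i ,_) (filter (λ j → toℕ i ℕ.<? toℕ j) (allFin n))

    ∈-edges⁺ : ∀ {S e} → IsEdge S e → e ∈ edges' G S
    ∈-edges⁺ {S} {i , j} (i∈ , j∈ , ij , i<j) = ∈-filter⁺ _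
      (∈-concatMap⁺ up (lose (∈-filter⁺ (inB? S) (∈-allFin i) (lookup-true i∈))
        (∈-map⁺ (i ,_) (∈-filter⁺ (λ k → toℕ i ℕ.<? toℕ k) (∈-allFin j) i<j))))
      (cong₂ _∧_ (lookup-true j∈) ij)

    ∈-edges⁻ : ∀ {S e} → e ∈ edges' G S → IsEdge S e
    ∈-edges⁻ {S} {i , j} e∈ with ∈-filter⁻
        (λ e → (lookup S (proj₂ e) ∧ adj G (proj₁ e) (proj₂ e)) Bool.≟ true) {xs = edges G S} e∈
    ... | e∈′ , q with find (∈-concatMap⁻ up {xs = filter (inB? S) (allFin n)} e∈′)
    ... | k , k∈ , e∈″ with ∈-map⁻ (k ,_) e∈″
    ... | l , l∈ , ≡.refl with ∈-filter⁻ (inB? S) {xs = allFin n} k∈ | ∈-filter⁻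
        (λ j → toℕ k ℕ.<? toℕ j) {xs = allFin n} l∈
    ... | _ , lk | _ , k<l with ∧-true q
    ... | ll , kl = lookup-true⁻ lk , lookup-true⁻ ll , kl , k<l

    edges-unique : ∀ S → Unique (edges' G S)
    edges-unique S = Unique.filter⁺ _ (Unique.concat⁺
        (All.map⁺ (All.universal (λ i → Unique.map⁺ (λ { ≡.refl → ≡.refl }) (Unique.filter⁺ _ (Unique.allFin⁺ n))) _))
        (AllPairs.map⁺ (AllPairs.map disjoint (Unique.filter⁺ (inB? S) (Unique.allFin⁺ n)))))
      where
      disjoint : ∀ {i j} → i ≢ j → ∀ {e} → ¬ (e ∈ up i × e ∈ up j)
      disjoint i≢j (e∈i , e∈j) with ∈-map⁻ (_ ,_) e∈i | ∈-map⁻ (_ ,_) e∈j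
      ... | _ , _ , ≡.refl | _ , _ , ≡.refl = i≢j ≡.refl

    -- The edge uv in the orientation in which `edges'` lists it, smaller endpoint first.
    join : Fin n → Fin n → Edge
    join u v = if does (toℕ u ℕ.<? toℕ v) then (u , v) else (v , u)

    join-elim : ∀ u v (P : Edge → Set) → P (u , v) → P (v , u) → P (join u v)
    join-elim u v P p q with does (toℕ u ℕ.<? toℕ v)
    ... | true  = p
    ... | false = q

    join-< : ∀ u v → toℕ u ℕ.< toℕ v → join u v ≡ (u , v)
    join-< u v u<v rewrite dec-true (toℕ u ℕ.<? toℕ v) u<v = ≡.refl

    join-> : ∀ u v → toℕ v ℕ.< toℕ u → join u v ≡ (v , u)
    join-> u v v<u rewrite dec-false (toℕ u ℕ.<? toℕ v) (ℕ.<-asym v<u) = ≡.refl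

    neighbours : Subset n → Fin n → List (Fin n)
    neighbours T u = filterᵇ (λ v → lookup T v ∧ adj G u v) (allFin n)

    star : Subset n → Fin n → List Edge
    star T u = map (join u) (neighbours T u)

    private
      meets : ∀ u v e → ¬ (proj₁ e ≢ u × proj₁ e ≢ v × proj₂ e ≢ u × proj₂ e ≢ v) → disjointB G (u , v) e ≡ false
      meets u v (i , j) touch with u Fin.≟ i | u Fin.≟ j | v Fin.≟ i | v Fin.≟ j
      ... | yes _ | _     | _     | _     = ≡.refl
      ... | no _  | yes _ | _     | _     = ≡.refl
      ... | no _  | no _  | yes _ | _     = ≡.refl
      ... | no _  | no _  | no _  | yes _ = ≡.refl
      ... | no a  | no b  | no c  | no d  = ⊥-elim (touch (a ∘ sym , c ∘ sym , b ∘ sym , d ∘ sym))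

      avoids : ∀ u v e → proj₁ e ≢ u → proj₁ e ≢ v → proj₂ e ≢ u → proj₂ e ≢ v → disjointB G (u , v) e ≡ true
      avoids u v (i , j) a b c d
        rewrite ⌊⌋-false (u Fin.≟ i) (a ∘ sym) | ⌊⌋-false (u Fin.≟ j) (c ∘ sym)
              | ⌊⌋-false (v Fin.≟ i) (b ∘ sym) | ⌊⌋-false (v Fin.≟ j) (d ∘ sym) = ≡.refl

      meets-join : ∀ u v e → ¬ (proj₁ e ≢ u × proj₁ e ≢ v × proj₂ e ≢ u × proj₂ e ≢ v) →
          disjointB G (join u v) e ≡ false
      meets-join u v e touch = join-elim u v (λ f → disjointB G f e ≡ false) (meets u v e touch)
        (meets v u e λ (a , b , c , d) → touch (b , a , d , c))

      avoids-join : ∀ u v e → proj₁ e ≢ u → proj₁ e ≢ v → proj₂ e ≢ u → proj₂ e ≢ v → disjointB G (join u v) e ≡ true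
      avoids-join u v e a b c d = join-elim u v (λ f → disjointB G f e ≡ true) (avoids u v e a b c d)
          (avoids v u e b a d c)

      touches : Edge → Fin n → Set
      touches e u = proj₁ e ≡ u ⊎ proj₂ e ≡ u

      join-touches : ∀ u v → touches (join u v) u
      join-touches u v = join-elim u v (λ e → touches e u) (inj₁ ≡.refl) (inj₂ ≡.refl)

      joins-meet : ∀ u v w → disjointB G (join u v) (join u w) ≡ false
      joins-meet u v w = meets-join u v (join u w) λ (a , _ , c , _) → [ a , c ]′ (join-touches u w)

      remaining-edges : ∀ T u v → u Subset.∉ T → remaining (join u v) (edges' G T) ↭ edges' G (T - v)
      -- Neither list has duplicates, so having the same members already makes them permutations of
      -- each other.
      remaining-edges T u v u∉T = ∼bag⇒↭
          (unique∧set⇒bag (Unique.filter⁺ _ (edges-unique T)) (edges-unique (T - v)) (mk⇔ to from))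
        where
        to : ∀ {e} → e ∈ remaining (join u v) (edges' G T) → e ∈ edges' G (T - v)
        to {i , j} e∈ with ∈-filterᵇ⁻ (disjointB G (join u v)) {xs = edges' G T} e∈
        ... | e∈T , disj with ∈-edges⁻ {T} e∈T
        ... | i∈ , j∈ , ij , i<j = ∈-edges⁺ (x∈p∧x≢y⇒x∈p-y i∈ i≢v , x∈p∧x≢y⇒x∈p-y j∈ j≢v , ij , i<j)
          where
          clash : ¬ ¬ (i ≢ u × i ≢ v × j ≢ u × j ≢ v)
          clash touch with () ← ≡.trans (sym disj) (meets-join u v (i , j) touch)
          i≢v : i ≢ v
          i≢v e = clash λ (_ , ne , _) → ne e
          j≢v : j ≢ v
          j≢v e = clash λ (_ , _ , _ , ne) → ne e
        from : ∀ {e} → e ∈ edges' G (T - v) → e ∈ remaining (join u v) (edges' G T)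
        from {i , j} e∈ with ∈-edges⁻ {T - v} e∈
        ... | i∈ , j∈ , ij , i<j = ∈-filterᵇ⁺ (disjointB G (join u v))
                (∈-edges⁺ (proj₁ (∈-⁻ i∈) , proj₁ (∈-⁻ j∈) , ij , i<j))
                (avoids-join u v (i , j) (λ { ≡.refl → u∉T (proj₁ (∈-⁻ i∈)) }) (proj₂ (∈-⁻ i∈))
                                         (λ { ≡.refl → u∉T (proj₁ (∈-⁻ j∈)) }) (proj₂ (∈-⁻ j∈)))

      join-injective : ∀ u {v w} → join u v ≡ join u w → v ≡ w
      join-injective u {v} {w} e with does (toℕ u ℕ.<? toℕ v) | does (toℕ u ℕ.<? toℕ w)
      ... | true  | true  with ≡.refl ← e = ≡.refl
      ... | true  | false with ≡.refl ← e = ≡.refl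
      ... | false | true  with ≡.refl ← e = ≡.refl
      ... | false | false with ≡.refl ← e = ≡.refl

      edges-split : ∀ S u → u Subset.∈ S → edges' G S ↭ star (S - u) u ++ edges' G (S - u)
      edges-split S u u∈S = ∼bag⇒↭ (unique∧set⇒bag (edges-unique S)
          (Unique.++⁺ (Unique.map⁺ (join-injective u) (Unique.filter⁺ _ (Unique.allFin⁺ n)))
              (edges-unique (S - u)) disjoint) (mk⇔ to from))
        where
        T = S - u
        ∈-star : ∀ v → v Subset.∈ T → adj G u v ≡ true → join u v ∈ star T u
        ∈-star v v∈ uv = ∈-map⁺ (join u)
            (∈-filterᵇ⁺ (λ v → lookup T v ∧ adj G u v) (∈-allFin v) (cong₂ _∧_ (lookup-true v∈) uv))
        disjoint : ∀ {e} → ¬ (e ∈ star T u × e ∈ edges' G T)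
        disjoint {e} (e∈ , e∈T) with ∈-map⁻ (join u) e∈
        ... | v , _ , ≡.refl with join-touches u v | ∈-edges⁻ {T} e∈T
        ... | inj₁ i≡u | i∈ , _ = proj₂ (∈-⁻ i∈) i≡u
        ... | inj₂ j≡u | _ , j∈ , _ = proj₂ (∈-⁻ j∈) j≡u
        to : ∀ {e} → e ∈ edges' G S → e ∈ star T u ++ edges' G T
        to {i , j} e∈ with ∈-edges⁻ {S} e∈
        ... | i∈ , j∈ , ij , i<j with i Fin.≟ u | j Fin.≟ u
        ... | yes ≡.refl | _ = ∈-++⁺ˡ (≡.subst (_∈ star T u) (join-< i j i<j)
                (∈-star j (x∈p∧x≢y⇒x∈p-y j∈ λ { ≡.refl → ℕ.<-irrefl ≡.refl i<j }) ij))
        ... | no i≢u | yes ≡.refl = ∈-++⁺ˡ (≡.subst (_∈ star T u) (join-> j i i<j)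
                (∈-star i (x∈p∧x≢y⇒x∈p-y i∈ i≢u) (≡.trans (adj-sym G j i) ij)))
        ... | no i≢u | no j≢u = ∈-++⁺ʳ (star T u) (∈-edges⁺ (x∈p∧x≢y⇒x∈p-y i∈ i≢u , x∈p∧x≢y⇒x∈p-y j∈ j≢u , ij , i<j))
        from : ∀ {e} → e ∈ star T u ++ edges' G T → e ∈ edges' G S
        from {e} e∈ with ∈-++⁻ (star T u) e∈
        ... | inj₂ e∈T = let i∈ , j∈ , r = ∈-edges⁻ {T} e∈T in ∈-edges⁺ (proj₁ (∈-⁻ i∈) , proj₁ (∈-⁻ j∈) , r)
        ... | inj₁ e∈st with ∈-map⁻ (join u) e∈st
        ... | v , v∈ , ≡.refl with ∧-true (proj₂ (∈-filterᵇ⁻ (λ v → lookup T v ∧ adj G u v) {xs = allFin n} v∈))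
        ... | lv , uv with ∈-⁻ {p = S} (lookup-true⁻ {p = T} lv)
        ... | v∈S , v≢u with ℕ.<-cmp (toℕ u) (toℕ v)
        ... | tri< u<v _ _ = ≡.subst (_∈ edges' G S) (sym (join-< u v u<v)) (∈-edges⁺ (u∈S , v∈S , uv , u<v))
        ... | tri≈ _ e _ = ⊥-elim (v≢u (sym (Fin.toℕ-injective e)))
        ... | tri> _ _ v<u = ≡.subst (_∈ edges' G S) (sym (join-> u v v<u))
            (∈-edges⁺ (v∈S , u∈S , ≡.trans (adj-sym G v u) uv , v<u))

      -- Any two edges at u meet, so a matching contains at most one of them, and removing the edges
      -- that meet one star edge removes the whole star.
      matchings-star : ∀ r u vs es → matchings (suc r) (map (join u) vs ++ es)
                       ≡ matchings (suc r) es + sum (map (λ v → matchings r (remaining (join u v) es)) vs)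
      matchings-star r u []       es = sym (ℕ.+-identityʳ _)
      matchings-star r u (v ∷ vs) es = begin
        matchings (suc r) (join u v ∷ map (join u) vs ++ es) ≡⟨ matchings-suc r (join u v) (map (join u) vs ++ es) ⟩
        matchings (suc r) (map (join u) vs ++ es) + matchings r (remaining (join u v) (map (join u) vs ++ es))
          ≡⟨ cong₂ _+_ (matchings-star r u vs es) (cong (matchings r) (drop vs)) ⟩
        matchings (suc r) es + rest + first  ≡⟨ ℕ.+-assoc (matchings (suc r) es) rest first ⟩
        matchings (suc r) es + (rest + first) ≡⟨ cong (matchings (suc r) es +_) (ℕ.+-comm rest first) ⟩
        matchings (suc r) es + (first + rest) ∎
        where
        first = matchings r (remaining (join u v) es)
        rest  = sum (map (λ v → matchings r (remaining (join u v) es)) vs)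
        drop : ∀ ws → remaining (join u v) (map (join u) ws ++ es) ≡ remaining (join u v) es
        drop [] = ≡.refl
        drop (w ∷ ws) rewrite joins-meet u v w = drop ws

    p-zero : ∀ S → p G S 0 ≡ 1
    p-zero S = ≡.trans (p≡matchings S 0) (matchings-zero (edges' G S))

    -- A matching leaves u uncovered or contains exactly one edge at u.
    p-suc : ∀ S u r → u Subset.∈ S →
        p G S (suc r) ≡ p G (S - u) (suc r) + sum (map (λ v → p G (S - u - v) r) (neighbours (S - u) u))
    p-suc S u r u∈S = begin
      p G S (suc r)                     ≡⟨ p≡matchings S (suc r) ⟩
      matchings (suc r) (edges' G S)    ≡⟨ matchings-↭ (suc r) (edges-split S u u∈S) ⟩
      matchings (suc r) (star T u ++ edges' G T) ≡⟨ matchings-star r u (neighbours T u) (edges' G T) ⟩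
      matchings (suc r) (edges' G T) + sum
          (map (λ v → matchings r (remaining (join u v) (edges' G T))) (neighbours T u))
        ≡⟨ cong₂ _+_ (sym (p≡matchings T (suc r))) (cong sum (map-cong (λ v →
             ≡.trans (matchings-↭ r (remaining-edges T u v (x∉p-x S u))) (sym (p≡matchings (T - v) r)))
                 (neighbours T u))) ⟩
      p G T (suc r) + sum (map (λ v → p G (T - v) r) (neighbours T u)) ∎
      where T = S - u

-- Taylor expansions of matching polynomials at θ; multiplicity as order.

module TaylorExpansions where

  open import Defs hiding (sym)
  open Subsets
  open Series
  open Orders
  open Recurrences
  open MatchingNumbers
  open import Data.Bool using (Bool; true; false; _∧_; if_then_else_)
  open import Data.Nat as ℕ using (ℕ; suc; zero; z≤n; s≤s; _∸_)
  import Data.Nat.Properties as ℕ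
  open import Data.Nat.DivMod using (_/_; _%_; m/n≡1+[m∸n]/n)
  open import Data.Nat.ListAction using (sum)
  open import Data.Integer as ℤ using (ℤ; +_)
  open import Data.Fin as Fin using (Fin; suc; zero)
  open import Data.Fin.Subset using (Subset; _∈_; _-_; ∣_∣; ⊥)
  open import Data.Fin.Subset.Properties using (nonempty?; Empty-unique; ∉⊥; ∣⊥∣≡0)
  open import Data.List as List using (List; []; _∷_; length; map; upTo; applyUpTo; allFin; filterᵇ; tabulate)
  open import Data.List.Properties using (map-upTo; length-map; length-upTo; map-∘)
  open import Data.List.Membership.Propositional using () renaming (_∈_ to _∈ᴸ_)
  open import Data.List.Relation.Unary.Any using (here; there)
  open import Data.Vec using (lookup)
  open import Data.Product using (_,_; proj₁; proj₂)
  open import Data.Empty using (⊥-elim)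
  open import Function.Base using (_∘_)
  open import Relation.Nullary using (¬_; yes; no)
  open import Relation.Nullary.Decidable using (⌊_⌋)
  open import Relation.Binary.PropositionalEquality as ≡ using (_≡_)

  module Taylor (R : RealField) (θ : RealField.Carrier R) where
    open RealField R hiding (zero; _-_) renaming (_<_ to infix 4 _<ᴿ_)
    open WithReals R
    open PowerSeries commRing
    open Ordered R
    open import Algebra.Properties.Group +-group using () renaming (ε⁻¹≈ε to -0≈0)
    open import Algebra.Properties.AbelianGroup +-abelianGroup using () renaming (⁻¹-∙-comm to -‿+-comm)
    open import Algebra.Solver.Ring.NaturalCoefficients.Default 𝕊.commutativeSemiring
      using (solve; _:=_; _:+_; _:*_; con)
    open import Algebra.Properties.Semiring.Sum semiring using () renaming (sum to sumᴿ; sum-cong-≋ to sumᴿ-cong)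

    y : Series
    y = θ +t

    C-+ : ∀ a b → C⟨ a + b ⟩ ≋ C⟨ a ⟩ 𝕊.+ C⟨ b ⟩
    C-+ a b = pointwise λ { zero → refl ; (suc _) → sym (+-identityˡ 0#) }

    C-* : ∀ a b → C⟨ a * b ⟩ ≋ C⟨ a ⟩ 𝕊.* C⟨ b ⟩
    C-* a b = pointwise λ { zero → refl ; (suc i) → sym (trans (coeff-C* a C⟨ b ⟩ (suc i)) (zeroʳ a)) }

    C-cong : ∀ {a b} → a ≈ b → C⟨ a ⟩ ≋ C⟨ b ⟩
    C-cong e = pointwise λ { zero → e ; (suc _) → refl }

    C-0 : C⟨ 0# ⟩ ≋ 𝕊.0#
    C-0 = pointwise λ { zero → refl ; (suc _) → refl }

    -- Horner's scheme at x = θ + t.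
    taylor : List Carrier → Series
    taylor []       = 𝕊.0#
    taylor (a ∷ as) = C⟨ a ⟩ 𝕊.+ y 𝕊.* taylor as

    taylor-divLin : ∀ f → taylor f ≋ C⟨ proj₂ (divLin θ f) ⟩ 𝕊.+ t 𝕊.* taylor (proj₁ (divLin θ f))
    taylor-divLin [] = 𝕊.sym (𝕊.trans (𝕊.+-cong C-0 (𝕊.zeroʳ t)) (𝕊.+-identityˡ 𝕊.0#))
    taylor-divLin (a ∷ as) with divLin θ as | taylor-divLin as
    ... | q , r | ih = 𝕊.trans (𝕊.+-congˡ (𝕊.*-congˡ ih))
      (𝕊.trans (solve 5 (λ A Θ T r Q → A :+ (Θ :+ T) :* (r :+ T :* Q) := (A :+ Θ :* r) :+ T :* (r :+ (Θ :+ T) :* Q))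
          𝕊.refl C⟨ a ⟩ C⟨ θ ⟩ t C⟨ r ⟩ (taylor q))
        (𝕊.+-congʳ (𝕊.sym (𝕊.trans (C-+ a (θ * r)) (𝕊.+-congˡ (C-* θ r))))))

    -- Since x - θ = t, each successful division shifts the Taylor coefficients down by one. A
    -- nonzero coefficient at an index below the fuel ensures that the count ends at a nonzero
    -- remainder and not because the fuel is used up.
    ord-multFuel : ∀ k f i → i ℕ.< k → ¬ coeff (taylor f) i ≈ 0# → Ord (multFuel k θ f) (taylor f)
    ord-multFuel (suc k) f i i<k nz with divLin θ f | taylor-divLin f
    ... | q , r | e with r ≟ 0#
    ...   | no r≉0 = ord (λ _ ()) λ z → r≉0
        (trans (sym (trans (+-congˡ (coeff-t* (taylor q) 0)) (+-identityʳ r))) (trans (sym (at e 0)) z))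
    ...   | yes r≈0 with i
    ...     | zero = ⊥-elim (nz (trans (at e 0) (trans (+-cong r≈0 (coeff-t* (taylor q) 0)) (+-identityˡ 0#))))
    ...     | suc j = ord van λ z → leading o (trans (sym (shifted (multFuel k θ q))) z)
      where
      shifted : ∀ i → coeff (taylor f) (suc i) ≈ coeff (taylor q) i
      shifted i = trans (at e (suc i)) (trans (+-identityˡ _) (coeff-t* (taylor q) (suc i)))
      o = ord-multFuel k q j (ℕ.≤-pred i<k) λ z → nz (trans (shifted j) z)
      van : Vanishes (suc (multFuel k θ q)) (taylor f)
      van zero    _        = trans (at e 0) (trans (+-cong r≈0 (coeff-t* (taylor q) 0)) (+-identityˡ 0#))
      van (suc i) (s≤s i<) = trans (shifted i) (vanishes o i i<)

    poly : ℕ → (ℕ → Carrier) → Series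
    poly N c = taylor (applyUpTo c N)

    poly-cong : ∀ N {c d} → (∀ k → k ℕ.< N → c k ≈ d k) → poly N c ≋ poly N d
    poly-cong zero    e = 𝕊.refl
    poly-cong (suc N) e = 𝕊.+-cong (C-cong (e 0 (s≤s z≤n))) (𝕊.*-congˡ (poly-cong N λ k k<N → e (suc k) (s≤s k<N)))

    coeff-y*-suc : ∀ f i → coeff (y 𝕊.* f) (suc i) ≈ θ * coeff f (suc i) + coeff f i
    coeff-y*-suc f i = trans (at (𝕊.distribʳ f C⟨ θ ⟩ t) (suc i)) (+-cong (coeff-C* θ f (suc i)) (coeff-t* f (suc i)))

    poly-degree : ∀ N c i → N ℕ.≤ i → coeff (poly N c) i ≈ 0#
    poly-degree zero    c i       _         = refl
    poly-degree (suc N) c (suc i) (s≤s N≤i) = trans (+-identityˡ _) (trans (coeff-y*-suc (poly N (c ∘ suc)) i)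
      (trans (+-cong (trans (*-congˡ (poly-degree N (c ∘ suc) (suc i) (ℕ.m≤n⇒m≤1+n N≤i))) (zeroʳ θ))
          (poly-degree N (c ∘ suc) i N≤i)) (+-identityˡ 0#)))

    -- The translation x = θ + t preserves the top coefficient. This supplies the nonzero
    -- coefficient that `ord-multFuel` asks for.
    poly-top : ∀ N c → coeff (poly (suc N) c) N ≈ c N
    poly-top zero    c = trans (+-congˡ (trans (at (𝕊.zeroʳ y) 0) refl)) (+-identityʳ (c 0))
    poly-top (suc N) c = trans (+-identityˡ _) (trans (coeff-y*-suc (poly (suc N) (c ∘ suc)) N)
      (trans (+-cong (trans (*-congˡ (poly-degree (suc N) (c ∘ suc) (suc N) ℕ.≤-refl)) (zeroʳ θ))
          (poly-top N (c ∘ suc))) (+-identityˡ _)))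

    y^ : ℕ → Series
    y^ zero    = 𝕊.1#
    y^ (suc N) = y 𝕊.* y^ N

    poly-suc : ∀ N c → poly (suc N) c ≋ poly N c 𝕊.+ C⟨ c N ⟩ 𝕊.* y^ N
    poly-suc zero    c = solve 2 (λ a b → a :+ b :* con 0 := con 0 :+ a :* con 1) 𝕊.refl C⟨ c 0 ⟩ y
    poly-suc (suc N) c = 𝕊.trans (𝕊.+-congˡ (𝕊.*-congˡ (poly-suc N (c ∘ suc))))
      (solve 5 (λ a b p d z → a :+ b :* (p :+ d :* z) := (a :+ b :* p) :+ d :*
          (b :* z)) 𝕊.refl C⟨ c 0 ⟩ y _ C⟨ c (suc N) ⟩ (y^ N))

    -- Σ_r q(r) y^(N − 2r)
    alternate : ℕ → (ℕ → Carrier) → Series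
    alternate zero          q = C⟨ q 0 ⟩
    alternate (suc zero)    q = C⟨ q 0 ⟩ 𝕊.* y
    alternate (suc (suc N)) q = C⟨ q 0 ⟩ 𝕊.* y^ (suc (suc N)) 𝕊.+ alternate N (q ∘ suc)

    -- Coefficients indexed by codegree, the distance d = N - k from the top degree: the even
    -- positions carry q, the odd ones zero.
    spread : (ℕ → Carrier) → ℕ → Carrier
    spread q zero          = q 0
    spread q (suc zero)    = 0#
    spread q (suc (suc d)) = spread (q ∘ suc) d

    -- The two highest degrees carry q(0) and zero. Removing them leaves the same pattern with N
    -- lowered by two and q shifted by one.
    poly-spread : ∀ N q → poly (suc N) (λ k → spread q (N ∸ k)) ≋ alternate N q
    poly-spread zero q = 𝕊.trans (𝕊.+-congˡ (𝕊.zeroʳ y)) (𝕊.+-identityʳ _)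
    poly-spread (suc zero) q = 𝕊.trans (𝕊.+-congʳ C-0)
      (solve 2 (λ a b → con 0 :+ b :* (a :+ b :* con 0) := a :* b) 𝕊.refl C⟨ q 0 ⟩ y)
    poly-spread (suc (suc N)) q = 𝕊.trans (poly-suc (suc (suc N)) c) (𝕊.trans (𝕊.+-congʳ (poly-suc (suc N) c))
      (𝕊.trans (𝕊.+-cong (𝕊.+-cong (poly-cong (suc N) low) (𝕊.*-congʳ (𝕊.trans (C-cong mid) C-0)))
          (𝕊.*-congʳ (C-cong top)))
      (𝕊.trans (solve 4 (λ p z a w → p :+ con 0 :* z :+ a :* w := a :* w :+ p) 𝕊.refl _ (y^ (suc N)) C⟨ q 0 ⟩
          (y^ (suc (suc N))))
        (𝕊.+-congˡ (poly-spread N (q ∘ suc))))))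
      where
      c : ℕ → Carrier
      c k = spread q (suc (suc N) ∸ k)
      top : c (suc (suc N)) ≈ q 0
      top = reflexive (≡.cong (spread q) (ℕ.n∸n≡0 N))
      mid : c (suc N) ≈ 0#
      mid = reflexive (≡.cong (spread q) (ℕ.m+n∸n≡m 1 N))
      low : ∀ k → k ℕ.< suc N → c k ≈ spread (q ∘ suc) (N ∸ k)
      low k k<1+N = reflexive (≡.cong (spread q) (ℕ.+-∸-assoc 2 (ℕ.≤-pred k<1+N)))

    alternate-cong : ∀ N {q q′} → (∀ r → q r ≈ q′ r) → alternate N q ≋ alternate N q′
    alternate-cong zero          e = C-cong (e 0)
    alternate-cong (suc zero)    e = 𝕊.*-congʳ (C-cong (e 0))
    alternate-cong (suc (suc N)) e = 𝕊.+-cong (𝕊.*-congʳ (C-cong (e 0))) (alternate-cong N (e ∘ suc))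

    alternate-+ : ∀ N q q′ → alternate N (λ r → q r + q′ r) ≋ alternate N q 𝕊.+ alternate N q′
    alternate-+ zero          q q′ = C-+ _ _
    alternate-+ (suc zero)    q q′ = 𝕊.trans (𝕊.*-congʳ (C-+ _ _)) (𝕊.distribʳ y _ _)
    alternate-+ (suc (suc N)) q q′ = 𝕊.trans (𝕊.+-cong (𝕊.*-congʳ (C-+ _ _)) (alternate-+ N (q ∘ suc) (q′ ∘ suc)))
      (solve 5 (λ a b z u v → (a :+ b) :* z :+ (u :+ v) := (a :* z :+ u) :+
          (b :* z :+ v)) 𝕊.refl C⟨ q 0 ⟩ C⟨ q′ 0 ⟩ _ _ _)

    alternate-0 : ∀ N → alternate N (λ _ → 0#) ≋ 𝕊.0#
    alternate-0 zero          = C-0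
    alternate-0 (suc zero)    = 𝕊.trans (𝕊.*-congʳ C-0) (𝕊.zeroˡ y)
    alternate-0 (suc (suc N)) = 𝕊.trans (𝕊.+-cong (𝕊.trans (𝕊.*-congʳ C-0) (𝕊.zeroˡ _)) (alternate-0 N))
        (𝕊.+-identityˡ _)

    -- When N is odd, the right-hand side has one summand more, the constant q(r) with 2r = N + 1;
    -- the hypothesis makes it vanish. `p-vanishes` supplies it for matching numbers.
    y*alternate : ∀ N q → (∀ r → r ℕ.+ r ≡ suc N → q r ≈ 0#) → y 𝕊.* alternate N q ≋ alternate (suc N) q
    y*alternate zero          q z = 𝕊.*-comm y _
    y*alternate (suc zero)    q z = 𝕊.trans
        (solve 2 (λ a b → b :* (a :* b) := a :* (b :* (b :* con 1)) :+ con 0) 𝕊.refl C⟨ q 0 ⟩ y)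
      (𝕊.+-congˡ (𝕊.sym (𝕊.trans (C-cong (z 1 ≡.refl)) C-0)))
    y*alternate (suc (suc N)) q z = 𝕊.trans
        (solve 4 (λ a b w p → b :* (a :* w :+ p) := a :* (b :* w) :+ b :* p) 𝕊.refl C⟨ q 0 ⟩ y _ _)
      (𝕊.+-congˡ (y*alternate N (q ∘ suc) λ r e → z (suc r)
          (≡.trans (≡.cong suc (ℕ.+-suc r r)) (≡.cong (λ k → suc (suc k)) e))))

    fromℕ-+ : ∀ a b → fromℕ (a ℕ.+ b) ≈ fromℕ a + fromℕ b
    fromℕ-+ zero    b = sym (+-identityˡ _)
    fromℕ-+ (suc a) b = trans (+-congˡ (fromℕ-+ a b)) (sym (+-assoc _ _ _))

    signed : ℕ → Carrier → Carrier
    signed zero    x = x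
    signed (suc r) x = - signed r x

    signed-cong : ∀ r {x x′} → x ≈ x′ → signed r x ≈ signed r x′
    signed-cong zero    e = e
    signed-cong (suc r) e = -‿cong (signed-cong r e)

    signed-+ : ∀ r x x′ → signed r (x + x′) ≈ signed r x + signed r x′
    signed-+ zero    x x′ = refl
    signed-+ (suc r) x x′ = trans (-‿cong (signed-+ r x x′)) (sym (-‿+-comm _ _))

    signed-0 : ∀ r → signed r 0# ≈ 0#
    signed-0 zero    = refl
    signed-0 (suc r) = trans (-‿cong (signed-0 r)) -0≈0

    fromℤ-neg : ∀ k → fromℤ (ℤ.- (+ k)) ≈ - fromℕ k
    fromℤ-neg zero    = sym -0≈0
    fromℤ-neg (suc k) = refl

    fromℤ-signed : ∀ r k → fromℤ (if ⌊ r % 2 ℕ.≟ 0 ⌋ then + k else ℤ.- (+ k)) ≈ signed r (fromℕ k)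
    fromℤ-signed zero          k = refl
    fromℤ-signed (suc zero)    k = fromℤ-neg k
    fromℤ-signed (suc (suc r)) k = trans (fromℤ-signed r k) (sym (-‿involutive _))
      where open import Algebra.Properties.Ring ring using (-‿involutive)

    module _ {n : ℕ} (G : Graph n) where
      open MatchingCount G

      -- The coefficient function is local to the definition of μ; unification recovers it.
      mutual
        matchingCoeff : Subset n → ℕ → ℤ
        matchingCoeff = _

        μ≡ : ∀ S → μ G S ≡ map (matchingCoeff S) (upTo (suc ∣ S ∣))
        μ≡ S = ≡.refl

      F : Subset n → Series
      F S = taylor (map fromℤ (μ G S))

      q : Subset n → ℕ → Carrier
      q S r = signed r (fromℕ (p G S r))

      half : ∀ d → suc (suc d) / 2 ≡ suc (d / 2)
      half d = m/n≡1+[m∸n]/n {suc (suc d)} {2} (s≤s (s≤s z≤n))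

      spread-parity : ∀ (f : ℕ → Carrier) d → spread f d ≈ (if ⌊ d % 2 ℕ.≟ 0 ⌋ then f (d / 2) else 0#)
      spread-parity f zero          = refl
      spread-parity f (suc zero)    = refl
      spread-parity f (suc (suc d)) = trans (spread-parity (f ∘ suc) d)
        (reflexive (≡.cong (λ k → if ⌊ d % 2 ℕ.≟ 0 ⌋ then f k else 0#) (≡.sym (half d))))

      matchingCoeff-spread : ∀ S k → fromℤ (matchingCoeff S k) ≈ spread (q S) (∣ S ∣ ∸ k)
      matchingCoeff-spread S k = trans even (sym (spread-parity (q S) (∣ S ∣ ∸ k)))
        where
        even : fromℤ (matchingCoeff S k) ≈ (if ⌊ (∣ S ∣ ∸ k) % 2 ℕ.≟ 0 ⌋ then q S ((∣ S ∣ ∸ k) / 2) else 0#)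
        even with (∣ S ∣ ∸ k) % 2
        ... | zero  = fromℤ-signed ((∣ S ∣ ∸ k) / 2) (p G S ((∣ S ∣ ∸ k) / 2))
        ... | suc _ = refl

      F-poly : ∀ S → F S ≋ poly (suc ∣ S ∣) (λ k → spread (q S) (∣ S ∣ ∸ k))
      F-poly S = 𝕊.trans (𝕊.reflexive
          (≡.cong taylor (≡.trans (≡.sym (map-∘ (upTo (suc ∣ S ∣))))
              (map-upTo (fromℤ ∘ matchingCoeff S) (suc ∣ S ∣)))))
        (poly-cong (suc ∣ S ∣) λ k _ → matchingCoeff-spread S k)

      F-alternate : ∀ S → F S ≋ alternate ∣ S ∣ (q S)
      F-alternate S = 𝕊.trans (F-poly S) (poly-spread ∣ S ∣ (q S))

      F-alternate′ : ∀ S {N} → ∣ S ∣ ≡ N → F S ≋ alternate N (q S)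
      F-alternate′ S ≡.refl = F-alternate S

      q-zero : ∀ S → q S 0 ≈ 1#
      q-zero S = trans (reflexive (≡.cong fromℕ (p-zero S))) (+-identityʳ 1#)

      -- The matching polynomial is monic of degree |S|, so its Taylor coefficient at |S| is 1, just
      -- below the fuel |S| + 1.
      ord-mult : ∀ S → Ord (mult G θ S) (F S)
      ord-mult S = ord-multFuel (length (map fromℤ (μ G S))) (map fromℤ (μ G S)) ∣ S ∣
        (ℕ.≤-reflexive (≡.sym (≡.trans (length-map fromℤ (μ G S))
            (≡.trans (length-map (matchingCoeff S) (upTo (suc ∣ S ∣))) (length-upTo (suc ∣ S ∣))))))
        λ z → 1≉0 (trans (sym (trans (at (F-poly S) ∣ S ∣) (trans (poly-top ∣ S ∣ λ k → spread (q S) (∣ S ∣ ∸ k))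
          (trans (reflexive (≡.cong (spread (q S)) (ℕ.n∸n≡0 ∣ S ∣))) (q-zero S))))) z)

      F-⊥ : F ⊥ ≋ 𝕊.1#
      F-⊥ = 𝕊.trans (F-alternate′ ⊥ (∣⊥∣≡0 n)) (C-cong (q-zero ⊥))

      -- An r-matching covers 2r vertices. In the recurrence this is seen by removing one vertex, or
      -- two together with one edge.
      p-vanishes : ∀ k S r → ∣ S ∣ ℕ.≤ k → ∣ S ∣ ℕ.< r ℕ.+ r → p G S r ≡ 0
      p-vanishes k S (suc r) ∣S∣≤k lt with nonempty? S
      ... | no empty with ≡.refl ← Empty-unique empty = no-edges (edges' G ⊥) ≡.refl
        where
        no-edges : ∀ es → edges' G ⊥ ≡ es → p G ⊥ (suc r) ≡ 0
        no-edges [] e = ≡.trans (p≡matchings ⊥ (suc r)) (≡.cong (matchings (suc r)) e)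
        no-edges (x ∷ es) e = ⊥-elim (∉⊥ (proj₁ (∈-edges⁻ {⊥} (≡.subst (x ∈ᴸ_) (≡.sym e) (here ≡.refl)))))
      p-vanishes zero    S (suc r) ∣S∣≤0 lt | yes (u , u∈S)
        with () ← ≡.trans (≡.sym (ℕ.n≤0⇒n≡0 ∣S∣≤0)) (∣p∣≡1+∣p-x∣ u∈S)
      p-vanishes (suc k) S (suc r) ∣S∣≤k lt | yes (u , u∈S) = ≡.trans (p-suc S u r u∈S) (≡.cong₂ ℕ._+_
          (p-vanishes k (S - u) (suc r) small (ℕ.<-trans (ℕ.≤-reflexive (≡.sym (∣p∣≡1+∣p-x∣ u∈S))) lt))
          (all-zero (neighbours (S - u) u) λ v v∈ → removed v
              (lookup-true⁻ {p = S - u} (proj₁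
                  (∧-true (proj₂ (∈-filterᵇ⁻ (λ v → lookup (S - u) v ∧ adj G u v) {xs = allFin n} v∈)))))))
        where
        small : ∣ S - u ∣ ℕ.≤ k
        small = ℕ.≤-pred (ℕ.≤-trans (ℕ.≤-reflexive (≡.sym (∣p∣≡1+∣p-x∣ u∈S))) ∣S∣≤k)
        all-zero : ∀ vs → (∀ v → v ∈ᴸ vs → p G (S - u - v) r ≡ 0) → sum (map (λ v → p G (S - u - v) r) vs) ≡ 0
        all-zero []       z = ≡.refl
        all-zero (v ∷ vs) z = ≡.cong₂ ℕ._+_ (z v (here ≡.refl)) (all-zero vs λ w w∈ → z w (there w∈))
        removed : ∀ v → v ∈ S - u → p G (S - u - v) r ≡ 0
        removed v v∈ = p-vanishes k (S - u - v) r
            (ℕ.≤-trans (ℕ.n≤1+n _) (ℕ.≤-trans (ℕ.≤-reflexive (≡.sym (∣p∣≡1+∣p-x∣ v∈))) small))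
          (ℕ.≤-pred (ℕ.≤-pred (ℕ.≤-trans (ℕ.≤-reflexive
              (≡.cong suc (≡.sym (≡.trans (∣p∣≡1+∣p-x∣ u∈S) (≡.cong suc (∣p∣≡1+∣p-x∣ v∈)))))) 
            (ℕ.≤-trans lt (ℕ.≤-reflexive (≡.cong suc (ℕ.+-suc r r)))))))

      open Recurrence seriesRing G using (Recursive; neighbourSum; neighbourTerm) renaming
          (sum to sumˢ; sum-cong-≋ to sumˢ-cong)

      fromℕ-sum : ∀ {k} (b : Fin n → Bool) (f : Fin n → ℕ) (g : Fin k → Fin n) →
        fromℕ (sum (map f (filterᵇ b (tabulate g)))) ≈ sumᴿ (λ i → if b (g i) then fromℕ (f (g i)) else 0#)
      fromℕ-sum {zero}  b f g = refl
      fromℕ-sum {suc k} b f g with b (g zero)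
      ... | true  = trans (fromℕ-+ (f (g zero)) _) (+-congˡ (fromℕ-sum b f (g ∘ suc)))
      ... | false = trans (fromℕ-sum b f (g ∘ suc)) (sym (+-identityˡ _))

      signed-sum : ∀ {k} r (f : Fin k → Carrier) → signed r (sumᴿ f) ≈ sumᴿ (λ i → signed r (f i))
      signed-sum {zero}  r f = signed-0 r
      signed-sum {suc k} r f = trans (signed-+ r _ _) (+-congˡ (signed-sum r (f ∘ suc)))

      alternate-sum : ∀ {k} N (f : Fin k → ℕ → Carrier) →
          alternate N (λ r → sumᴿ (λ i → f i r)) ≋ sumˢ (λ i → alternate N (f i))
      alternate-sum {zero}  N f = alternate-0 N
      alternate-sum {suc k} N f = 𝕊.trans (alternate-+ N (f zero) _) (𝕊.+-congˡ (alternate-sum N (f ∘ suc)))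

      neighbourCoeff : Subset n → Fin n → Fin n → ℕ → Carrier
      neighbourCoeff T u v r = if lookup T v ∧ adj G u v then q (T - v) r else 0#

      delayed : (ℕ → Carrier) → ℕ → Carrier
      delayed f zero    = 0#
      delayed f (suc r) = f r

      -- The neighbour terms have one edge fewer and hence the opposite sign, which puts them on the
      -- left; `delayed` accounts for the index lowered by one.
      q-recursive : ∀ S u → u ∈ S → ∀ r →
          q S r + delayed (λ r → sumᴿ (λ v → neighbourCoeff (S - u) u v r)) r ≈ q (S - u) r
      q-recursive S u u∈S zero    = trans (+-identityʳ _) (trans (q-zero S) (sym (q-zero (S - u))))
      q-recursive S u u∈S (suc r) = trans
          (+-congʳ (trans (signed-cong (suc r) (trans (reflexive (≡.cong fromℕ (p-suc S u r u∈S)))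
          (trans (fromℕ-+ (p G T (suc r)) _)
              (+-congˡ (fromℕ-sum (λ v → lookup T v ∧ adj G u v) (λ v → p G (T - v) r) (λ i → i))))))
          (signed-+ (suc r) (fromℕ (p G T (suc r))) D)))
          (trans (+-assoc _ _ _) (trans (+-congˡ (trans (+-congˡ same) (-‿inverseˡ (signed r D)))) (+-identityʳ _)))
        where
        T = S - u
        D = sumᴿ (λ v → if lookup T v ∧ adj G u v then fromℕ (p G (T - v) r) else 0#)
        term : ∀ v → neighbourCoeff T u v r ≈ signed r (if lookup T v ∧ adj G u v then fromℕ (p G (T - v) r) else 0#)
        term v with lookup T v ∧ adj G u v
        ... | true  = refl
        ... | false = sym (signed-0 r)
        same : sumᴿ (λ v → neighbourCoeff T u v r) ≈ signed r D
        same = trans (sumᴿ-cong term) (sym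
            (signed-sum {n} r λ v → if lookup T v ∧ adj G u v then fromℕ (p G (T - v) r) else 0#))

      -- All terms are written as alternating sums for the common degree |S|: the neighbour sum
      -- through `delayed`, the product with y through `y*alternate`. Then the coefficients are
      -- compared by `q-recursive`.
      F-recursive : Recursive (λ _ → y) F
      F-recursive S u u∈S = 𝕊.trans (𝕊.+-cong (F-alternate′ S (∣p∣≡1+∣p-x∣ u∈S)) (nb ∣ T ∣ ≡.refl))
          (𝕊.trans (𝕊.sym (alternate-+ (suc ∣ T ∣) (q S) _))
          (𝕊.trans (alternate-cong (suc ∣ T ∣) (q-recursive S u u∈S))
          (𝕊.trans (𝕊.sym (y*alternate ∣ T ∣ (q T) top)) (𝕊.*-congˡ (𝕊.sym (F-alternate T))))))
        where
        T = S - u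
        Σq : ℕ → Carrier
        Σq r = sumᴿ (λ v → neighbourCoeff T u v r)
        top : ∀ r → r ℕ.+ r ≡ suc ∣ T ∣ → q T r ≈ 0#
        top r e = trans (signed-cong r (reflexive
            (≡.cong fromℕ (p-vanishes ∣ T ∣ T r ℕ.≤-refl (ℕ.≤-reflexive (≡.sym e)))))) (signed-0 r)
        nb : ∀ N → ∣ T ∣ ≡ N → neighbourSum F T u ≋ alternate (suc N) (delayed Σq)
        -- With T empty there are no neighbours, and the delayed sum of degree 1 consists of its
        -- default coefficient 0 alone.
        nb zero ∣T∣≡0 = 𝕊.trans (sumˢ-cong term)
            (𝕊.trans (sum-replicate-zero n) (𝕊.sym (𝕊.trans (𝕊.*-congʳ C-0) (𝕊.zeroˡ y))))
          where
          open import Algebra.Properties.Semiring.Sum 𝕊.semiring using (sum-replicate-zero)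
          term : ∀ v → neighbourTerm F T u v ≋ 𝕊.0#
          term v with lookup T v in eq
          ... | false = 𝕊.refl
          ... | true with () ← ≡.trans (≡.sym ∣T∣≡0) (∣p∣≡1+∣p-x∣ (lookup-true⁻ {p = T} eq))
        nb (suc N) ∣T∣≡ = 𝕊.trans (sumˢ-cong term) (𝕊.trans (𝕊.sym (alternate-sum N (neighbourCoeff T u)))
            (𝕊.sym (𝕊.trans (𝕊.+-congʳ (𝕊.trans (𝕊.*-congʳ C-0) (𝕊.zeroˡ _))) (𝕊.+-identityˡ _))))
          where
          term : ∀ v → neighbourTerm F T u v ≋ alternate N (neighbourCoeff T u v)
          term v with lookup T v in eq | adj G u v
          ... | true  | true  = F-alternate′ (T - v)
              (ℕ.suc-injective (≡.trans (≡.sym (∣p∣≡1+∣p-x∣ (lookup-true⁻ {p = T} eq))) ∣T∣≡))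
          ... | true  | false = 𝕊.sym (alternate-0 N)
          ... | false | _     = 𝕊.sym (alternate-0 N)

-- Connected components, their least representatives, and additive functions.

module ConnectedComponents where

  open import Defs renaming (sym to adj-sym)
  open Subsets
  open MatchingNumbers using (count; length-filter; ∈-filterᵇ⁺; ∈-filterᵇ⁻; ⌊⌋-true)
  open import Data.Bool as Bool using (Bool; true; false; _∧_; not; if_then_else_)
  open import Data.Bool.ListAction using (any; all)
  open import Data.Nat as ℕ using (ℕ; suc; zero; _+_; _≤_; _<_)
  import Data.Nat.Properties as ℕ
  open import Data.Nat.ListAction using (sum)
  open import Data.Fin as Fin using (Fin; toℕ)
  import Data.Fin.Properties as Fin
  open import Data.Fin.Subset using (Subset; _∈_; _∉_; _⊆_; ∣_∣; ⊥; _∪_; ⁅_⁆)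
  open import Data.Fin.Subset.Properties
  open import Data.List as List using (List; []; _∷_; map; allFin; filterᵇ; foldr)
  open import Data.List.Membership.Propositional using () renaming (_∈_ to _∈ᴸ_)
  open import Data.List.Membership.Propositional.Properties using (∈-allFin)
  open import Data.List.Relation.Unary.Any using (here; there)
  open import Data.List.Relation.Unary.All as All using (All; []; _∷_)
  open import Data.List.Relation.Unary.AllPairs using ([]; _∷_)
  open import Data.List.Relation.Unary.Unique.Propositional using (Unique)
  import Data.List.Relation.Unary.Unique.Propositional.Properties as Unique
  open import Data.Vec using (lookup)
  open import Data.Vec.Properties using (lookup∘tabulate)
  open import Data.Product using (_×_; _,_; ∃; proj₁; proj₂)
  open import Data.Sum using (_⊎_; inj₁; inj₂)
  open import Data.Empty using (⊥-elim)
  open import Function.Base using (_∘_)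
  open import Relation.Nullary using (yes; no)
  open import Relation.Nullary.Decidable using (_×-dec_; ¬?; ⌊_⌋)
  open import Relation.Binary.PropositionalEquality using (_≡_; refl; cong; cong₂; trans; subst) renaming (sym to ≡-sym)
  open import Relation.Binary.Definitions using (tri<; tri≈; tri>)

  all-true⁻ : ∀ {A : Set} (b : A → Bool) xs → all b xs ≡ true → ∀ {x} → x ∈ᴸ xs → b x ≡ true
  all-true⁻ b (x ∷ xs) e (here refl) = proj₁ (∧-true e)
  all-true⁻ b (x ∷ xs) e (there x∈)  = all-true⁻ b xs (proj₂ (∧-true e)) x∈

  all-true⁺ : ∀ {A : Set} (b : A → Bool) xs → (∀ x → b x ≡ true) → all b xs ≡ true
  all-true⁺ b []       f = refl
  all-true⁺ b (x ∷ xs) f = cong₂ _∧_ (f x) (all-true⁺ b xs f)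

  any-true⁻ : ∀ {A : Set} (b : A → Bool) xs → any b xs ≡ true → ∃ λ x → b x ≡ true
  any-true⁻ b (x ∷ xs) e with b x in bx
  ... | true  = x , bx
  ... | false = any-true⁻ b xs e

  any-true⁺ : ∀ {A : Set} (b : A → Bool) xs {x} → x ∈ᴸ xs → b x ≡ true → any b xs ≡ true
  any-true⁺ b (x ∷ xs) (here refl) bx rewrite bx = refl
  any-true⁺ b (x ∷ xs) (there x∈)  bx with b x
  ... | true  = refl
  ... | false = any-true⁺ b xs x∈ bx

  module Components {n : ℕ} (G : Graph n) where

    step⁻ : ∀ S T {j} → j ∈ step G S T → j ∈ T ⊎ (j ∈ S × ∃ λ i → i ∈ T × adj G i j ≡ true)
    step⁻ S T {j} j∈ with x∈p∪q⁻ T _ j∈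
    ... | inj₁ j∈T = inj₁ j∈T
    ... | inj₂ j∈∩ with x∈p∩q⁻ S _ j∈∩
    ... | j∈S , j∈N with any-true⁻ (λ i → lookup T i ∧ adj G i j) (allFin n)
                         (trans (≡-sym (lookup∘tabulate (λ j → any (λ i → lookup T i ∧ adj G i j)
                             (allFin n)) j)) (lookup-true j∈N))
    ... | i , e = inj₂ (j∈S , i , lookup-true⁻ {p = T} (proj₁ (∧-true e)) , proj₂ (∧-true {lookup T i} e))

    step-⊇ : ∀ S T → T ⊆ step G S T
    step-⊇ S T = p⊆p∪q _

    step⁺ : ∀ S T {i j} → i ∈ T → j ∈ S → adj G i j ≡ true → j ∈ step G S T
    step⁺ S T {i} {j} i∈T j∈S ij = q⊆p∪q T _ (x∈p∩q⁺ (j∈S , lookup-true⁻ (trans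
      (lookup∘tabulate (λ j → any (λ i → lookup T i ∧ adj G i j) (allFin n)) j)
      (any-true⁺ (λ i → lookup T i ∧ adj G i j) (allFin n) (∈-allFin i) (cong₂ _∧_ (lookup-true i∈T) ij)))))

    iter-⊇ : ∀ k S T → T ⊆ iter G k S T
    iter-⊇ zero    S T x∈ = x∈
    iter-⊇ (suc k) S T x∈ = iter-⊇ k S (step G S T) (step-⊇ S T x∈)

    iter-induction : ∀ (P : Fin n → Set) S → (∀ i j → P i → j ∈ S → adj G i j ≡ true → P j) →
                     ∀ k T → (∀ i → i ∈ T → P i) → ∀ i → i ∈ iter G k S T → P i
    iter-induction P S closed zero    T base = base
    iter-induction P S closed (suc k) T base = iter-induction P S closed k (step G S T) base′
      where
      base′ : ∀ i → i ∈ step G S T → P i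
      base′ j j∈ with step⁻ S T j∈
      ... | inj₁ j∈T = base j j∈T
      ... | inj₂ (j∈S , i , i∈T , ij) = closed i j (base i i∈T) j∈S ij

    Closed : Subset n → Subset n → Set
    Closed S C = ∀ {i j} → i ∈ C → j ∈ S → adj G i j ≡ true → j ∈ C

    private
      iter-fixed : ∀ k S T → step G S T ≡ T → iter G k S T ≡ T
      iter-fixed zero    S T e = refl
      iter-fixed (suc k) S T e = trans (cong (iter G k S) e) (iter-fixed k S T e)

      -- A round that adds nothing makes all later iterates equal; otherwise every round gains at
      -- least one vertex.
      iter-grows : ∀ k S T → step G S (iter G k S T) ⊆ iter G k S T ⊎ k + ∣ T ∣ ≤ ∣ iter G k S T ∣
      iter-grows zero    S T = inj₂ ℕ.≤-refl
      iter-grows (suc k) S T with Fin.any? (λ x → (x ∈? step G S T) ×-dec ¬? (x ∈? T))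
      ... | no none = inj₁ λ {x} x∈ → subst (x ∈_) (≡-sym same)
          (subst (x ∈_) fixed (subst (λ Z → x ∈ step G S Z) same x∈))
        where
        fixed : step G S T ≡ T
        fixed = ⊆-antisym sub (step-⊇ S T)
          where
          sub : step G S T ⊆ T
          sub {x} x∈ with x ∈? T
          ... | yes x∈T = x∈T
          ... | no x∉T  = ⊥-elim (none (x , x∈ , x∉T))
        same : iter G (suc k) S T ≡ T
        same = iter-fixed (suc k) S T fixed
      ... | yes (x , x∈ , x∉) with iter-grows k S (step G S T)
      ...   | inj₁ f  = inj₁ f
      ...   | inj₂ le = inj₂ (ℕ.≤-trans (ℕ.≤-reflexive (≡-sym (ℕ.+-suc k ∣ T ∣)))
                           (ℕ.≤-trans (ℕ.+-monoʳ-≤ k (p⊂q⇒∣p∣<∣q∣ (step-⊇ S T , x , x∈ , x∉))) le))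

    component-closed : ∀ S v → Closed S (component G S v)
    component-closed S v i∈ j∈S ij with iter-grows n S ⁅ v ⁆
    ... | inj₁ fixed = fixed (step⁺ S (component G S v) i∈ j∈S ij)
    -- n rounds of growth from a single vertex would produce n + 1 vertices.
    ... | inj₂ big = ⊥-elim (ℕ.<-irrefl refl
        (ℕ.≤-trans (ℕ.≤-reflexive (trans (ℕ.+-comm 1 n) (cong (n +_) (≡-sym (∣⁅x⁆∣≡1 v)))))
                       (ℕ.≤-trans big (∣p∣≤n (component G S v)))))

    ∈-component : ∀ S v → v ∈ component G S v
    ∈-component S v = iter-⊇ n S ⁅ v ⁆ (x∈⁅x⁆ v)

    component-induction : ∀ (P : Fin n → Set) S v → P v → (∀ i j → P i → j ∈ S → adj G i j ≡ true → P j) → ∀ i →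
        i ∈ component G S v → P i
    component-induction P S v Pv closed = iter-induction P S closed n ⁅ v ⁆
        (λ i i∈ → subst P (≡-sym (x∈⁅y⁆⇒x≡y v i∈)) Pv)

    component-⊆ : ∀ S v → v ∈ S → component G S v ⊆ S
    component-⊆ S v v∈S {x} = component-induction (_∈ S) S v v∈S (λ _ _ _ j∈S _ → j∈S) x

    component-least : ∀ S v C → v ∈ C → Closed S C → component G S v ⊆ C
    component-least S v C v∈C closed {x} = component-induction (_∈ C) S v v∈C (λ _ _ i∈ j∈ ij → closed i∈ j∈ ij) x

    component-sym : ∀ S v → v ∈ S → ∀ {u} → u ∈ component G S v → v ∈ component G S u
    component-sym S v v∈S {u} u∈ = proj₂
        (component-induction (λ x → x ∈ S × v ∈ component G S x) S v (v∈S , ∈-component S v) next u u∈)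
      where
      next : ∀ i j → i ∈ S × v ∈ component G S i → j ∈ S → adj G i j ≡ true → j ∈ S × v ∈ component G S j
      next i j (i∈S , v∈i) j∈S ij = j∈S , component-least S i (component G S j)
        (component-closed S j (∈-component S j) i∈S (trans (adj-sym G j i) ij)) (component-closed S j) v∈i

    component-≡ : ∀ S v → v ∈ S → ∀ {u} → u ∈ component G S v → component G S u ≡ component G S v
    component-≡ S v v∈S {u} u∈ = ⊆-antisym (component-least S u _ u∈ (component-closed S v))
      (component-least S v _ (component-sym S v v∈S u∈) (component-closed S u))

    -- The induction is restarted at u, whose component is the same. Carrying membership along with
    -- P supplies the premise that both ends of an edge lie in the component.
    component-connected : ∀ S v → v ∈ S → ∀ (P : Fin n → Set) u → u ∈ component G S v → P u →
      (∀ i j → i ∈ component G S v → j ∈ component G S v → adj G i j ≡ true → P i → P j) → ∀ j → j ∈ component G S v → P j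
    component-connected S v v∈S P u u∈ Pu next j j∈ = proj₂
        (component-induction (λ x → x ∈ component G S v × P x) S u (u∈ , Pu)
      (λ { i j (i∈ , Pi) j∈S ij → let j∈C = component-closed S v i∈ j∈S ij in j∈C , next i j i∈ j∈C ij Pi })
      j (subst (j ∈_) (≡-sym (component-≡ S v v∈S u∈)) j∈))

    Representative : Subset n → Fin n → Set
    Representative S v = v ∈ S × (∀ u → toℕ u < toℕ v → u ∉ component G S v)

    representative-unique : ∀ {S u v} → Representative S u → Representative S v → u ∈ component G S v → u ≡ v
    representative-unique {S} {u} {v} (u∈S , least-u) (v∈S , least-v) u∈ with ℕ.<-cmp (toℕ u) (toℕ v)
    ... | tri< u<v _ _ = ⊥-elim (least-v u u<v u∈)
    ... | tri≈ _ e _   = Fin.toℕ-injective e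
    ... | tri> _ _ v<u = ⊥-elim (least-u v v<u (component-sym S v v∈S u∈))

    private
      least : ∀ k (C : Subset n) v → v ∈ C → toℕ v < k → ∃ λ w → w ∈ C × (∀ (u : Fin n) → toℕ u < toℕ w → u ∉ C)
      least (suc k) C v v∈C v<k with Fin.any? (λ u → (toℕ u ℕ.<? toℕ v) ×-dec (u ∈? C))
      ... | yes (u , u<v , u∈C) = least k C u u∈C (ℕ.≤-trans u<v (ℕ.≤-pred v<k))
      ... | no none = v , v∈C , λ u u<v u∈C → none (u , u<v , u∈C)

    representative : ∀ {S x} → x ∈ S → ∃ λ v → Representative S v × x ∈ component G S v
    representative {S} {x} x∈S with least (suc (toℕ x)) (component G S x) x (∈-component S x) ℕ.≤-refl
    ... | w , w∈ , low = w , (component-⊆ S x x∈S w∈ , λ u u<w u∈ → low u u<w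
        (subst (u ∈_) (component-≡ S x x∈S w∈) u∈)) ,
                         component-sym S x x∈S w∈

    union : Subset n → List (Fin n) → Subset n
    union S = foldr (λ v C → component G S v ∪ C) ⊥

    ∈-union⁻ : ∀ S vs {x} → x ∈ union S vs → ∃ λ v → v ∈ᴸ vs × x ∈ component G S v
    ∈-union⁻ S []       x∈ = ⊥-elim (∉⊥ x∈)
    ∈-union⁻ S (v ∷ vs) x∈ with x∈p∪q⁻ (component G S v) (union S vs) x∈
    ... | inj₁ x∈v = v , here refl , x∈v
    ... | inj₂ x∈vs = let w , w∈ , x∈w = ∈-union⁻ S vs x∈vs in w , there w∈ , x∈w

    ∈-union⁺ : ∀ S vs {v x} → v ∈ᴸ vs → x ∈ component G S v → x ∈ union S vs
    ∈-union⁺ S (v ∷ vs) (here refl) x∈ = x∈p∪q⁺ (inj₁ x∈)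
    ∈-union⁺ S (v ∷ vs) (there v∈)  x∈ = x∈p∪q⁺ (inj₂ (∈-union⁺ S vs v∈ x∈))

    module Additive (m : Subset n → ℕ)
      (m-∪ : ∀ C D → (∀ {x} → x ∈ C → x ∉ D) → (∀ {i j} → i ∈ C → j ∈ D → adj G i j ≡ false) → m (C ∪ D) ≡ m C + m D) where

      m-⊥ : m ⊥ ≡ 0
      m-⊥ = ≡-sym (ℕ.+-cancelˡ-≡ (m ⊥) 0 (m ⊥) (trans (ℕ.+-identityʳ (m ⊥)) (trans (cong m (≡-sym (∪-identityˡ ⊥)))
              (m-∪ ⊥ ⊥ (λ x∈ _ → ∉⊥ x∈) (λ i∈ → ⊥-elim (∉⊥ i∈))))))

      -- Components of distinct representatives are disjoint, and no edge leaves a component, so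
      -- additivity applies one component at a time.
      m-union : ∀ S vs → Unique vs → All (Representative S) vs → m (union S vs) ≡ sum (map (m ∘ component G S) vs)
      m-union S []       _          _          = m-⊥
      m-union S (v ∷ vs) (v∉ ∷ uvs) (rv ∷ rvs) = trans (m-∪ (component G S v) (union S vs) disjoint noEdge)
          (cong (m (component G S v) +_) (m-union S vs uvs rvs))
        where
        disjoint : ∀ {x} → x ∈ component G S v → x ∉ union S vs
        disjoint {x} x∈v x∈vs with ∈-union⁻ S vs x∈vs
        ... | w , w∈ , x∈w = All.lookup v∉ w∈
            (representative-unique rv rw (subst (v ∈_) (component-≡ S w (proj₁ rw) x∈w)
                (component-sym S v (proj₁ rv) x∈v)))
          where rw = All.lookup rvs w∈
        noEdge : ∀ {i j} → i ∈ component G S v → j ∈ union S vs → adj G i j ≡ false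
        noEdge {i} {j} i∈ j∈ with adj G i j in ij
        ... | false = refl
        ... | true with ∈-union⁻ S vs j∈
        ... | w , w∈ , j∈w = ⊥-elim (disjoint
            (component-closed S v i∈ (component-⊆ S w (proj₁ (All.lookup rvs w∈)) j∈w) ij) j∈)

  module Reps (R : RealField) {n : ℕ} (G : Graph n) (θ : RealField.Carrier R) where
    open WithReals R
    open Components G

    notSmallerInComponent : Subset n → Fin n → Fin n → Bool
    notSmallerInComponent S v u = if ⌊ toℕ u ℕ.<? toℕ v ⌋ then not (lookup (component G S v) u) else true

    isRepresentative : Subset n → Fin n → Bool
    isRepresentative S v = lookup S v ∧ leastInComp G θ S v

    representatives : Subset n → List (Fin n)
    representatives S = filterᵇ (isRepresentative S) (allFin n)

    representatives-unique : ∀ S → Unique (representatives S)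
    representatives-unique S = Unique.filter⁺ _ (Unique.allFin⁺ n)

    ∈-representatives⁻ : ∀ {S v} → v ∈ᴸ representatives S → Representative S v
    ∈-representatives⁻ {S} {v} v∈ with ∧-true {lookup S v} {leastInComp G θ S v}
        (proj₂ (∈-filterᵇ⁻ (isRepresentative S) {xs = allFin n} v∈))
    ... | lv , e = lookup-true⁻ lv , low
      where
      low : ∀ u → toℕ u < toℕ v → u ∉ component G S v
      low u u<v u∈ with all-true⁻ (notSmallerInComponent S v) (allFin n) e (∈-allFin u)
      ... | f rewrite ⌊⌋-true (toℕ u ℕ.<? toℕ v) u<v | lookup-true u∈ with () ← f

    ∈-representatives⁺ : ∀ {S v} → Representative S v → v ∈ᴸ representatives S
    ∈-representatives⁺ {S} {v} (v∈S , low) = ∈-filterᵇ⁺ (isRepresentative S) (∈-allFin v)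
        (cong₂ _∧_ (lookup-true v∈S) (all-true⁺ (notSmallerInComponent S v) (allFin n) each))
      where
      each : ∀ u → notSmallerInComponent S v u ≡ true
      each u with toℕ u ℕ.<? toℕ v
      ... | no _ = refl
      ... | yes u<v rewrite lookup-false (low u u<v) = refl

    union-representatives : ∀ S → union S (representatives S) ≡ S
    union-representatives S = ⊆-antisym to from
      where
      to : union S (representatives S) ⊆ S
      to x∈ with ∈-union⁻ S (representatives S) x∈
      ... | v , v∈ , x∈v = component-⊆ S v (proj₁ (∈-representatives⁻ v∈)) x∈v
      from : S ⊆ union S (representatives S)
      from x∈ with representative x∈
      ... | v , rv , x∈v = ∈-union⁺ S (representatives S) (∈-representatives⁺ rv) x∈v

    -- Puts the count into the form of a sum over representatives, to be compared term by term with
    -- the decomposition of the multiplicity.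
    cθ-sum : ∀ S → cθ G θ S ≡ sum (map (λ v → if criticalB G θ (component G S v) then 1 else 0) (representatives S))
    cθ-sum S = trans (length-filter _ (allFin n)) (go (allFin n))
      where
      crit : Fin n → Bool
      crit v = criticalB G θ (component G S v)
      go : ∀ vs → count (λ v → lookup S v ∧ leastInComp G θ S v ∧ crit v) vs ≡ sum (map (λ v → if crit v then 1 else 0) (filterᵇ (isRepresentative S) vs))
      go [] = refl
      go (v ∷ vs) with lookup S v | leastInComp G θ S v
      ... | true  | true  = cong ((if crit v then 1 else 0) +_) (go vs)
      ... | true  | false = go vs
      ... | false | _     = go vs

-- Tutte, extreme and nice sets.

open import Defs renaming (sym to adj-sym)
open Subsets
open MatchingNumbers using (⌊⌋-true)
open Series
open Orders
open Recurrences
open Multiplicities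
open TaylorExpansions
open ConnectedComponents
open import Data.Bool using (Bool; true; false; if_then_else_)
open import Data.Nat as ℕ using (ℕ; suc; zero; _+_; _≤_; _<_; z≤n; s≤s)
import Data.Nat.Properties as ℕ
open import Data.Nat.ListAction using (sum)
open import Data.Fin as Fin using (Fin)
import Data.Fin.Properties as Fin
open import Data.Fin.Subset using (Subset; _∈_; _∉_; _⊆_; _⊂_; _-_; ∣_∣; ⊥; ⊤; _∪_; _∩_; ⁅_⁆; ∁)
open import Data.Fin.Subset.Properties
open import Data.List using ([]; _∷_; map; allFin)
open import Data.List.Membership.Propositional using () renaming (_∈_ to _∈ᴸ_)
open import Data.List.Membership.Propositional.Properties using (∈-allFin)
open import Data.List.Relation.Unary.Any using (here; there)
open import Data.List.Relation.Unary.All as All using ()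
open import Data.Vec using (lookup)
open import Data.Product using (_×_; _,_; ∃; proj₁; proj₂)
open import Data.Sum using (inj₁; inj₂)
open import Data.Empty using (⊥-elim)
open import Function.Base using (_∘_)
open import Function.Bundles using (_⇔_; mk⇔; Equivalence)
open import Relation.Nullary using (¬_; yes; no)
open import Relation.Nullary.Decidable using (_×-dec_; ¬?; ⌊_⌋)
open import Relation.Binary.PropositionalEquality as ≡ using (_≡_; _≢_)

-- Presents the graph without X as a single vertex deletion from a larger graph, the form to which
-- interlacing applies.
∁-delete : ∀ {n} {X : Subset n} {x} → x ∈ X → ∁ (X - x) - x ≡ ∁ X
∁-delete {X = X} {x} x∈X = ⊆-antisym to from
  where
  to : ∁ (X - x) - x ⊆ ∁ X
  to y∈ with ∈-⁻ {p = ∁ (X - x)} y∈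
  ... | y∈∁ , y≢x = x∉p⇒x∈∁p λ y∈X → x∈∁p⇒x∉p y∈∁ (x∈p∧x≢y⇒x∈p-y y∈X y≢x)
  from : ∁ X ⊆ ∁ (X - x) - x
  from y∈ = x∈p∧x≢y⇒x∈p-y (x∉p⇒x∈∁p λ y∈X-x → x∈∁p⇒x∉p y∈ (proj₁ (∈-⁻ y∈X-x))) λ { ≡.refl → x∈∁p⇒x∉p y∈ x∈X }

insert-delete : ∀ {n} {X : Subset n} {x} → x ∉ X → (X ∪ ⁅ x ⁆) - x ≡ X
insert-delete {X = X} {x} x∉X = ⊆-antisym to from
  where
  to : (X ∪ ⁅ x ⁆) - x ⊆ X
  to y∈ with ∈-⁻ {p = X ∪ ⁅ x ⁆} y∈
  ... | y∈∪ , y≢x with x∈p∪q⁻ X ⁅ x ⁆ y∈∪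
  ... | inj₁ y∈X = y∈X
  ... | inj₂ y∈x = ⊥-elim (y≢x (x∈⁅y⁆⇒x≡y x y∈x))
  from : X ⊆ (X ∪ ⁅ x ⁆) - x
  from = ⊆-⁺ (p⊆p∪q ⁅ x ⁆) x∉X

∁⊥≡⊤ : ∀ {n} → ∁ (⊥ {n}) ≡ ⊤
∁⊥≡⊤ = ⊆-antisym (⊆-max (∁ ⊥)) (λ _ → x∉p⇒x∈∁p ∉⊥)

pair-∁ : ∀ {n} (X : Subset n) {u v} → u ∈ X → v ∈ X - u → X - u - v ≡ ⊥ → ∁ X ≡ ⊤ - u - v
pair-∁ X {u} {v} u∈ v∈ e = begin
  ∁ X                      ≡⟨ ∁-delete u∈ ⟨
  ∁ (X - u) - u            ≡⟨ ≡.cong (_- u) (∁-delete v∈) ⟨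
  ∁ (X - u - v) - v - u    ≡⟨ ≡.cong (λ Y → ∁ Y - v - u) e ⟩
  ∁ ⊥ - v - u              ≡⟨ ≡.cong (λ Y → Y - v - u) ∁⊥≡⊤ ⟩
  ⊤ - v - u                ≡⟨ p─x─y≡p─y─x ⊤ v u ⟩
  ⊤ - u - v                ∎
  where open ≡.≡-Reasoning

sum-map-≤ : ∀ {A : Set} (f g : A → ℕ) xs → (∀ x → x ∈ᴸ xs → f x ≤ g x) → sum (map f xs) ≤ sum (map g xs)
sum-map-≤ f g []       le = z≤n
sum-map-≤ f g (x ∷ xs) le = ℕ.+-mono-≤ (le x (here ≡.refl)) (sum-map-≤ f g xs λ y y∈ → le y (there y∈))

sum-map-≡ : ∀ {A : Set} (f g : A → ℕ) xs → (∀ x → x ∈ᴸ xs → f x ≡ g x) → sum (map f xs) ≡ sum (map g xs)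
sum-map-≡ f g []       e = ≡.refl
sum-map-≡ f g (x ∷ xs) e = ≡.cong₂ _+_ (e x (here ≡.refl)) (sum-map-≡ f g xs λ y y∈ → e y (there y∈))

module Critical (R : RealField) {n : ℕ} (G : Graph n) (θ : RealField.Carrier R) where
  open WithReals R

  critical⁻ : ∀ {C} → criticalB G θ C ≡ true → ∀ u → u ∈ C → suc (mult G θ (C - u)) ≡ mult G θ C
  critical⁻ {C} e u u∈ with all-true⁻
      (λ u → if lookup C u then ⌊ suc (mult G θ (C - u)) ℕ.≟ mult G θ C ⌋ else true) (allFin n) e (∈-allFin u)
  ... | f rewrite lookup-true u∈ with suc (mult G θ (C - u)) ℕ.≟ mult G θ C
  ... | yes eq = eq
  critical⁻ {C} e u u∈ | () | no _

  critical⁺ : ∀ {C} → (∀ u → u ∈ C → suc (mult G θ (C - u)) ≡ mult G θ C) → criticalB G θ C ≡ true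
  critical⁺ {C} essential = all-true⁺
      (λ u → if lookup C u then ⌊ suc (mult G θ (C - u)) ℕ.≟ mult G θ C ⌋ else true) (allFin n) each
    where
    each : ∀ u → (if lookup C u then ⌊ suc (mult G θ (C - u)) ℕ.≟ mult G θ C ⌋ else true) ≡ true
    each u with lookup C u in eq
    ... | false = ≡.refl
    ... | true  = ⌊⌋-true (suc (mult G θ (C - u)) ℕ.≟ mult G θ C) (essential u (lookup-true⁻ eq))

module Extremal (R : RealField) {n : ℕ} (G : Graph n) (θ : RealField.Carrier R) where
  open PowerSeries (RealField.commRing R)
  open Ordered R using (Ord)
  open Recurrence seriesRing G using (Recursive)
  open Multiplicity R G

  module TutteSets
    (F : Subset n → Series) (rec : Recursive (λ _ → θ +t) F) (F⊥ : F ⊥ ≋ 𝕊.1#) (m : Subset n → ℕ) (ordF : ∀ S → Ord (m S) (F S))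
    (critical : Subset n → Bool)
    (critical⁻ : ∀ {C} → critical C ≡ true → ∀ u → u ∈ C → suc (m (C - u)) ≡ m C)
    (critical⁺ : ∀ {C} → (∀ u → u ∈ C → suc (m (C - u)) ≡ m C) → critical C ≡ true)
    where
    open Components G
    open Reps R G θ
    open Roots θ F rec F⊥ m ordF
    open Additive m mult-∪

    c : Subset n → ℕ
    c S = sum (map (λ v → if critical (component G S v) then 1 else 0) (representatives S))

    Tutte Extreme Nice : Subset n → Set
    Tutte X   = c (∁ X) ≡ m ⊤ + ∣ X ∣
    Extreme X = m (∁ X) ≡ m ⊤ + ∣ X ∣
    Nice X    = 1 < ∣ X ∣ × (∀ u v → u ∈ X → v ∈ X → u ≢ v → m (⊤ - u - v) ≡ m ⊤ + 2)

    mult-components : ∀ S → m S ≡ sum (map (m ∘ component G S) (representatives S))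
    mult-components S = ≡.trans (≡.cong m (≡.sym (union-representatives S)))
      (m-union S (representatives S) (representatives-unique S) (All.tabulate ∈-representatives⁻))

    critical⇒mult≡1 : ∀ S v → v ∈ S → critical (component G S v) ≡ true → m (component G S v) ≡ 1
    critical⇒mult≡1 S v v∈S crit = gallai (component G S v) (component-connected S v v∈S) (v , ∈-component S v)
        (critical⁻ crit)

    c≤mult : ∀ S → c S ≤ m S
    c≤mult S = ℕ.≤-trans (sum-map-≤ _ _ (representatives S) each) (ℕ.≤-reflexive (≡.sym (mult-components S)))
      where
      each : ∀ v → v ∈ᴸ representatives S → (if critical (component G S v) then 1 else 0) ≤ m (component G S v)
      each v v∈ with critical (component G S v) in crit
      ... | false = z≤n
      ... | true  = ℕ.≤-reflexive (≡.sym (critical⇒mult≡1 S v (proj₁ (∈-representatives⁻ v∈)) crit))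

    NoPositive : Subset n → Set
    NoPositive S = ∀ v → v ∈ S → m (S - v) ≢ suc (m S)

    -- Multiplicity is additive over the component and the rest of S, and deleting w changes only
    -- the first summand.
    noPositive-component : ∀ {S} → NoPositive S → ∀ v → v ∈ S → NoPositive (component G S v)
    noPositive-component {S} none v v∈S w w∈C pos = none w (component-⊆ S v v∈S w∈C) (≡.trans
        (≡.trans (≡.cong (λ T → m (T - w)) (≡.sym split)) (≡.trans (≡.cong m (∪-delete C D w∉D))
          (mult-∪ (C - w) D (disjoint ∘ proj₁ ∘ ∈-⁻) (noEdge ∘ proj₁ ∘ ∈-⁻))))
        (≡.trans (≡.cong (_+ m D) pos) (≡.cong suc (≡.trans (≡.sym (mult-∪ C D disjoint noEdge)) (≡.cong m split)))))
      where
      C = component G S v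
      D = S ∩ ∁ C
      disjoint : ∀ {x} → x ∈ C → x ∉ D
      disjoint x∈C x∈D = x∈∁p⇒x∉p (proj₂ (x∈p∩q⁻ S (∁ C) x∈D)) x∈C
      w∉D : w ∉ D
      w∉D = disjoint w∈C
      noEdge : ∀ {i j} → i ∈ C → j ∈ D → adj G i j ≡ false
      noEdge {i} {j} i∈ j∈ with adj G i j in ij
      ... | false = ≡.refl
      ... | true  = ⊥-elim (disjoint (component-closed S v i∈ (proj₁ (x∈p∩q⁻ S (∁ C) j∈)) ij) j∈)
      split : C ∪ D ≡ S
      split = ⊆-antisym to from
        where
        to : C ∪ D ⊆ S
        to x∈ with x∈p∪q⁻ C D x∈
        ... | inj₁ x∈C = component-⊆ S v v∈S x∈C
        ... | inj₂ x∈D = proj₁ (x∈p∩q⁻ S (∁ C) x∈D)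
        from : S ⊆ C ∪ D
        from {x} x∈ with x ∈? C
        ... | yes x∈C = x∈p∪q⁺ (inj₁ x∈C)
        ... | no x∉C  = x∈p∪q⁺ (inj₂ (x∈p∩q⁺ (x∈ , x∉p⇒x∈∁p x∉C)))

    -- A component of positive multiplicity has an essential vertex. A neighbour of an essential
    -- vertex is not neutral and, by assumption, not positive, hence essential; connectedness
    -- spreads this to the whole component.
    noPositive⇒critical : ∀ {S} → NoPositive S → ∀ v → v ∈ S → ∀ {b} → m (component G S v) ≡ suc b →
        critical (component G S v) ≡ true
    noPositive⇒critical {S} none v v∈S {b} mC with exists-essential (component G S v) b mC
    ... | u , u∈C , mu = critical⁺ λ w w∈ → ≡.trans
        (≡.cong suc (component-connected S v v∈S (λ w → m (C - w) ≡ b) u u∈C mu next w w∈)) (≡.sym mC)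
      where
      C = component G S v
      next : ∀ i j → i ∈ C → j ∈ C → adj G i j ≡ true → m (C - i) ≡ b → m (C - j) ≡ b
      next i j i∈ j∈ ij mi = ℕ.≤-antisym
        (ℕ.≤-pred (ℕ.≤∧≢⇒< (ℕ.≤-pred (ℕ.≤∧≢⇒< (ℕ.≤-trans (mult-upper C j j∈) (ℕ.≤-reflexive (≡.cong suc mC)))
            (λ e → noPositive-component none v v∈S j j∈ (≡.trans e (≡.cong suc (≡.sym mC))))))
          (essential-neighbour-not-neutral j∈ i∈ (≡.trans (adj-sym G j i) ij) mC mi)))
        (ℕ.≤-pred (ℕ.≤-trans (ℕ.≤-reflexive (≡.sym mC)) (mult-lower C j j∈)))

    noPositive⇒c≡mult : ∀ {S} → NoPositive S → c S ≡ m S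
    noPositive⇒c≡mult {S} none = ≡.trans (sum-map-≡ _ _ (representatives S) each) (≡.sym (mult-components S))
      where
      each : ∀ v → v ∈ᴸ representatives S → (if critical (component G S v) then 1 else 0) ≡ m (component G S v)
      each v v∈ = cases (critical (component G S v)) (m (component G S v)) ≡.refl ≡.refl
        where
        v∈S = proj₁ (∈-representatives⁻ v∈)
        cases : ∀ c k → critical (component G S v) ≡ c → m (component G S v) ≡ k → (if c then 1 else 0) ≡ k
        cases true  k       crit mC = ≡.trans (≡.sym (critical⇒mult≡1 S v v∈S crit)) mC
        cases false zero    crit mC = ≡.refl
        cases false (suc b) crit mC with () ← ≡.trans (≡.sym crit) (noPositive⇒critical none v v∈S mC)

    private
      -- Pass from Y to X one vertex at a time; each deletion raises the multiplicity by at most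
      -- one. The cardinalities stand on opposite sides in place of a subtraction.
      mult-delete′ : ∀ k X Y → ∣ X ∣ ≤ k → Y ⊆ X → m (∁ X) + ∣ Y ∣ ≤ m (∁ Y) + ∣ X ∣
      mult-delete′ k X Y ∣X∣≤k Y⊆X with Fin.any? (λ x → (x ∈? X) ×-dec ¬? (x ∈? Y))
      ... | no none = ℕ.≤-reflexive (≡.cong₂ (λ A B → m (∁ A) + ∣ B ∣) X≡Y (≡.sym X≡Y))
        where
        X⊆Y : X ⊆ Y
        X⊆Y {x} x∈ with x ∈? Y
        ... | yes x∈Y = x∈Y
        ... | no x∉Y  = ⊥-elim (none (x , x∈ , x∉Y))
        X≡Y : X ≡ Y
        X≡Y = ⊆-antisym X⊆Y Y⊆X
      mult-delete′ zero X Y ∣X∣≤0 Y⊆X | yes (x , x∈ , x∉)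
        with () ← ≡.trans (≡.sym (ℕ.n≤0⇒n≡0 ∣X∣≤0)) (∣p∣≡1+∣p-x∣ x∈)
      mult-delete′ (suc k) X Y ∣X∣≤k Y⊆X | yes (x , x∈ , x∉) = begin
          m (∁ X) + ∣ Y ∣                  ≤⟨ ℕ.+-monoˡ-≤ ∣ Y ∣ bound ⟩
          suc (m (∁ (X - x)) + ∣ Y ∣)      ≤⟨ s≤s (mult-delete′ k (X - x) Y small (⊆-⁺ Y⊆X x∉)) ⟩
          suc (m (∁ Y) + ∣ X - x ∣)        ≡⟨ ℕ.+-suc (m (∁ Y)) ∣ X - x ∣ ⟨
          m (∁ Y) + suc ∣ X - x ∣          ≡⟨ ≡.cong (m (∁ Y) +_) (∣p∣≡1+∣p-x∣ x∈) ⟨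
          m (∁ Y) + ∣ X ∣                  ∎
        where
        open ℕ.≤-Reasoning
        small : ∣ X - x ∣ ≤ k
        small = ℕ.≤-pred (ℕ.≤-trans (ℕ.≤-reflexive (≡.sym (∣p∣≡1+∣p-x∣ x∈))) ∣X∣≤k)
        bound : m (∁ X) ≤ suc (m (∁ (X - x)))
        bound = ℕ.≤-trans (ℕ.≤-reflexive (≡.cong m (≡.sym (∁-delete x∈))))
            (mult-upper (∁ (X - x)) x (x∉p⇒x∈∁p (x∉p-x X x)))

    mult-delete : ∀ {X Y} → Y ⊆ X → m (∁ X) + ∣ Y ∣ ≤ m (∁ Y) + ∣ X ∣
    mult-delete {X} {Y} = mult-delete′ ∣ X ∣ X Y ℕ.≤-refl

    mult-∁-≤ : ∀ X → m (∁ X) ≤ m ⊤ + ∣ X ∣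
    mult-∁-≤ X = begin
      m (∁ X)              ≡⟨ ℕ.+-identityʳ _ ⟨
      m (∁ X) + 0          ≡⟨ ≡.cong (m (∁ X) +_) (∣⊥∣≡0 n) ⟨
      m (∁ X) + ∣ ⊥ {n} ∣  ≤⟨ mult-delete {X} {⊥} (⊆-min X) ⟩
      m (∁ ⊥) + ∣ X ∣      ≡⟨ ≡.cong (λ Y → m Y + ∣ X ∣) ∁⊥≡⊤ ⟩
      m ⊤ + ∣ X ∣          ∎
      where open ℕ.≤-Reasoning

    tutte⇒extreme : ∀ {X} → Tutte X → Extreme X
    tutte⇒extreme {X} tutte = ℕ.≤-antisym (mult-∁-≤ X) (ℕ.≤-trans (ℕ.≤-reflexive (≡.sym tutte)) (c≤mult (∁ X)))

    -- Extremality means that the bound `mult-∁-≤` is attained. If Y fell short of it, the remaining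
    -- deletions could not make up the loss.
    extreme-⊆ : ∀ {X Y} → Y ⊆ X → Extreme X → Extreme Y
    extreme-⊆ {X} {Y} Y⊆X ext = ℕ.≤-antisym (mult-∁-≤ Y) (ℕ.+-cancelʳ-≤ ∣ X ∣ (m ⊤ + ∣ Y ∣) (m (∁ Y)) (begin
      m ⊤ + ∣ Y ∣ + ∣ X ∣    ≡⟨ ℕ.+-assoc (m ⊤) ∣ Y ∣ ∣ X ∣ ⟩
      m ⊤ + (∣ Y ∣ + ∣ X ∣)  ≡⟨ ≡.cong (m ⊤ +_) (ℕ.+-comm ∣ Y ∣ ∣ X ∣) ⟩
      m ⊤ + (∣ X ∣ + ∣ Y ∣)  ≡⟨ ℕ.+-assoc (m ⊤) ∣ X ∣ ∣ Y ∣ ⟨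
      m ⊤ + ∣ X ∣ + ∣ Y ∣    ≡⟨ ≡.cong (_+ ∣ Y ∣) ext ⟨
      m (∁ X) + ∣ Y ∣        ≤⟨ mult-delete Y⊆X ⟩
      m (∁ Y) + ∣ X ∣        ∎))
      where open ℕ.≤-Reasoning

    private
      extreme⇒tutte′ : ∀ k X → ∣ ∁ X ∣ ≤ k → Extreme X → ∃ λ Z → X ⊆ Z × Tutte Z
      extreme⇒tutte′ k X ∣∁X∣≤k ext with Fin.any? (λ v → (v ∈? ∁ X) ×-dec (m (∁ X - v) ℕ.≟ suc (m (∁ X))))
      -- Without positive vertices the number of critical components equals the multiplicity, so an
      -- extreme set is itself a Tutte set.
      ... | no none = X , ⊆-refl , ≡.trans (noPositive⇒c≡mult λ v v∈ e → none (v , v∈ , e)) ext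
      extreme⇒tutte′ zero X ∣∁X∣≤0 ext | yes (v , v∈ , _)
        with () ← ≡.trans (≡.sym (ℕ.n≤0⇒n≡0 ∣∁X∣≤0)) (∣p∣≡1+∣p-x∣ v∈)
      extreme⇒tutte′ (suc k) X ∣∁X∣≤k ext | yes (v , v∈ , pos) =
          let Z , Y⊆Z , tutte = extreme⇒tutte′ k Y small extY in Z , (λ x∈ → Y⊆Z (p⊆p∪q ⁅ v ⁆ x∈)) , tutte
        where
        Y = X ∪ ⁅ v ⁆
        v∈Y : v ∈ Y
        v∈Y = x∈p∪q⁺ {p = X} (inj₂ (x∈⁅x⁆ v))
        Y-v : Y - v ≡ X
        Y-v = insert-delete (x∈∁p⇒x∉p v∈)
        ∁Y : ∁ Y ≡ ∁ X - v
        ∁Y = ≡.trans (≡.sym (∁-delete v∈Y)) (≡.cong (λ Z → ∁ Z - v) Y-v)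
        small : ∣ ∁ Y ∣ ≤ k
        small = ℕ.≤-pred (ℕ.≤-trans (ℕ.≤-reflexive (≡.trans (≡.cong (suc ∘ ∣_∣) ∁Y) (≡.sym (∣p∣≡1+∣p-x∣ v∈)))) ∣∁X∣≤k)
        extY : Extreme Y
        extY = ≡.trans (≡.cong m ∁Y) (≡.trans pos (≡.trans (≡.cong suc ext) (≡.trans (≡.sym (ℕ.+-suc (m ⊤) ∣ X ∣))
                 (≡.cong (m ⊤ +_) (≡.sym (≡.trans (∣p∣≡1+∣p-x∣ v∈Y) (≡.cong (suc ∘ ∣_∣) Y-v)))))))

    -- Keep adding vertices that are positive in the remaining graph.
    extreme⇒tutte : ∀ {X} → Extreme X → ∃ λ Z → X ⊆ Z × Tutte Z
    extreme⇒tutte {X} = extreme⇒tutte′ ∣ ∁ X ∣ X ℕ.≤-refl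

    -- Every pair inside X is an extreme set by `extreme-⊆`.
    extreme⇒nice : ∀ {X} → 1 < ∣ X ∣ → Extreme X → Nice X
    extreme⇒nice {X} 1<∣X∣ ext = 1<∣X∣ , pair
      where
      pair : ∀ u v → u ∈ X → v ∈ X → u ≢ v → m (⊤ - u - v) ≡ m ⊤ + 2
      pair u v u∈ v∈ u≢v = ≡.trans (≡.cong m (≡.sym (pair-∁ Y u∈Y v∈Y-u Y-u-v)))
          (≡.trans (extreme-⊆ Y⊆X ext) (≡.cong (m ⊤ +_) ∣Y∣≡2))
        where
        Y = ⁅ u ⁆ ∪ ⁅ v ⁆
        u∈Y : u ∈ Y
        u∈Y = x∈p∪q⁺ (inj₁ (x∈⁅x⁆ u))
        v∈Y-u : v ∈ Y - u
        v∈Y-u = x∈p∧x≢y⇒x∈p-y (x∈p∪q⁺ {p = ⁅ u ⁆} (inj₂ (x∈⁅x⁆ v))) (u≢v ∘ ≡.sym)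
        Y-u-v : Y - u - v ≡ ⊥
        Y-u-v = Empty-unique λ { (x , x∈) → empty x x∈ }
          where
          empty : ∀ x → x ∉ Y - u - v
          empty x x∈ with ∈-⁻ {p = Y - u} x∈
          ... | x∈′ , x≢v with ∈-⁻ {p = Y} x∈′
          ... | x∈Y , x≢u with x∈p∪q⁻ ⁅ u ⁆ ⁅ v ⁆ x∈Y
          ... | inj₁ x∈u = x≢u (x∈⁅y⁆⇒x≡y u x∈u)
          ... | inj₂ x∈v = x≢v (x∈⁅y⁆⇒x≡y v x∈v)
        Y⊆X : Y ⊆ X
        Y⊆X x∈ with x∈p∪q⁻ ⁅ u ⁆ ⁅ v ⁆ x∈
        ... | inj₁ x∈u with ≡.refl ← x∈⁅y⁆⇒x≡y u x∈u = u∈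
        ... | inj₂ x∈v with ≡.refl ← x∈⁅y⁆⇒x≡y v x∈v = v∈
        ∣Y∣≡2 : ∣ Y ∣ ≡ 2
        ∣Y∣≡2 = ≡.trans (∣p∣≡1+∣p-x∣ u∈Y)
            (≡.cong suc (≡.trans (∣p∣≡1+∣p-x∣ v∈Y-u) (≡.cong suc (≡.trans (≡.cong ∣_∣ Y-u-v) (∣⊥∣≡0 n)))))

    private
      nonempty : ∀ {X : Subset n} → 0 < ∣ X ∣ → ∃ λ x → x ∈ X
      nonempty {X} 0<∣X∣ with nonempty? X
      ... | yes p = p
      ... | no empty = ⊥-elim (ℕ.<-irrefl (≡.sym (≡.trans (≡.cong ∣_∣ (Empty-unique empty)) (∣⊥∣≡0 n))) 0<∣X∣)

      -- Induction on the size of X, pairs being the base. Otherwise choose a, b, c in X and let H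
      -- be the graph without the remaining vertices of X. By induction X - a, X - b and X - c are
      -- extreme, so a, b, c are pairwise extreme in H and `three-extreme` applies there.
      nice⇒extreme′ : ∀ k X → ∣ X ∣ ≤ k → 1 < ∣ X ∣ →
          (∀ u v → u ∈ X → v ∈ X → u ≢ v → m (⊤ - u - v) ≡ m ⊤ + 2) → Extreme X
      nice⇒extreme′ zero X ∣X∣≤0 1<∣X∣ nice with () ← ℕ.≤-trans 1<∣X∣ ∣X∣≤0
      nice⇒extreme′ (suc k) X ∣X∣≤k 1<∣X∣ nice with nonempty {X} (ℕ.<-trans (s≤s z≤n) 1<∣X∣)
      ... | a , a∈ with nonempty {X - a} (ℕ.≤-pred (ℕ.≤-trans 1<∣X∣ (ℕ.≤-reflexive (∣p∣≡1+∣p-x∣ a∈))))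
      ... | b , b∈a with nonempty? (X - a - b)
      ... | no empty = ≡.trans (≡.cong m (pair-∁ X a∈ b∈a X-a-b))
          (≡.trans (nice a b a∈ (proj₁ (∈-⁻ b∈a)) (proj₂ (∈-⁻ b∈a) ∘ ≡.sym))
              (≡.cong (m ⊤ +_) (≡.sym (≡.trans (∣p∣≡1+∣p-x∣ a∈)
                  (≡.cong suc (≡.trans (∣p∣≡1+∣p-x∣ b∈a) (≡.cong suc (≡.trans (≡.cong ∣_∣ X-a-b) (∣⊥∣≡0 n)))))))))
        where
        X-a-b : X - a - b ≡ ⊥
        X-a-b = Empty-unique empty
      ... | yes (c , c∈ab) = ≡.trans (≡.cong m (≡.sym H-a-b-c)) (≡.trans
              (three-extreme {H} {a} {b} {c} (∉Z λ e → x∉p-x X a (proj₁ (∈-⁻ (proj₁ (∈-⁻ e)))))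
                  (∉Z λ e → x∉p-x (X - a) b (proj₁ (∈-⁻ e))) (∉Z (x∉p-x (X - a - b) c))
                a≢b a≢c b≢c ≡.refl
                (≡.trans (≡.cong m H-a) (level₁ Xbc (extreme-⊆ (λ e → proj₁ (∈-⁻ e)) extb) ∣Xbc∣))
                (≡.trans (≡.cong m H-b) (level₁ (X - a - c) (extreme-⊆ (λ e → proj₁ (∈-⁻ e)) exta) ∣Xac∣))
                (≡.trans (≡.cong m H-c) (level₁ (X - a - b) (extreme-⊆ (λ e → proj₁ (∈-⁻ e)) exta) ∣Xab∣))
                (≡.trans (≡.cong m H-a-b) (level₂ c c∈ extc))
                (≡.trans (≡.cong m H-a-c) (level₂ b b∈ extb))
                (≡.trans (≡.cong m H-b-c) (level₂ a a∈ exta)))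
              total)
        where
        b∈ = proj₁ (∈-⁻ b∈a)
        c∈a = proj₁ (∈-⁻ c∈ab)
        c∈ = proj₁ (∈-⁻ c∈a)
        a≢b : a ≢ b
        a≢b = proj₂ (∈-⁻ b∈a) ∘ ≡.sym
        a≢c : a ≢ c
        a≢c = proj₂ (∈-⁻ c∈a) ∘ ≡.sym
        b≢c : b ≢ c
        b≢c = proj₂ (∈-⁻ c∈ab) ∘ ≡.sym
        Z = X - a - b - c
        H = ∁ Z
        Xbc = X - b - c
        ∉Z : ∀ {x} → x ∉ Z → x ∈ H
        ∉Z = x∉p⇒x∈∁p
        ∣X∣≡ : ∣ X ∣ ≡ suc (suc (suc ∣ Z ∣))
        ∣X∣≡ = ≡.trans (∣p∣≡1+∣p-x∣ a∈) (≡.cong suc (≡.trans (∣p∣≡1+∣p-x∣ b∈a) (≡.cong suc (∣p∣≡1+∣p-x∣ c∈ab))))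
        ∣X-∣ : ∀ {x} → x ∈ X → ∣ X - x ∣ ≡ suc (suc ∣ Z ∣)
        ∣X-∣ x∈ = ℕ.suc-injective (≡.trans (≡.sym (∣p∣≡1+∣p-x∣ x∈)) ∣X∣≡)
        ∣X--∣ : ∀ {x y} → x ∈ X → y ∈ X → x ≢ y → ∣ X - x - y ∣ ≡ suc ∣ Z ∣
        ∣X--∣ x∈ y∈ x≢y = ℕ.suc-injective (≡.trans (≡.sym (∣p∣≡1+∣p-x∣ (x∈p∧x≢y⇒x∈p-y y∈ (x≢y ∘ ≡.sym)))) (∣X-∣ x∈))
        ∣Xbc∣ = ∣X--∣ b∈ c∈ b≢c
        ∣Xac∣ = ∣X--∣ a∈ c∈ a≢c
        ∣Xab∣ = ∣X--∣ a∈ b∈ a≢b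
        -- X has at least three vertices here, so X - x retains at least two and inherits the pair
        -- condition.
        extreme- : ∀ x → x ∈ X → Extreme (X - x)
        extreme- x x∈ = nice⇒extreme′ k (X - x) (ℕ.≤-pred (ℕ.≤-trans (ℕ.≤-reflexive (≡.sym (∣p∣≡1+∣p-x∣ x∈))) ∣X∣≤k))
          (ℕ.≤-trans (s≤s (s≤s z≤n)) (ℕ.≤-reflexive (≡.sym (∣X-∣ x∈))))
          λ u v u∈ v∈ → nice u v (proj₁ (∈-⁻ u∈)) (proj₁ (∈-⁻ v∈))
        exta = extreme- a a∈
        extb = extreme- b b∈
        extc = extreme- c c∈
        mH : m H ≡ m ⊤ + ∣ Z ∣
        mH = extreme-⊆ (λ e → proj₁ (∈-⁻ (proj₁ (∈-⁻ e)))) exta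
        -- Z together with one of a, b, c is X without the other two, so it corresponds to one
        -- deletion from H. In the same way `level₂` handles two deletions.
        level₁ : ∀ W → Extreme W → ∣ W ∣ ≡ suc ∣ Z ∣ → m (∁ W) ≡ suc (m H)
        level₁ W ext ∣W∣ = ≡.trans ext (≡.trans (≡.cong (m ⊤ +_) ∣W∣)
            (≡.trans (ℕ.+-suc (m ⊤) ∣ Z ∣) (≡.cong suc (≡.sym mH))))
        level₂ : ∀ x → x ∈ X → Extreme (X - x) → m (∁ (X - x)) ≡ suc (suc (m H))
        level₂ x x∈ ext = ≡.trans ext (≡.trans (≡.cong (m ⊤ +_) (∣X-∣ x∈)) (≡.trans (ℕ.+-suc (m ⊤) (suc ∣ Z ∣))
          (≡.cong suc (≡.trans (ℕ.+-suc (m ⊤) ∣ Z ∣) (≡.cong suc (≡.sym mH))))))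
        total : suc (suc (suc (m H))) ≡ m ⊤ + ∣ X ∣
        total = ≡.sym (≡.trans (≡.cong (m ⊤ +_) ∣X∣≡)
            (≡.trans (ℕ.+-suc (m ⊤) (suc (suc ∣ Z ∣))) (≡.cong suc (≡.trans (ℕ.+-suc (m ⊤) (suc ∣ Z ∣))
          (≡.cong suc (≡.trans (ℕ.+-suc (m ⊤) ∣ Z ∣) (≡.cong suc (≡.sym mH))))))))
        Z≡bca : Z ≡ X - b - c - a
        Z≡bca = ≡.trans (≡.cong (_- c) (p─x─y≡p─y─x X a b)) (p─x─y≡p─y─x (X - b) a c)
        H-a : H - a ≡ ∁ (X - b - c)
        H-a = ≡.trans (≡.cong (λ W → ∁ W - a) Z≡bca) (∁-delete (x∈p∧x≢y⇒x∈p-y (x∈p∧x≢y⇒x∈p-y a∈ a≢b) a≢c))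
        H-b : H - b ≡ ∁ (X - a - c)
        H-b = ≡.trans (≡.cong (λ W → ∁ W - b) (p─x─y≡p─y─x (X - a) b c)) (∁-delete (x∈p∧x≢y⇒x∈p-y b∈a b≢c))
        H-c : H - c ≡ ∁ (X - a - b)
        H-c = ∁-delete c∈ab
        H-a-b : H - a - b ≡ ∁ (X - c)
        H-a-b = ≡.trans (≡.cong (_- b) (≡.trans H-a (≡.cong ∁ (p─x─y≡p─y─x X b c)))) (∁-delete (x∈p∧x≢y⇒x∈p-y b∈ b≢c))
        H-a-c : H - a - c ≡ ∁ (X - b)
        H-a-c = ≡.trans (≡.cong (_- c) H-a) (∁-delete (x∈p∧x≢y⇒x∈p-y c∈ (b≢c ∘ ≡.sym)))
        H-b-c : H - b - c ≡ ∁ (X - a)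
        H-b-c = ≡.trans (≡.cong (_- c) H-b) (∁-delete c∈a)
        H-a-b-c : H - a - b - c ≡ ∁ X
        H-a-b-c = ≡.trans (≡.cong (_- c) H-a-b) (∁-delete c∈)

    nice⇒extreme : ∀ {X} → Nice X → Extreme X
    nice⇒extreme {X} (1<∣X∣ , pairs) = nice⇒extreme′ ∣ X ∣ X ℕ.≤-refl 1<∣X∣ pairs


    MaximalSet : (Subset n → Set) → Subset n → Set
    MaximalSet P X = P X × (∀ Y → X ⊂ Y → ¬ P Y)

    -- Tutte sets are extreme, and every extreme set lies in a Tutte set. Hence the two families
    -- have the same maximal members.
    maximalTutte⇔maximalExtreme : ∀ X → MaximalSet Tutte X ⇔ MaximalSet Extreme X
    maximalTutte⇔maximalExtreme X = mk⇔ to from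
      where
      to : MaximalSet Tutte X → MaximalSet Extreme X
      to (tutte , maximal) = tutte⇒extreme tutte , λ Y X⊂Y ext →
        let Z , Y⊆Z , tutteZ = extreme⇒tutte ext in maximal Z (⊂-⊆-trans X⊂Y Y⊆Z) tutteZ
      from : MaximalSet Extreme X → MaximalSet Tutte X
      from (ext , maximal) = tutte , λ Y X⊂Y tutteY → maximal Y X⊂Y (tutte⇒extreme tutteY)
        where
        tutte : Tutte X
        tutte with extreme⇒tutte ext
        ... | Z , X⊆Z , tutteZ = ≡.subst Tutte (⊆-antisym Z⊆X X⊆Z) tutteZ
          where
          Z⊆X : Z ⊆ X
          Z⊆X {x} x∈Z with x ∈? X
          ... | yes x∈X = x∈X
          ... | no x∉X  = ⊥-elim (maximal Z (X⊆Z , x , x∈Z , x∉X) (tutte⇒extreme tutteZ))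

    -- Among sets with more than one vertex the two properties agree, and every set containing X has
    -- more than one vertex.
    maximalExtreme⇔maximalNice : ∀ X → 1 < ∣ X ∣ → MaximalSet Extreme X ⇔ MaximalSet Nice X
    maximalExtreme⇔maximalNice X 1<∣X∣ = mk⇔
      (λ { (ext , maximal) → extreme⇒nice 1<∣X∣ ext , λ Y X⊂Y nice → maximal Y X⊂Y (nice⇒extreme nice) })
      (λ { (nice , maximal) → nice⇒extreme nice , λ Y X⊂Y ext →
             maximal Y X⊂Y (extreme⇒nice (ℕ.<-trans 1<∣X∣ (p⊂q⇒∣p∣<∣q∣ X⊂Y)) ext) })

theorem3p6 : (R : RealField) (n : ℕ) (G : Graph n) (θ : RealField.Carrier R)
    (X : Subset n) → 1 < ∣ X ∣ →
    let open WithReals R in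
    (Maximal G θ (IsTutte G θ) X ⇔ Maximal G θ (IsExtreme G θ) X)
    × (Maximal G θ (IsExtreme G θ) X ⇔ Maximal G θ (IsNice G θ) X)
theorem3p6 R n G θ X 1<∣X∣ =
    mk⇔ (λ { (tutte , maximal) → to tutte-extreme (fromTutte tutte , λ Y X⊂Y → maximal Y X⊂Y ∘ toTutte) })
        (λ ext → let tutte , maximal = from tutte-extreme ext in toTutte tutte , λ Y X⊂Y → maximal Y X⊂Y ∘ fromTutte)
  -- `IsExtreme` and `IsNice` unfold to `Extreme` and `Nice`; only Tutte sets have to be translated,
  -- by `cθ-sum`.
  , maximalExtreme⇔maximalNice X 1<∣X∣
  where
  open WithReals R
  open Taylor R θ using (F; F-recursive; F-⊥; ord-mult)
  open Critical R G θ using (critical⁻; critical⁺)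
  open Extremal R G θ
  open TutteSets (F G) (F-recursive G) (F-⊥ G) (mult G θ) (ord-mult G) (criticalB G θ) critical⁻ critical⁺
  open Reps R G θ using (cθ-sum)
  open Equivalence using (to; from)
  tutte-extreme = maximalTutte⇔maximalExtreme X
  fromTutte : ∀ {Y} → IsTutte G θ Y → Tutte Y
  fromTutte {Y} = ≡.trans (≡.sym (cθ-sum (∁ Y)))
  toTutte : ∀ {Y} → Tutte Y → IsTutte G θ Y
  toTutte {Y} = ≡.trans (cθ-sum (∁ Y))
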